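{- Let $n\ge3$ and $u\ge2$ be integers with $\gcd(u,n)=1$, and let $a$ be a square-free rational integer such that every prime divisor of $n$ divides $a$. Let $F(x)=x^n-a^u\in\mathbb{Z}[x]$. Then $F(x)$ is irreducible over $\mathbb{Q}$. Moreover, letting $K=\mathbb{Q}(\alpha)$ with $\alpha$ a root of $F(x)$ and $\mathbb{Z}_K$ the ring of integers of $K$: (1) $\mathbb{Z}[\alpha]\neq\mathbb{Z}_K$; (2) there exists $\theta\in\mathbb{Z}_K$ with $K=\mathbb{Q}(\theta)$ and $\mathbb{Z}_K=\mathbb{Z}[\theta]$; that is, $K$ is monogenic.
   Context: A number field $K$ is monogenic if there is $\theta\in\mathbb{Z}_K$ such that $\{1,\theta,\dots,\theta^{[K:\mathbb{Q}]-1}\}$ is a $\mathbb{Z}$-basis of $\mathbb{Z}_K$. -}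

module Defs where

open import Level using (Level; 0ℓ; _⊔_) renaming (suc to lsuc)
open import Algebra.Apartness.Bundles using (HeytingField)
open import Algebra.Bundles using (CommutativeRing)
open import Algebra.Bundles.Raw using (RawRing; RawSemiring)
open import Algebra.Morphism.Structures using (IsRingHomomorphism)
import Algebra.Definitions.RawSemiring as RawSemiringDefs
open import Data.Fin.Base using (Fin; toℕ)
open import Data.Integer.Base as ℤ using (ℤ)
import Data.Integer.Divisibility as ℤ
open import Data.List.Base using (List; []; _∷_; map)
open import Data.Nat.Base using (ℕ; zero; suc; _<_)
open import Data.Product.Base using (Σ-syntax; ∃-syntax; _×_)
open import Data.Rational.Base as ℚ using (ℚ)
open import Data.Rational.Literals using (fromℤ)
open import Data.Vec.Functional using (Vector)
open import Relation.Unary using (Pred; _∈_; U)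

SquareFree : ℤ → Set
SquareFree a = ∀ d → (d ℤ.* d) ℤ.∣ a → d ℤ.∣ ℤ.1ℤ

-- A polynomial is its list of coefficients, constant term first.  Trailing
-- zeros are allowed, so polynomials are compared coefficientwise by _≈ₚ_.
module Polynomial {c ℓ : Level} (R : RawRing c ℓ) where
  open RawRing R

  Poly : Set c
  Poly = List Carrier

  coeff : Poly → ℕ → Carrier
  coeff []      _       = 0#
  coeff (a ∷ p) zero    = a
  coeff (a ∷ p) (suc i) = coeff p i

  infix  4 _≈ₚ_
  infixl 6 _+ₚ_
  infixl 7 _*ₚ_

  _≈ₚ_ : Poly → Poly → Set ℓ
  p ≈ₚ q = ∀ i → coeff p i ≈ coeff q i

  _+ₚ_ : Poly → Poly → Poly
  []      +ₚ q       = q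
  (a ∷ p) +ₚ []      = a ∷ p
  (a ∷ p) +ₚ (b ∷ q) = (a + b) ∷ (p +ₚ q)

  -ₚ_ : Poly → Poly
  -ₚ_ = map -_

  _*ₚ_ : Poly → Poly → Poly
  []      *ₚ q = []
  (a ∷ p) *ₚ q = map (a *_) q +ₚ (0# ∷ (p *ₚ q))

  polyRawRing : RawRing c ℓ
  polyRawRing = record
    { Carrier = Poly
    ; _≈_     = _≈ₚ_
    ; _+_     = _+ₚ_
    ; _*_     = _*ₚ_
    ; -_      = -ₚ_
    ; 0#      = []
    ; 1#      = 1# ∷ []
    }

  const : Carrier → Poly
  const a = a ∷ []

  X : Poly
  X = 0# ∷ 1# ∷ []

  Monic : Poly → Set ℓ
  Monic p = ∃[ d ] (coeff p d ≈ 1#) × (∀ i → d < i → coeff p i ≈ 0#)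

ℤ[x] ℚ[x] : RawRing 0ℓ 0ℓ
ℤ[x] = Polynomial.polyRawRing ℤ.+-*-rawRing
ℚ[x] = Polynomial.polyRawRing ℚ.+-*-rawRing

ℤ[x]→ℚ[x] : RawRing.Carrier ℤ[x] → RawRing.Carrier ℚ[x]
ℤ[x]→ℚ[x] = map fromℤ

Irreducibleℚ : RawRing.Carrier ℚ[x] → Set
Irreducibleℚ = RawSemiringDefs.Irreducible (RawRing.rawSemiring ℚ[x])

xⁿ-aᵘ : (n u : ℕ) (a : ℤ) → RawRing.Carrier ℤ[x]
xⁿ-aᵘ n u a = (X ^ n) +ₚ (-ₚ const (a ℤ.^ u))
  where
  open Polynomial ℤ.+-*-rawRing
  open RawSemiringDefs (RawRing.rawSemiring ℤ[x]) using (_^_)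

-- A field containing ℚ.  Fields are Heyting fields (x # y iff x - y is
-- invertible, and _#_ is tight); classically these are the usual fields.
record FieldExtension (c ℓ₁ ℓ₂ : Level) : Set (lsuc (c ⊔ ℓ₁ ⊔ ℓ₂)) where
  field
    heytingField : HeytingField c ℓ₁ ℓ₂

  open HeytingField heytingField public

  commutativeRing : CommutativeRing c ℓ₁
  commutativeRing = record { isCommutativeRing = isCommutativeRing }

  open CommutativeRing commutativeRing public using (rawRing)

  field
    ι      : ℚ → Carrier
    ι-homo : IsRingHomomorphism ℚ.+-*-rawRing rawRing ι

  ιℤ : ℤ → Carrier
  ιℤ z = ι (fromℤ z)

  open RawSemiringDefs (RawRing.rawSemiring rawRing) using (_^_; sum)

  infix 10 _⟨_⟩

  _⟨_⟩ : List ℤ → Carrier → Carrier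
  []      ⟨ x ⟩ = 0#
  (a ∷ p) ⟨ x ⟩ = ιℤ a + x * (p ⟨ x ⟩)

  -- The subring ℤ[θ].
  ℤ[_] : Carrier → Pred Carrier ℓ₁
  ℤ[ θ ] x = ∃[ p ] x ≈ p ⟨ θ ⟩

  -- The subfield ℚ(θ): the smallest subfield containing ℚ and θ.
  data ℚ⟨_⟩ (θ : Carrier) : Pred Carrier (c ⊔ ℓ₁) where
    rational  : ∀ q → ℚ⟨ θ ⟩ (ι q)
    generator : ℚ⟨ θ ⟩ θ
    add       : ∀ {x y} → ℚ⟨ θ ⟩ x → ℚ⟨ θ ⟩ y → ℚ⟨ θ ⟩ (x + y)
    neg       : ∀ {x} → ℚ⟨ θ ⟩ x → ℚ⟨ θ ⟩ (- x)
    mul       : ∀ {x y} → ℚ⟨ θ ⟩ x → ℚ⟨ θ ⟩ y → ℚ⟨ θ ⟩ (x * y)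
    inv       : ∀ {x y} → ℚ⟨ θ ⟩ x → x * y ≈ 1# → ℚ⟨ θ ⟩ y
    resp      : ∀ {x y} → x ≈ y → ℚ⟨ θ ⟩ x → ℚ⟨ θ ⟩ y

  -- The ring of integers: roots of monic integer polynomials.
  𝒪 : Pred Carrier ℓ₁
  𝒪 x = ∃[ p ] Polynomial.Monic ℤ.+-*-rawRing p × (p ⟨ x ⟩ ≈ 0#)

  -- v is a basis of S over the ring R, whose elements act on the field by
  -- multiplication through φ.
  record IsBasis (R : RawRing 0ℓ 0ℓ) (φ : RawRing.Carrier R → Carrier)
                 {ℓ : Level} (S : Pred Carrier ℓ)
                 {d : ℕ} (v : Vector Carrier d) : Set (c ⊔ ℓ₁ ⊔ ℓ) where
    private module R = RawRing R
    field
      member      : ∀ i → v i ∈ S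
      spanning    : ∀ {x} → x ∈ S →
                    Σ[ k ∈ Vector R.Carrier d ] x ≈ sum (λ i → φ (k i) * v i)
      independent : ∀ (k : Vector R.Carrier d) →
                    sum (λ i → φ (k i) * v i) ≈ 0# → ∀ i → k i R.≈ R.0#

  -- [K : ℚ] = d.
  HasDegree : ℕ → Set (c ⊔ ℓ₁)
  HasDegree d = Σ[ v ∈ Vector Carrier d ] IsBasis ℚ.+-*-rawRing ι U v

  Monogenic : Set (c ⊔ ℓ₁)
  Monogenic = ∃[ d ] HasDegree d × (∃[ θ ] (θ ∈ 𝒪) ×
    IsBasis ℤ.+-*-rawRing ιℤ 𝒪 {d} (λ i → θ ^ toℕ i))

{-# OPTIONS --safe #-}

-- Choose r, s with u r = 1 + s n and put θ = αʳ / aˢ.  Then θⁿ = a and θᵘ = α, so ℚ(α) = ℚ(θ), and θ is a root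
-- of xⁿ - a, which is Eisenstein at every prime dividing a, hence at every prime dividing n.  It is shown
-- that R = ℤ[θ] is integrally closed.  Let y be integral and p y ∈ R.  Some N ≠ 0 satisfies N yᵏ ∈ R for all k.
-- If p ∣ a, the elements of R have a θ-adic valuation at p, which is additive because an element of θR ∩ ℤ is
-- divisible by p; boundedness of N yᵏ forces y ∈ R.  If p ∤ a, then p ∤ n, and (p y)ᵏ ∈ pR for large k; the
-- Frobenius map on R/pR permutes the lines spanned by the powers of θ, so R/pR is reduced and p y ∈ pR.
-- The same valuation shows that R is a domain with basis 1, θ, …, θⁿ⁻¹.  A factorisation of xⁿ - aᵘ over ℚ has a
-- factor vanishing at α = θᵘ, and this factor has degree at least n since u permutes the exponents modulo n.
-- Finally θ ∈ ℤ[α] ⊆ ℤ + θ²R is impossible.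
module Submission where

open import Defs
open import Algebra.Bundles using (CommutativeRing)
open import Algebra.Bundles.Raw using (RawRing)
import Algebra.Definitions.RawSemiring as RawSemiringDefs
open import Algebra.Morphism.Structures using (IsRingHomomorphism)
import Algebra.Properties.CommutativeSemiring.Binomial as Binomial
import Algebra.Properties.CommutativeSemiring.Exp as CommutativeExp
import Algebra.Properties.Ring as RingProperties
import Algebra.Properties.Semiring.Exp as Exp
import Algebra.Properties.Semiring.Mult as Mult
import Algebra.Properties.Semiring.Sum as Summation
import Algebra.Solver.Ring as Solver
open import Algebra.Solver.Ring.AlmostCommutativeRing using (fromCommutativeRing; _-Raw-AlmostCommutative⟶_)
open import Data.Fin.Base as Fin using (Fin; zero; suc; toℕ)
open import Data.Fin.Permutation using (permutation)
import Data.Fin.Properties as Fin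
open import Data.Integer.Base as ℤ using (ℤ; +_; 0ℤ; 1ℤ)
import Data.Integer.Divisibility as ℤ
open import Data.Integer.Divisibility.Signed as ℤᵈ using (divides; ∣ᵤ⇒∣; ∣⇒∣ᵤ) renaming (_∣_ to _∣ₛ_)
import Data.Integer.Properties as ℤ
open import Data.List.Base as List using ([]; _∷_)
open import Data.List.Relation.Unary.All using (All; []; _∷_)
open import Data.Maybe.Base as Maybe using ()
open import Data.Nat.Base as ℕ using (ℕ; zero; suc; _≤_; s≤s; z≤n)
open import Data.Nat.Combinatorics using (_C_; nCk≡n!/k![n-k]!; k![n∸k]!∣n!; nCn≡1)
import Data.Nat.Divisibility as ℕ
open import Data.Nat.Divisibility using (_∣_)
import Data.Nat.DivMod as ℕ
open import Data.Nat.GCD as ℕ using (gcd; GCD; gcd-GCD; module Bézout)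
open import Data.Nat.ListAction using (product)
open import Data.Nat.Primality using (Prime; euclidsLemma; ¬prime[1]; prime⇒irreducible; prime⇒nonTrivial; prime⇒nonZero)
open import Data.Nat.Primality.Factorisation using (PrimeFactorisation; factorise)
import Data.Nat.Properties as ℕ
open import Data.Product.Base using (∃-syntax; Σ-syntax; _×_; _,_; proj₁; proj₂)
open import Data.Rational.Base as ℚ using (ℚ; 0ℚ; 1ℚ)
open import Data.Rational.Literals using (fromℤ)
import Data.Rational.Properties as ℚ
import Data.Rational.Solver
import Data.Rational.Unnormalised.Base as ℚᵘ
import Data.Rational.Unnormalised.Properties as ℚᵘ
open import Data.Sum.Base as Sum using (_⊎_; inj₁; inj₂; [_,_]′)
open import Data.Unit.Base using (tt)
open import Data.Vec.Base as Vec using (Vec; []; _∷_; lookup; tabulate)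
import Data.Vec.Properties as Vec
open import Level using (0ℓ; _⊔_) renaming (suc to lsuc)
open import Relation.Binary.Consequences using (dec⇒weaklyDec)
open import Relation.Binary.Definitions using (Symmetric)
open import Relation.Binary.PropositionalEquality as ≡ using (_≡_; _≢_; cong; cong₂; subst)
import Relation.Binary.Reasoning.Setoid as ≈-Reasoning
open import Relation.Nullary.Decidable using (yes; no; decidable-stable)
open import Relation.Nullary.Negation using (¬_; contradiction)
open import Relation.Unary using (_∈_; _≐_; U)

-- Integers and rationals

-- Irreducibility has to be shown before any field containing θ is at hand, since ℚ[x]/(xⁿ - a) is
-- known to be a field only afterwards. The arithmetic of R is therefore developed over an arbitrary
-- nontrivial commutative ℚ-algebra with θⁿ = a; it is applied once to a model of this quotient and
-- once to K. Division is replaced by cancellation of nonzero integers and of θ, a factor of the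
-- nonzero integer a. Equality in the algebra is not assumed decidable, so case distinctions are
-- made on integer or rational coefficients, and the valuation appears through explicit equations
-- rather than as a function.
--
-- That p divides the elements of θR ∩ ℤ cannot be read off coordinates, because the independence of
-- the powers of θ is itself derived from it. It rests on integrality: if w = -θ r with r in R, then
-- a rⁿ = (-w)ⁿ with rⁿ integral, and the rational root theorem makes p divide w.
--
-- Since n ≥ 2 has a prime divisor, the hypothesis on the primes of n also supplies an Eisenstein
-- prime, from which independence and the domain property are deduced.

fromℤ-+ : ∀ x y → fromℤ (x ℤ.+ y) ≡ fromℤ x ℚ.+ fromℤ y
fromℤ-+ x y = ℚ.toℚᵘ-injective (ℚᵘ.≃-trans
  (ℚᵘ.*≡* (cong (ℤ._* 1ℤ) (≡.sym (cong₂ ℤ._+_ (ℤ.*-identityʳ x) (ℤ.*-identityʳ y)))))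
  (ℚᵘ.≃-sym (ℚ.toℚᵘ-homo-+ (fromℤ x) (fromℤ y))))

fromℤ-* : ∀ x y → fromℤ (x ℤ.* y) ≡ fromℤ x ℚ.* fromℤ y
fromℤ-* x y = ℚ.toℚᵘ-injective (ℚᵘ.≃-sym (ℚ.toℚᵘ-homo-* (fromℤ x) (fromℤ y)))

fromℤ-neg : ∀ x → fromℤ (ℤ.- x) ≡ ℚ.- fromℤ x
fromℤ-neg x = ℚ.toℚᵘ-injective (ℚᵘ.≃-sym (ℚ.toℚᵘ-homo‿- (fromℤ x)))

fromℤ-injective : ∀ {x y} → fromℤ x ≡ fromℤ y → x ≡ y
fromℤ-injective ≡.refl = ≡.refl

denominator-clears : ∀ q → fromℤ (ℚ.↧ q) ℚ.* q ≡ fromℤ (ℚ.↥ q)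
denominator-clears q@(ℚ.mkℚ n d _) = ℚ.toℚᵘ-injective (ℚᵘ.≃-trans
  (ℚ.toℚᵘ-homo-* (fromℤ (ℚ.↧ q)) q)
  (ℚᵘ.*≡* (≡.trans (ℤ.*-identityʳ _) (≡.trans (ℤ.*-comm (ℚ.↧ q) n)
    (cong (λ k → n ℤ.* + suc k) (≡.sym (ℕ.+-identityʳ d)))))))

*-≢0 : ∀ {x y} → x ≢ 0ℤ → y ≢ 0ℤ → x ℤ.* y ≢ 0ℤ
*-≢0 {x} x≢0 y≢0 xy≡0 = [ x≢0 , y≢0 ]′ (ℤ.i*j≡0⇒i≡0∨j≡0 x xy≡0)

^-≢0 : ∀ {x} → x ≢ 0ℤ → ∀ k → x ℤ.^ k ≢ 0ℤ
^-≢0 x≢0 zero    ()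
^-≢0 x≢0 (suc k) = *-≢0 x≢0 (^-≢0 x≢0 k)

module _ {p : ℕ} (pr : Prime p) where

  prime≢0 : + p ≢ 0ℤ
  prime≢0 p≡0 = ℕ.≢-nonZero⁻¹ p {{prime⇒nonZero pr}} (ℤ.+-injective p≡0)

  prime∤1 : ¬ (+ p ∣ₛ 1ℤ)
  prime∤1 p∣1 = ¬prime[1] (subst Prime (ℕ.∣1⇒≡1 (∣⇒∣ᵤ p∣1)) pr)

  prime∣* : ∀ x y → + p ∣ₛ x ℤ.* y → + p ∣ₛ x ⊎ + p ∣ₛ y
  prime∣* x y p∣xy = Sum.map ∣ᵤ⇒∣ ∣ᵤ⇒∣
    (euclidsLemma ℤ.∣ x ∣ ℤ.∣ y ∣ pr (subst (p ℕ.∣_) (ℤ.abs-* x y) (∣⇒∣ᵤ p∣xy)))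

  prime∤* : ∀ {x y} → ¬ (+ p ∣ₛ x) → ¬ (+ p ∣ₛ y) → ¬ (+ p ∣ₛ x ℤ.* y)
  prime∤* p∤x p∤y p∣xy = [ p∤x , p∤y ]′ (prime∣* _ _ p∣xy)

  prime∣^ : ∀ x k → + p ∣ₛ x ℤ.^ k → + p ∣ₛ x
  prime∣^ x zero    p∣1 = contradiction p∣1 prime∤1
  prime∣^ x (suc k) p∣  = [ (λ p∣x → p∣x) , prime∣^ x k ]′ (prime∣* x _ p∣)

  prime^∣* : ∀ k x y → ¬ (+ p ∣ₛ y) → (+ p) ℤ.^ k ∣ₛ x ℤ.* y → (+ p) ℤ.^ k ∣ₛ x
  prime^∣* zero    x y p∤y _ = divides x (≡.sym (ℤ.*-identityʳ x))
  prime^∣* (suc k) x y p∤y pᵏ∣xy with prime∣* x y (ℤᵈ.∣-trans (ℤᵈ.∣m⇒∣m*n _ ℤᵈ.∣-refl) pᵏ∣xy)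
  ... | inj₂ p∣y = contradiction p∣y p∤y
  ... | inj₁ (divides x′ ≡.refl) = subst (_ ∣ₛ_) (ℤ.*-comm (+ p) x′)
    (ℤᵈ.*-monoʳ-∣ (+ p) (prime^∣* k x′ y p∤y
      (ℤᵈ.*-cancelˡ-∣ (+ p) {{prime⇒nonZero pr}} (subst (_ ∣ₛ_) eq pᵏ∣xy))))
    where
    eq : x′ ℤ.* + p ℤ.* y ≡ + p ℤ.* (x′ ℤ.* y)
    eq = ≡.trans (cong (ℤ._* y) (ℤ.*-comm x′ (+ p))) (ℤ.*-assoc (+ p) x′ y)

  prime^≡ : ∀ k → ℤ.∣ (+ p) ℤ.^ k ∣ ≡ p ℕ.^ k
  prime^≡ zero    = ≡.refl
  prime^≡ (suc k) = ≡.trans (ℤ.abs-* (+ p) _) (cong (p ℕ.*_) (prime^≡ k))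

  n<prime^n : ∀ n → n ℕ.< p ℕ.^ n
  n<prime^n zero    = s≤s z≤n
  n<prime^n (suc n) = ℕ.<-≤-trans (ℕ.≤-<-trans (n<prime^n n)
      (ℕ.m<m*n (p ℕ.^ n) p {{ℕ.m^n≢0 p n {{prime⇒nonZero pr}}}} (ℕ.nonTrivial⇒n>1 p {{prime⇒nonTrivial pr}})))
    (ℕ.≤-reflexive (ℕ.*-comm (p ℕ.^ n) p))

  -- Since |x| < p^|x|, the absolute value is an explicit bound for the exponent of p in x. It
  -- serves as recursion measure, and as a concrete exponent, wherever repeated division by p must
  -- stop.
  prime^∤ : ∀ {x} → x ≢ 0ℤ → ¬ ((+ p) ℤ.^ ℤ.∣ x ∣ ∣ₛ x)
  prime^∤ {x} x≢0 pᵏ∣x = ℕ.<⇒≱ (n<prime^n ℤ.∣ x ∣)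
    (subst (ℕ._≤ ℤ.∣ x ∣) (prime^≡ ℤ.∣ x ∣)
      (ℕ.∣⇒≤ {{ℤ.≢-nonZero x≢0}} (∣⇒∣ᵤ pᵏ∣x)))

  prime^-split : ∀ {x} → x ≢ 0ℤ → ∃[ e ] ∃[ x′ ] x ≡ (+ p) ℤ.^ e ℤ.* x′ × ¬ (+ p ∣ₛ x′)
  prime^-split {x} x≢0 = go ℤ.∣ x ∣ x (prime^∤ x≢0)
    where
    go : ∀ k x → ¬ ((+ p) ℤ.^ k ∣ₛ x) → ∃[ e ] ∃[ x′ ] x ≡ (+ p) ℤ.^ e ℤ.* x′ × ¬ (+ p ∣ₛ x′)
    go zero    x 1∤x = contradiction (divides x (≡.sym (ℤ.*-identityʳ x))) 1∤x
    go (suc k) x pᵏ∤x with + p ℤᵈ.∣? x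
    ... | no p∤x = 0 , x , ≡.sym (ℤ.*-identityˡ x) , p∤x
    ... | yes (divides x′ ≡.refl) with go k x′ (λ pᵏ∣x′ → pᵏ∤x (subst (_ ∣ₛ_) (ℤ.*-comm (+ p) x′) (ℤᵈ.*-monoʳ-∣ (+ p) pᵏ∣x′)))
    ...   | e , x″ , ≡.refl , p∤x″ = suc e , x″ ,
      ≡.trans (ℤ.*-comm _ (+ p)) (≡.sym (ℤ.*-assoc (+ p) ((+ p) ℤ.^ e) x″)) , p∤x″

  private
    prime∤! : ∀ k → k ℕ.< p → ¬ (p ℕ.∣ k ℕ.!)
    prime∤! zero    _   p∣1 = ¬prime[1] (subst Prime (ℕ.∣1⇒≡1 p∣1) pr)
    prime∤! (suc k) k<p p∣  = [ (λ p∣k → ℕ.<⇒≱ k<p (ℕ.∣⇒≤ p∣k)) , prime∤! k (ℕ.<⇒≤ k<p) ]′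
      (euclidsLemma (suc k) (k ℕ.!) pr p∣)

  -- The prime p divides p! = (p C k) k! (p - k)!, but neither of the two factorials, whose factors
  -- are all smaller than p.
  prime∣pCk : ∀ k → 0 ℕ.< k → k ℕ.< p → p ℕ.∣ (p C k)
  prime∣pCk k 0<k k<p with euclidsLemma (p C k) (k ℕ.! ℕ.* (p ℕ.∸ k) ℕ.!) pr p∣
    where
    instance _ = k ℕ.!* (p ℕ.∸ k) !≢0
    p∣p! : ∀ {q} → 0 ℕ.< q → q ℕ.∣ q ℕ.!
    p∣p! {suc q} _ = ℕ.m∣m*n (q ℕ.!)
    p∣ : p ℕ.∣ (p C k) ℕ.* (k ℕ.! ℕ.* (p ℕ.∸ k) ℕ.!)
    p∣ = subst (p ℕ.∣_)
      (≡.sym (≡.trans (cong (ℕ._* (k ℕ.! ℕ.* (p ℕ.∸ k) ℕ.!)) (nCk≡n!/k![n-k]! (ℕ.<⇒≤ k<p))) (ℕ.m/n*n≡m (k![n∸k]!∣n! (ℕ.<⇒≤ k<p)))))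
      (p∣p! (ℕ.<-trans 0<k k<p))
  ... | inj₁ p∣C = p∣C
  ... | inj₂ p∣! = contradiction p∣! λ p∣! →
    [ prime∤! k k<p , prime∤! (p ℕ.∸ k) (ℕ.∸-monoʳ-< 0<k (ℕ.<⇒≤ k<p)) ]′ (euclidsLemma (k ℕ.!) _ pr p∣!)

gcd≡1⇒inverse : ∀ k n → 2 ℕ.≤ n → ℕ.gcd k n ≡ 1 → ∃[ r ] ∃[ s ] k ℕ.* r ≡ 1 ℕ.+ s ℕ.* n
gcd≡1⇒inverse k n 2≤n gcd≡1 with Bézout.identity (subst (GCD k n) gcd≡1 (gcd-GCD k n))
... | Bézout.+- x y eq = x , y , ≡.trans (ℕ.*-comm k x) (≡.sym eq)
... | Bézout.-+ x y eq with x ℕ.* k in xk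
...   | zero  = contradiction (ℕ.m*n≡1⇒n≡1 y n (≡.sym eq)) λ where ≡.refl → ℕ.<⇒≱ 2≤n (s≤s z≤n)
-- Here x k = j + 1 is -1 modulo n, so its square k (x (x k)) is 1: explicitly (j + 1)² = 1 + j (j +
-- 2), and j + 2 = y n.
...   | suc j = x ℕ.* suc j , j ℕ.* y , (begin
  k ℕ.* (x ℕ.* suc j)         ≡⟨ ℕ.*-assoc k x (suc j) ⟨
  k ℕ.* x ℕ.* suc j           ≡⟨ cong (ℕ._* suc j) (≡.trans (ℕ.*-comm k x) xk) ⟩
  suc j ℕ.* suc j             ≡⟨ cong suc (≡.cong (j ℕ.+_) (ℕ.*-comm j (suc j))) ⟩
  suc (j ℕ.+ (j ℕ.+ j ℕ.* j)) ≡⟨ cong suc (≡.sym (≡.trans (ℕ.*-suc j (suc j)) (cong (j ℕ.+_) (ℕ.*-suc j j)))) ⟩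
  suc (j ℕ.* (2 ℕ.+ j))       ≡⟨ cong (λ w → suc (j ℕ.* w)) eq ⟩
  suc (j ℕ.* (y ℕ.* n))       ≡⟨ cong suc (ℕ.*-assoc j y n) ⟨
  suc (j ℕ.* y ℕ.* n)         ∎)
  where open ≡.≡-Reasoning

mulMod : ∀ {m} → ℕ → Fin (suc m) → Fin (suc m)
mulMod {m} k i = Fin.fromℕ< (ℕ.m%n<n (k ℕ.* toℕ i) (suc m))

toℕ-mulMod : ∀ {m} k (i : Fin (suc m)) → toℕ (mulMod k i) ≡ (k ℕ.* toℕ i) ℕ.% suc m
toℕ-mulMod {m} k i = Fin.toℕ-fromℕ< (ℕ.m%n<n (k ℕ.* toℕ i) (suc m))

mulMod-inverse : ∀ {m k r s} → k ℕ.* r ≡ 1 ℕ.+ s ℕ.* suc m → ∀ (i : Fin (suc m)) → mulMod k (mulMod r i) ≡ i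
mulMod-inverse {m} {k} {r} {s} kr≡1 i = Fin.toℕ-injective (begin
  toℕ (mulMod k (mulMod r i))                ≡⟨ toℕ-mulMod k (mulMod r i) ⟩
  (k ℕ.* toℕ (mulMod r i)) ℕ.% n             ≡⟨ cong (λ w → (k ℕ.* w) ℕ.% n) (toℕ-mulMod r i) ⟩
  (k ℕ.* ((r ℕ.* toℕ i) ℕ.% n)) ℕ.% n        ≡⟨ ℕ.%-distribˡ-* k _ n ⟩
  ((k ℕ.% n) ℕ.* ((r ℕ.* toℕ i) ℕ.% n ℕ.% n)) ℕ.% n  ≡⟨ cong (λ w → ((k ℕ.% n) ℕ.* w) ℕ.% n) (ℕ.m%n%n≡m%n (r ℕ.* toℕ i) n) ⟩
  ((k ℕ.% n) ℕ.* ((r ℕ.* toℕ i) ℕ.% n)) ℕ.% n  ≡⟨ ℕ.%-distribˡ-* k (r ℕ.* toℕ i) n ⟨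
  (k ℕ.* (r ℕ.* toℕ i)) ℕ.% n                ≡⟨ cong (ℕ._% n) (≡.trans (≡.sym (ℕ.*-assoc k r (toℕ i))) (cong (ℕ._* toℕ i) kr≡1)) ⟩
  (toℕ i ℕ.+ s ℕ.* n ℕ.* toℕ i) ℕ.% n        ≡⟨ cong (λ w → (toℕ i ℕ.+ w) ℕ.% n)
    (≡.trans (ℕ.*-assoc s n (toℕ i)) (≡.trans (cong (s ℕ.*_) (ℕ.*-comm n (toℕ i))) (≡.sym (ℕ.*-assoc s (toℕ i) n)))) ⟩
  (toℕ i ℕ.+ s ℕ.* toℕ i ℕ.* n) ℕ.% n        ≡⟨ ℕ.[m+kn]%n≡m%n (toℕ i) (s ℕ.* toℕ i) n ⟩
  toℕ i ℕ.% n                                ≡⟨ ℕ.m<n⇒m%n≡m (Fin.toℕ<n i) ⟩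
  toℕ i                                      ∎)
  where
  open ≡.≡-Reasoning
  n = suc m

squarefree⇒≢0 : ∀ {a} → SquareFree a → a ≢ 0ℤ
squarefree⇒≢0 sf ≡.refl = contradiction (sf (+ 2) (ℕ.divides 0 ≡.refl)) λ 2∣1 → contradiction (ℕ.∣1⇒≡1 2∣1) λ ()

squarefree⇒p∤quotient : ∀ {a p} → SquareFree a → Prime p → (p∣a : + p ∣ₛ a) → ¬ (+ p ∣ₛ _∣ₛ_.quotient p∣a)
squarefree⇒p∤quotient {p = p} sf pr (divides _ ≡.refl) (divides q ≡.refl) =
  prime∤1 pr (∣ᵤ⇒∣ (sf (+ p) (∣⇒∣ᵤ (divides q (ℤ.*-assoc q (+ p) (+ p))))))

prime-coprime : ∀ {p n} → Prime p → ¬ (p ℕ.∣ n) → ℕ.gcd p n ≡ 1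
prime-coprime {p} {n} pr p∤n with prime⇒irreducible pr (ℕ.gcd[m,n]∣m p n)
... | inj₁ gcd≡1 = gcd≡1
... | inj₂ gcd≡p = contradiction (subst (ℕ._∣ n) gcd≡p (ℕ.gcd[m,n]∣n p n)) p∤n

prime-divisor : ∀ {n} → 2 ℕ.≤ n → ∃[ p ] Prime p × p ℕ.∣ n
prime-divisor {n} 2≤n with factorise n {{ℕ.>-nonZero (ℕ.<-trans (s≤s z≤n) 2≤n)}}
... | record { factors = [] ; isFactorisation = ≡.refl } = contradiction 2≤n (λ { (s≤s ()) })
... | record { factors = p ∷ ps ; isFactorisation = ≡.refl ; factorsPrime = pr ∷ _ } = p , pr , ℕ.m∣m*n (product ps)

divide-coefficients : ∀ q {d} (v : Vec ℤ d) → (∀ i → q ∣ₛ lookup v i) → ∃[ w ] v ≡ Vec.map (q ℤ.*_) w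
divide-coefficients q []      q∣ = [] , ≡.refl
divide-coefficients q (k ∷ v) q∣ with q∣ zero | divide-coefficients q v (λ i → q∣ (suc i))
... | divides k′ ≡.refl | w , ≡.refl = k′ ∷ w , cong (_∷ _) (ℤ.*-comm k′ q)

-- Commutative ℚ-algebras and their integral elements

record ℚAlgebra c ℓ : Set (lsuc (c ⊔ ℓ)) where
  field
    commutativeRing : CommutativeRing c ℓ
  open CommutativeRing commutativeRing public
  field
    ι          : ℚ → Carrier
    ι-homo     : IsRingHomomorphism ℚ.+-*-rawRing rawRing ι
    nontrivial : ¬ (1# ≈ 0#)

module ℚAlgebraProperties {c ℓ} (A : ℚAlgebra c ℓ) where
  open ℚAlgebra A public hiding (zero)
  open RingProperties ring public using (-‿distribˡ-*; -‿distribʳ-*; -0#≈0#; -‿involutive; x∙y⁻¹≈ε⇒x≈y)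
  open Exp semiring public using (_^_; ^-congˡ; ^-homo-*; ^-assocʳ)
  open CommutativeExp commutativeSemiring public using (^-distrib-*)
  open Summation semiring public using (sum; sum-cong-≋; *-distribˡ-sum; ∑-distrib-+; sum-permute; sum-init-last)
  open ≈-Reasoning setoid public
  open IsRingHomomorphism ι-homo public using ()
    renaming (⟦⟧-cong to ι-cong; +-homo to ι-+; *-homo to ι-*; -‿homo to ι-neg; 0#-homo to ι-0; 1#-homo to ι-1)

  ιℤ : ℤ → Carrier
  ιℤ z = ι (fromℤ z)

  ιℤ-morphism : ℤ.+-*-rawRing -Raw-AlmostCommutative⟶ fromCommutativeRing commutativeRing
  ιℤ-morphism = record
    { ⟦_⟧    = ιℤ
    ; +-homo = λ x y → trans (ι-cong (fromℤ-+ x y)) (ι-+ _ _)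
    ; *-homo = λ x y → trans (ι-cong (fromℤ-* x y)) (ι-* _ _)
    ; -‿homo = λ x → trans (ι-cong (fromℤ-neg x)) (ι-neg _)
    ; 0-homo = ι-0
    ; 1-homo = ι-1
    }
  open _-Raw-AlmostCommutative⟶_ ιℤ-morphism public using ()
    renaming (+-homo to ιℤ-+; *-homo to ιℤ-*; -‿homo to ιℤ-neg)

  open Solver ℤ.+-*-rawRing (fromCommutativeRing commutativeRing) ιℤ-morphism
    (λ x y → Maybe.map (λ x≡y → reflexive (cong ιℤ x≡y)) (dec⇒weaklyDec ℤ._≟_ x y)) public
    using (solve; con; _:=_; _:+_; _:*_; :-_; _:-_)

  ιℤ-cong : ∀ {x y} → x ≡ y → ιℤ x ≈ ιℤ y
  ιℤ-cong x≡y = reflexive (cong ιℤ x≡y)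

  ιℤ-^ : ∀ x k → ιℤ (x ℤ.^ k) ≈ ιℤ x ^ k
  ιℤ-^ x zero    = ι-1
  ιℤ-^ x (suc k) = trans (ιℤ-* x _) (*-congˡ (ιℤ-^ x k))

  ι-inverse : ∀ {q} → q ≢ 0ℚ → ∃[ q⁻¹ ] q⁻¹ ℚ.* q ≡ 1ℚ
  ι-inverse {q} q≢0 = (ℚ.1/ q) {{ℚ.≢-nonZero q≢0}} , ℚ.*-inverseˡ q {{ℚ.≢-nonZero q≢0}}

  ι-cancel : ∀ {q x} → q ≢ 0ℚ → ι q * x ≈ 0# → x ≈ 0#
  ι-cancel {q} {x} q≢0 qx≈0 = let q⁻¹ , q⁻¹q≡1 = ι-inverse q≢0 in begin
    x                   ≈⟨ *-identityˡ x ⟨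
    1# * x              ≈⟨ *-congʳ (trans (ι-cong q⁻¹q≡1) ι-1) ⟨
    ι (q⁻¹ ℚ.* q) * x   ≈⟨ *-congʳ (ι-* q⁻¹ q) ⟩
    ι q⁻¹ * ι q * x     ≈⟨ *-assoc _ _ _ ⟩
    ι q⁻¹ * (ι q * x)   ≈⟨ *-congˡ qx≈0 ⟩
    ι q⁻¹ * 0#          ≈⟨ zeroʳ _ ⟩
    0#                  ∎

  ι-injective : ∀ {q} → ι q ≈ 0# → q ≡ 0ℚ
  ι-injective {q} q≈0 with q ℚ.≟ 0ℚ
  ... | yes q≡0 = q≡0
  ... | no  q≢0 = contradiction (ι-cancel q≢0 (trans (*-identityʳ _) q≈0)) nontrivial

  ιℤ-injective : ∀ {x} → ιℤ x ≈ 0# → x ≡ 0ℤ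
  ιℤ-injective x≈0 = fromℤ-injective (ι-injective x≈0)

  x-y≈0⇒x≈y : ∀ {x y} → x - y ≈ 0# → x ≈ y
  x-y≈0⇒x≈y {x} {y} = x∙y⁻¹≈ε⇒x≈y x y

  x≈y⇒x-y≈0 : ∀ {x y} → x ≈ y → x - y ≈ 0#
  x≈y⇒x-y≈0 {x} {y} x≈y = trans (+-congʳ x≈y) (-‿inverseʳ y)

  ιℤ-injective₂ : ∀ {x y} → ιℤ x ≈ ιℤ y → x ≡ y
  ιℤ-injective₂ {x} {y} x≈y = ℤ.i-j≡0⇒i≡j x y (ιℤ-injective
    (trans (ιℤ-+ x (ℤ.- y)) (trans (+-congˡ (ιℤ-neg y)) (x≈y⇒x-y≈0 x≈y))))

  ιℤ-cancel : ∀ {z x} → z ≢ 0ℤ → ιℤ z * x ≈ 0# → x ≈ 0#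
  ιℤ-cancel z≢0 = ι-cancel (λ z≡0 → z≢0 (fromℤ-injective z≡0))

  cancel-sub : ∀ z {x y} → (∀ {w} → z * w ≈ 0# → w ≈ 0#) → z * x ≈ z * y → x ≈ y
  cancel-sub z {x} {y} cancel zx≈zy = x-y≈0⇒x≈y (cancel (begin
    z * (x - y)     ≈⟨ solve 3 (λ z x y → z :* (x :- y) := z :* x :- z :* y) refl z x y ⟩
    z * x - z * y   ≈⟨ x≈y⇒x-y≈0 zx≈zy ⟩
    0#              ∎))

  ιℤ-cancel₂ : ∀ {z x y} → z ≢ 0ℤ → ιℤ z * x ≈ ιℤ z * y → x ≈ y
  ιℤ-cancel₂ {z} z≢0 = cancel-sub (ιℤ z) (ιℤ-cancel z≢0)

  1^ : ∀ k → 1# ^ k ≈ 1#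
  1^ zero    = refl
  1^ (suc k) = trans (*-identityˡ _) (1^ k)

  x*y≈1⇒cancel : ∀ {x y w} → x * y ≈ 1# → x * w ≈ 0# → w ≈ 0#
  x*y≈1⇒cancel {x} {y} {w} xy≈1 xw≈0 = begin
    w             ≈⟨ *-identityˡ w ⟨
    1# * w        ≈⟨ *-congʳ xy≈1 ⟨
    x * y * w     ≈⟨ solve 3 (λ x y w → x :* y :* w := y :* (x :* w)) refl x y w ⟩
    y * (x * w)   ≈⟨ *-congˡ xw≈0 ⟩
    y * 0#        ≈⟨ zeroʳ y ⟩
    0#            ∎

  ev : ∀ {d} → Vec ℤ d → Carrier → Carrier
  ev []      y = 0#
  ev (k ∷ v) y = ιℤ k + y * ev v y

  ev-0 : ∀ d y → ev (Vec.replicate d 0ℤ) y ≈ 0#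
  ev-0 zero    y = refl
  ev-0 (suc d) y = begin
    ιℤ 0ℤ + y * ev (Vec.replicate d 0ℤ) y  ≈⟨ +-cong ι-0 (*-congˡ (ev-0 d y)) ⟩
    0# + y * 0#                            ≈⟨ trans (+-identityˡ _) (zeroʳ y) ⟩
    0#                                     ∎

  ev-+ : ∀ {d} (v w : Vec ℤ d) y → ev (Vec.zipWith ℤ._+_ v w) y ≈ ev v y + ev w y
  ev-+ []      []      y = sym (+-identityˡ 0#)
  ev-+ (j ∷ v) (k ∷ w) y = begin
    ιℤ (j ℤ.+ k) + y * ev (Vec.zipWith ℤ._+_ v w) y   ≈⟨ +-cong (ιℤ-+ j k) (*-congˡ (ev-+ v w y)) ⟩
    ιℤ j + ιℤ k + y * (ev v y + ev w y)
      ≈⟨ solve 5 (λ j k y v w → j :+ k :+ y :* (v :+ w) := j :+ y :* v :+ (k :+ y :* w)) refl _ _ _ _ _ ⟩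
    ιℤ j + y * ev v y + (ιℤ k + y * ev w y)           ∎

  ev-* : ∀ {d} z (v : Vec ℤ d) y → ev (Vec.map (z ℤ.*_) v) y ≈ ιℤ z * ev v y
  ev-* z []      y = sym (zeroʳ _)
  ev-* z (k ∷ v) y = begin
    ιℤ (z ℤ.* k) + y * ev (Vec.map (z ℤ.*_) v) y   ≈⟨ +-cong (ιℤ-* z k) (*-congˡ (ev-* z v y)) ⟩
    ιℤ z * ιℤ k + y * (ιℤ z * ev v y)
      ≈⟨ solve 4 (λ z k y v → z :* k :+ y :* (z :* v) := z :* (k :+ y :* v)) refl _ _ _ _ ⟩
    ιℤ z * (ιℤ k + y * ev v y)                     ∎

  ev-sum : ∀ {d} (v : Vec ℤ d) y → ev v y ≈ sum (λ i → ιℤ (lookup v i) * y ^ toℕ i)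
  ev-sum []      y = refl
  ev-sum (k ∷ v) y = +-cong (sym (*-identityʳ _)) (begin
    y * ev v y                                              ≈⟨ *-congˡ (ev-sum v y) ⟩
    y * sum (λ i → ιℤ (lookup v i) * y ^ toℕ i)             ≈⟨ *-distribˡ-sum y (λ i → ιℤ (lookup v i) * y ^ toℕ i) ⟩
    sum (λ i → y * (ιℤ (lookup v i) * y ^ toℕ i))
      ≈⟨ sum-cong-≋ (λ i → solve 3 (λ y k z → y :* (k :* z) := k :* (y :* z)) refl y (ιℤ (lookup v i)) (y ^ toℕ i)) ⟩
    sum (λ i → ιℤ (lookup v i) * y ^ suc (toℕ i))           ∎)

  -- The ℤ-module generated by 1, y, ..., y^(d-1), that is, the values at y of the integer
  -- polynomials of degree below d.
  Span : ℕ → Carrier → Carrier → Set ℓ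
  Span d y x = ∃[ v ] x ≈ ev {d} v y

  span-resp : ∀ {d y x x′} → x ≈ x′ → Span d y x → Span d y x′
  span-resp x≈x′ (v , x≈v) = v , trans (sym x≈x′) x≈v

  span-0 : ∀ {d y} → Span d y 0#
  span-0 {d} {y} = Vec.replicate d 0ℤ , sym (ev-0 d y)

  span-+ : ∀ {d y x x′} → Span d y x → Span d y x′ → Span d y (x + x′)
  span-+ (v , x≈v) (w , x′≈w) = Vec.zipWith ℤ._+_ v w , trans (+-cong x≈v x′≈w) (sym (ev-+ v w _))

  span-ιℤ* : ∀ z {d y x} → Span d y x → Span d y (ιℤ z * x)
  span-ιℤ* z (v , x≈v) = Vec.map (z ℤ.*_) v , trans (*-congˡ x≈v) (sym (ev-* z v _))

  span-neg : ∀ {d y x} → Span d y x → Span d y (- x)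
  span-neg {x = x} s = span-resp (solve 1 (λ x → con (ℤ.- 1ℤ) :* x := :- x) refl x) (span-ιℤ* (ℤ.- 1ℤ) s)

  span-∷ : ∀ z {d y x} → Span d y x → Span (suc d) y (ιℤ z + y * x)
  span-∷ z (v , x≈v) = z ∷ v , +-congˡ (*-congˡ x≈v)

  span-y* : ∀ {d y x} → Span d y x → Span (suc d) y (y * x)
  span-y* s = span-resp (trans (+-congʳ ι-0) (+-identityˡ _)) (span-∷ 0ℤ s)

  span-≤ : ∀ {d e y x} → d ℕ.≤ e → Span d y x → Span e y x
  span-≤ z≤n       ([]    , x≈0) = span-resp (sym x≈0) span-0
  span-≤ (s≤s d≤e) (k ∷ v , x≈v) = span-resp (sym x≈v) (span-∷ k (span-≤ d≤e (v , refl)))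

  span-ιℤ : ∀ z {d y} → Span (suc d) y (ιℤ z)
  span-ιℤ z {d} {y} = span-resp (trans (+-congˡ (zeroʳ y)) (+-identityʳ _)) (span-∷ z {d} span-0)

  span-y^* : ∀ k {d y x} → Span d y x → Span (k ℕ.+ d) y (y ^ k * x)
  span-y^* zero    s = span-resp (sym (*-identityˡ _)) s
  span-y^* (suc k) s = span-resp (sym (*-assoc _ _ _)) (span-y* (span-y^* k s))

  span-* : ∀ {d e y x x′} → Span d y x → Span e y x′ → Span (d ℕ.+ e) y (x * x′)
  span-* ([] , x≈0) s = span-resp (sym (trans (*-congʳ x≈0) (zeroˡ _))) span-0
  span-* {suc d} {y = y} {x} {x′} (k ∷ v , x≈v) s = span-resp (begin
    ιℤ k * x′ + y * (ev v y * x′)   ≈⟨ solve 4 (λ k x y v → k :* x :+ y :* (v :* x) := (k :+ y :* v) :* x) refl _ _ _ _ ⟩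
    (ιℤ k + y * ev v y) * x′        ≈⟨ *-congʳ x≈v ⟨
    x * x′                          ∎)
    (span-+ (span-≤ (ℕ.m≤n+m _ (suc d)) (span-ιℤ* k s)) (span-y* (span-* (v , refl) s)))

  span-split : ∀ m {y x} → Span (suc m) y x → ∃[ x′ ] Span m y x′ × (∃[ k ] x ≈ x′ + ιℤ k * y ^ m)
  span-split zero {y} {x} (k ∷ [] , x≈v) = 0# , span-0 , k , (begin
    x                     ≈⟨ x≈v ⟩
    ιℤ k + y * 0#         ≈⟨ +-congˡ (zeroʳ y) ⟩
    ιℤ k + 0#             ≈⟨ +-comm _ _ ⟩
    0# + ιℤ k             ≈⟨ +-congˡ (*-identityʳ _) ⟨
    0# + ιℤ k * 1#        ∎)
  span-split (suc m) {y} {x} (j ∷ v , x≈v) with span-split m (v , refl)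
  ... | x′ , s , k , eq = ιℤ j + y * x′ , span-∷ j s , k , (begin
    x                                       ≈⟨ x≈v ⟩
    ιℤ j + y * ev v y                       ≈⟨ +-congˡ (*-congˡ eq) ⟩
    ιℤ j + y * (x′ + ιℤ k * y ^ m)
      ≈⟨ solve 5 (λ j y x k z → j :+ y :* (x :+ k :* z) := j :+ y :* x :+ k :* (y :* z)) refl _ _ _ _ _ ⟩
    ιℤ j + y * x′ + ιℤ k * (y * y ^ m)      ∎)

  -- A monic integer equation for y of degree m + 1, solved for its leading power. The degree is a
  -- successor so that the module `Span (suc m) y` contains 1 and becomes a ring.
  Closed : ℕ → Carrier → Set ℓ
  Closed m y = Span (suc m) y (y ^ suc m)

  Integral : Carrier → Set ℓ
  Integral y = ∃[ m ] Closed m y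

  module Closure {m y} (closed : Closed m y) where

    -- Multiplication by y pushes only the top power out of the module, and the monic equation
    -- brings it back.
    closed-y* : ∀ {x} → Span (suc m) y x → Span (suc m) y (y * x)
    closed-y* {x} s with span-split m s
    ... | x′ , s′ , k , x≈ = span-resp (begin
      y * x′ + ιℤ k * y ^ suc m      ≈⟨ solve 4 (λ y x k z → y :* x :+ k :* (y :* z) := y :* (x :+ k :* z)) refl _ _ _ _ ⟩
      y * (x′ + ιℤ k * y ^ m)        ≈⟨ *-congˡ x≈ ⟨
      y * x                          ∎)
      (span-+ (span-y* s′) (span-ιℤ* k closed))

    closed-ev : ∀ {d} (v : Vec ℤ d) → Span (suc m) y (ev v y)
    closed-ev []      = span-0
    closed-ev (k ∷ v) = span-+ (span-ιℤ k) (closed-y* (closed-ev v))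

    closed-span : ∀ {d x} → Span d y x → Span (suc m) y x
    closed-span (v , x≈v) = span-resp (sym x≈v) (closed-ev v)

    closed-* : ∀ {x x′} → Span (suc m) y x → Span (suc m) y x′ → Span (suc m) y (x * x′)
    closed-* s s′ = closed-span (span-* s s′)

    closed-y : Span (suc m) y y
    closed-y = span-resp (*-identityʳ y) (closed-y* (span-resp ι-1 (span-ιℤ 1ℤ)))

    closed-^ : ∀ {x} → Span (suc m) y x → ∀ k → Span (suc m) y (x ^ k)
    closed-^ s zero    = span-resp ι-1 (span-ιℤ 1ℤ)
    closed-^ s (suc k) = closed-* s (closed-^ s k)

  -- Elimination of v₀ with the pivot T₀₀, which stays monic: no determinant is needed.
  elimination : ∀ m d {y} (T : Fin m → Fin m → Carrier) (v : Fin m → Carrier) →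
    (∀ i → Span d y (T i i - y ^ d)) → (∀ i j → i ≢ j → Span d y (T i j)) →
    (∀ i → sum (λ j → T i j * v j) ≈ 0#) →
    ∃[ e ] ∃[ t ] Span e y (t - y ^ e) × (∀ i → t * v i ≈ 0#)
  elimination zero    d {y} T v _ _ _ = 0 , 1# , span-resp (sym (-‿inverseʳ 1#)) span-0 , λ ()
  elimination (suc m) d {y} T v diag off Tv≈0 = e ℕ.+ d , t * T₀₀ , monic , kills
    where
    T₀₀ = T zero zero
    -- The entries are the 2 × 2 minors through the pivot. Diagonal entries stay monic, now of
    -- degree 2d in y, and off-diagonal entries stay of degree below 2d, so the shape required by
    -- the recursion is preserved with d doubled.
    T′ : Fin m → Fin m → Carrier
    T′ i j = T₀₀ * T (suc i) (suc j) - T (suc i) zero * T zero (suc j)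

    product-monic : ∀ {d e s t} → Span d y (s - y ^ d) → Span e y (t - y ^ e) → Span (d ℕ.+ e) y (s * t - y ^ (d ℕ.+ e))
    product-monic {d} {e} {s} {t} s-monic t-monic = span-resp (begin
      y ^ d * (t - y ^ e) + y ^ e * (s - y ^ d) + (s - y ^ d) * (t - y ^ e)
        ≈⟨ solve 4 (λ s t yᵈ yᵉ → yᵈ :* (t :- yᵉ) :+ yᵉ :* (s :- yᵈ) :+ (s :- yᵈ) :* (t :- yᵉ) := s :* t :- yᵈ :* yᵉ)
               refl _ _ _ _ ⟩
      s * t - y ^ d * y ^ e       ≈⟨ +-congˡ (-‿cong (^-homo-* y d e)) ⟨
      s * t - y ^ (d ℕ.+ e)       ∎)
      (span-+ (span-+ (span-y^* d t-monic)
        (span-≤ (ℕ.≤-reflexive (ℕ.+-comm e d)) (span-y^* e s-monic))) (span-* s-monic t-monic))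

    diag′ : ∀ i → Span (d ℕ.+ d) y (T′ i i - y ^ (d ℕ.+ d))
    diag′ i = span-resp
      (solve 3 (λ a b c → (a :- b) :+ (:- c) := (a :- c) :- b) refl (T₀₀ * T (suc i) (suc i)) (y ^ (d ℕ.+ d)) (T (suc i) zero * T zero (suc i)))
      (span-+ (product-monic (diag zero) (diag (suc i)))
        (span-neg (span-* (off (suc i) zero λ ()) (off zero (suc i) λ ()))))

    off′ : ∀ i j → i ≢ j → Span (d ℕ.+ d) y (T′ i j)
    off′ i j i≢j = span-+
      (span-resp (solve 3 (λ a b c → b :* c :+ (a :- b) :* c := a :* c) refl T₀₀ (y ^ d) (T (suc i) (suc j)))
        (span-+ (span-y^* d offᵢⱼ) (span-* (diag zero) offᵢⱼ)))
      (span-neg (span-* (off (suc i) zero λ ()) (off zero (suc j) λ ())))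
      where offᵢⱼ = off (suc i) (suc j) λ eq → i≢j (Fin.suc-injective eq)

    T′v≈0 : ∀ i → sum (λ j → T′ i j * v (suc j)) ≈ 0#
    T′v≈0 i = begin
      sum (λ j → T′ i j * v (suc j))
        ≈⟨ sum-cong-≋ (λ j → solve 5 (λ a b c d v → (a :* b :- c :* d) :* v := a :* (b :* v) :+ (:- c) :* (d :* v))
               refl T₀₀ (T (suc i) (suc j)) Tᵢ₀ (T zero (suc j)) (v (suc j))) ⟩
      sum (λ j → T₀₀ * (T (suc i) (suc j) * v (suc j)) + (- Tᵢ₀) * (T zero (suc j) * v (suc j)))
        ≈⟨ ∑-distrib-+ (λ j → T₀₀ * (T (suc i) (suc j) * v (suc j))) (λ j → (- Tᵢ₀) * (T zero (suc j) * v (suc j))) ⟩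
      sum (λ j → T₀₀ * (T (suc i) (suc j) * v (suc j))) + sum (λ j → (- Tᵢ₀) * (T zero (suc j) * v (suc j)))
        ≈⟨ +-cong (*-distribˡ-sum T₀₀ (λ j → T (suc i) (suc j) * v (suc j))) (*-distribˡ-sum (- Tᵢ₀) (λ j → T zero (suc j) * v (suc j))) ⟨
      T₀₀ * Sᵢ + (- Tᵢ₀) * S₀
        ≈⟨ solve 5 (λ a b s u w → a :* s :+ (:- b) :* u := a :* (b :* w :+ s) :+ (:- b) :* (a :* w :+ u))
               refl T₀₀ Tᵢ₀ Sᵢ S₀ (v zero) ⟩
      T₀₀ * (Tᵢ₀ * v zero + Sᵢ) + (- Tᵢ₀) * (T₀₀ * v zero + S₀)
        ≈⟨ +-cong (*-congˡ (Tv≈0 (suc i))) (*-congˡ (Tv≈0 zero)) ⟩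
      T₀₀ * 0# + (- Tᵢ₀) * 0#    ≈⟨ +-cong (zeroʳ _) (zeroʳ _) ⟩
      0# + 0#                    ≈⟨ +-identityˡ _ ⟩
      0#                         ∎
      where
      Tᵢ₀ = T (suc i) zero
      Sᵢ = sum (λ j → T (suc i) (suc j) * v (suc j))
      S₀ = sum (λ j → T zero (suc j) * v (suc j))

    rec = elimination m (d ℕ.+ d) T′ (λ i → v (suc i)) diag′ off′ T′v≈0
    e = proj₁ rec
    t = proj₁ (proj₂ rec)
    t-kills = proj₂ (proj₂ (proj₂ rec))

    monic : Span (e ℕ.+ d) y (t * T₀₀ - y ^ (e ℕ.+ d))
    monic = product-monic (proj₁ (proj₂ (proj₂ rec))) (diag zero)

    S₀-killed : t * sum (λ j → T zero (suc j) * v (suc j)) ≈ 0#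
    S₀-killed = begin
      t * sum (λ j → T zero (suc j) * v (suc j))     ≈⟨ *-distribˡ-sum t (λ j → T zero (suc j) * v (suc j)) ⟩
      sum (λ j → t * (T zero (suc j) * v (suc j)))
        ≈⟨ sum-cong-≋ (λ j → trans (solve 3 (λ t a v → t :* (a :* v) := a :* (t :* v)) refl t (T zero (suc j)) (v (suc j)))
             (trans (*-congˡ (t-kills j)) (trans (zeroʳ _) (sym (zeroˡ 0#))))) ⟩
      sum {m} (λ j → 0# * 0#)                        ≈⟨ *-distribˡ-sum 0# (λ (_ : Fin m) → 0#) ⟨
      0# * sum {m} (λ _ → 0#)                        ≈⟨ zeroˡ _ ⟩
      0#                                             ∎

    kills : ∀ i → t * T₀₀ * v i ≈ 0#
    kills (suc i) = begin
      t * T₀₀ * v (suc i)      ≈⟨ solve 3 (λ t a v → t :* a :* v := a :* (t :* v)) refl t T₀₀ (v (suc i)) ⟩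
      T₀₀ * (t * v (suc i))    ≈⟨ *-congˡ (t-kills i) ⟩
      T₀₀ * 0#                 ≈⟨ zeroʳ _ ⟩
      0#                       ∎
    kills zero = begin
      t * T₀₀ * v zero
        ≈⟨ solve 4 (λ t a v s → t :* a :* v := t :* (a :* v :+ s) :- t :* s) refl t T₀₀ (v zero) S₀ ⟩
      t * (T₀₀ * v zero + S₀) - t * S₀   ≈⟨ +-cong (*-congˡ (Tv≈0 zero)) (-‿cong S₀-killed) ⟩
      t * 0# - 0#                        ≈⟨ +-cong (zeroʳ t) -0#≈0# ⟩
      0# + 0#                            ≈⟨ +-identityˡ _ ⟩
      0#                                 ∎
      where S₀ = sum (λ j → T zero (suc j) * v (suc j))

  -- δ is row i of the scalar matrix x I, packaged with what is used of it. Recursion on i avoids a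
  -- test for equality of indices.
  sum-δ : ∀ {m} (i : Fin m) (x : Carrier) (v : Fin m → Carrier) →
    Σ[ δ ∈ (Fin m → Carrier) ] (δ i ≈ x) × (∀ j → i ≢ j → δ j ≈ 0#) × (sum (λ j → δ j * v j) ≈ x * v i)
  sum-δ {suc m} zero x v = δ , refl , off , trans (+-congˡ (zero-sum m (λ j → v (suc j)))) (+-identityʳ _)
    where
    δ : Fin (suc m) → Carrier
    δ zero    = x
    δ (suc _) = 0#
    off : ∀ j → zero ≢ j → δ j ≈ 0#
    off zero    0≢0 = contradiction ≡.refl 0≢0
    off (suc _) _   = refl
    zero-sum : ∀ m (v : Fin m → Carrier) → sum (λ j → 0# * v j) ≈ 0#
    zero-sum m v = trans (sym (*-distribˡ-sum 0# v)) (zeroˡ _)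
  sum-δ (suc i) x v with sum-δ i x (λ j → v (suc j))
  ... | δ , δᵢ , off , eq = δ′ , δᵢ , off′ , trans (+-cong (zeroˡ _) eq) (+-identityˡ _)
    where
    δ′ : Fin _ → Carrier
    δ′ zero    = 0#
    δ′ (suc j) = δ j
    off′ : ∀ j → suc i ≢ j → δ′ j ≈ 0#
    off′ zero    _   = refl
    off′ (suc j) i≢j = off j λ eq → i≢j (cong suc eq)

  -- The Cayley-Hamilton argument: multiplication by y acts on the generators 1, θ, ..., θᵐ through
  -- an integer matrix, so y I minus this matrix kills the vector of generators. Elimination leaves
  -- a monic polynomial t in y that kills every generator, in particular 1, hence t = 0.
  span-integral : ∀ {m θ y} → Closed m θ → Span (suc m) θ y → Integral y
  span-integral {m} {θ} {y} closed s = finish (elimination (suc m) 1 T v diag off Tv≈0)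
    where
    open Closure closed
    v : Fin (suc m) → Carrier
    v i = θ ^ toℕ i
    yv : ∀ i → Span (suc m) θ (y * v i)
    yv i = closed-* s (closed-^ closed-y (toℕ i))
    a : Fin (suc m) → Fin (suc m) → Carrier
    a i j = ιℤ (lookup (proj₁ (yv i)) j)
    av : ∀ i → sum (λ j → a i j * v j) ≈ y * v i
    av i = sym (trans (proj₂ (yv i)) (ev-sum (proj₁ (yv i)) θ))
    δ-row = λ i → sum-δ i y v
    δ : Fin (suc m) → Fin (suc m) → Carrier
    δ i = proj₁ (δ-row i)
    δ-sum : ∀ i → sum (λ j → δ i j * v j) ≈ y * v i
    δ-sum i = proj₂ (proj₂ (proj₂ (δ-row i)))
    T : Fin (suc m) → Fin (suc m) → Carrier
    T i j = δ i j - a i j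
    diag : ∀ i → Span 1 y (T i i - y ^ 1)
    diag i = span-resp (begin
      - a i i                     ≈⟨ solve 2 (λ a y → :- a := y :- a :- y) refl (a i i) y ⟩
      y - a i i - y               ≈⟨ +-cong (+-congʳ (proj₁ (proj₂ (δ-row i)))) (-‿cong (*-identityʳ y)) ⟨
      T i i - y ^ 1               ∎)
      (span-neg (span-ιℤ _))
    off : ∀ i j → i ≢ j → Span 1 y (T i j)
    off i j i≢j = span-resp (sym (trans (+-congʳ (proj₁ (proj₂ (proj₂ (δ-row i))) j i≢j)) (+-identityˡ _)))
      (span-neg (span-ιℤ _))
    Tv≈0 : ∀ i → sum (λ j → T i j * v j) ≈ 0#
    Tv≈0 i = begin
      sum (λ j → T i j * v j)
        ≈⟨ sum-cong-≋ (λ j → solve 3 (λ d a v → (d :- a) :* v := d :* v :+ con (ℤ.- 1ℤ) :* (a :* v))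
               refl (δ i j) (a i j) (v j)) ⟩
      sum (λ j → δ i j * v j + ιℤ (ℤ.- 1ℤ) * (a i j * v j))
        ≈⟨ ∑-distrib-+ (λ j → δ i j * v j) (λ j → ιℤ (ℤ.- 1ℤ) * (a i j * v j)) ⟩
      sum (λ j → δ i j * v j) + sum (λ j → ιℤ (ℤ.- 1ℤ) * (a i j * v j))
        ≈⟨ +-cong (δ-sum i) (sym (*-distribˡ-sum (ιℤ (ℤ.- 1ℤ)) (λ j → a i j * v j))) ⟩
      y * v i + ιℤ (ℤ.- 1ℤ) * sum (λ j → a i j * v j)   ≈⟨ +-congˡ (*-congˡ (av i)) ⟩
      y * v i + ιℤ (ℤ.- 1ℤ) * (y * v i)                 ≈⟨ solve 1 (λ x → x :+ con (ℤ.- 1ℤ) :* x := con 0ℤ) refl (y * v i) ⟩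
      ιℤ 0ℤ                                             ≈⟨ ι-0 ⟩
      0#                                                ∎
    finish : ∃[ e ] ∃[ t ] Span e y (t - y ^ e) × (∀ i → t * v i ≈ 0#) → Integral y
    -- The equation found has degree e; one multiplication by y brings it to the degree e + 1 that
    -- `Closed e` asks for.
    finish (e , t , monic , kills) = e , span-y* yᵉ∈
      where
      t≈0 : t ≈ 0#
      t≈0 = trans (sym (*-identityʳ t)) (kills zero)
      yᵉ∈ : Span e y (y ^ e)
      yᵉ∈ = span-resp (trans (-‿cong (trans (+-congʳ t≈0) (+-identityˡ _))) (-‿involutive _)) (span-neg monic)

  -- The rational root theorem for the root W / B: the monic equation is homogenised.
  integral-fraction : ∀ {y B W} → Integral y → ιℤ B * y ≈ ιℤ W → ∃[ e ] B ∣ₛ W ℤ.^ e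
  integral-fraction {y} {B} {W} (m , v , yᵐ≈v) By≈W = suc m , divides h (ιℤ-injective₂ (begin
    ιℤ (W ℤ.^ suc m)                ≈⟨ ιℤ-^ W (suc m) ⟩
    ιℤ W ^ suc m                    ≈⟨ ^-congˡ (suc m) By≈W ⟨
    (ιℤ B * y) ^ suc m              ≈⟨ ^-distrib-* (ιℤ B) y (suc m) ⟩
    ιℤ B ^ suc m * y ^ suc m        ≈⟨ *-congˡ yᵐ≈v ⟩
    ιℤ B ^ suc m * ev v y           ≈⟨ proj₂ (homogenise v) ⟩
    ιℤ B * ιℤ h                     ≈⟨ trans (*-comm _ _) (sym (ιℤ-* h B)) ⟩
    ιℤ (h ℤ.* B)                    ∎))
    where
    homogenise : ∀ {d} (v : Vec ℤ d) → ∃[ h ] ιℤ B ^ d * ev v y ≈ ιℤ B * ιℤ h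
    homogenise {zero}  [] = 0ℤ , trans (zeroʳ _) (sym (trans (*-congˡ ι-0) (zeroʳ _)))
    homogenise {suc d} (k ∷ v) with homogenise v
    ... | h , eq = B ℤ.^ d ℤ.* k ℤ.+ W ℤ.* h , (begin
      ιℤ B ^ suc d * (ιℤ k + y * ev v y)
        ≈⟨ solve 5 (λ b bᵈ k y e → b :* bᵈ :* (k :+ y :* e) := b :* (bᵈ :* k) :+ (b :* y) :* (bᵈ :* e)) refl _ _ _ _ _ ⟩
      ιℤ B * (ιℤ B ^ d * ιℤ k) + (ιℤ B * y) * (ιℤ B ^ d * ev v y)
        ≈⟨ +-cong (*-congˡ (*-congʳ (sym (ιℤ-^ B d)))) (*-cong By≈W eq) ⟩
      ιℤ B * (ιℤ (B ℤ.^ d) * ιℤ k) + ιℤ W * (ιℤ B * ιℤ h)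
        ≈⟨ solve 5 (λ b c k w h → b :* (c :* k) :+ w :* (b :* h) := b :* (c :* k :+ w :* h)) refl _ _ _ _ _ ⟩
      ιℤ B * (ιℤ (B ℤ.^ d) * ιℤ k + ιℤ W * ιℤ h)
        ≈⟨ *-congˡ (trans (ιℤ-+ _ _) (+-cong (ιℤ-* _ _) (ιℤ-* _ _))) ⟨
      ιℤ B * ιℤ (B ℤ.^ d ℤ.* k ℤ.+ W ℤ.* h)   ∎)
    h = proj₁ (homogenise v)

-- Pure extensions θⁿ = a

RootOf : ∀ {c ℓ} (A : ℚAlgebra c ℓ) → ℕ → ℤ → ℚAlgebra.Carrier A → Set ℓ
RootOf A n a θ = θ ^ n ≈ ιℤ a
  where open ℚAlgebraProperties A

module PureExtension {c ℓ} (A : ℚAlgebra c ℓ) {m : ℕ} {θ : ℚAlgebra.Carrier A} {a : ℤ}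
                     (a≢0 : a ≢ 0ℤ) (θⁿ≈a : RootOf A (suc m) a θ) where
  open ℚAlgebraProperties A

  R : Carrier → Set ℓ
  R = Span (suc m) θ

  θ-closed : Closed m θ
  θ-closed = span-resp (sym θⁿ≈a) (span-ιℤ a)

  open Closure θ-closed

  R-* : ∀ {x y} → R x → R y → R (x * y)
  R-* = closed-*

  R-^ : ∀ {x} → R x → ∀ k → R (x ^ k)
  R-^ = closed-^

  R-θ : R θ
  R-θ = closed-y

  -- θ divides θⁿ = a, a nonzero integer, so it is not a zero divisor even though the algebra need
  -- not be a domain.
  θ-cancel : ∀ {x} → θ * x ≈ 0# → x ≈ 0#
  θ-cancel {x} θx≈0 = ιℤ-cancel a≢0 (begin
    ιℤ a * x          ≈⟨ *-congʳ θⁿ≈a ⟨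
    θ * θ ^ m * x     ≈⟨ solve 3 (λ t u x → t :* u :* x := u :* (t :* x)) refl θ (θ ^ m) x ⟩
    θ ^ m * (θ * x)   ≈⟨ *-congˡ θx≈0 ⟩
    θ ^ m * 0#        ≈⟨ zeroʳ _ ⟩
    0#                ∎)

  θ^-cancel : ∀ k {x} → θ ^ k * x ≈ 0# → x ≈ 0#
  θ^-cancel zero    x≈0 = trans (sym (*-identityˡ _)) x≈0
  θ^-cancel (suc k) θx≈0 = θ^-cancel k (θ-cancel (trans (sym (*-assoc _ _ _)) θx≈0))

  θ^-cancel₂ : ∀ k {x y} → θ ^ k * x ≈ θ ^ k * y → x ≈ y
  θ^-cancel₂ k = cancel-sub (θ ^ k) (θ^-cancel k)

  θ^nk≈a^k : ∀ k → θ ^ (suc m ℕ.* k) ≈ ιℤ (a ℤ.^ k)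
  θ^nk≈a^k k = begin
    θ ^ (suc m ℕ.* k)    ≈⟨ ^-assocʳ θ (suc m) k ⟨
    (θ ^ suc m) ^ k      ≈⟨ ^-congˡ k θⁿ≈a ⟩
    ιℤ a ^ k             ≈⟨ ιℤ-^ a k ⟨
    ιℤ (a ℤ.^ k)         ∎

  -- The classical notion of an almost integral element: all powers of y share one denominator.
  -- Integrality is used in this form because a valuation, or a divisibility of coordinates, only
  -- sees how far the powers of y leave R.
  AlmostIntegral : Carrier → Set ℓ
  AlmostIntegral y = ∃[ N ] N ≢ 0ℤ × (∀ k → R (ιℤ N * y ^ k))

  Fractional : Carrier → Set ℓ
  Fractional x = ∃[ D ] D ≢ 0ℤ × R (ιℤ D * x)

  -- The θ-adic valuation at a prime dividing a exactly once

  module Eisenstein {p} (pr : Prime p) {b} (a≡pb : a ≡ + p ℤ.* b) (p∤b : ¬ (+ p ∣ₛ b)) where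

    a≈pb : ιℤ a ≈ ιℤ (+ p) * ιℤ b
    a≈pb = trans (ιℤ-cong a≡pb) (ιℤ-* (+ p) b)

    p∣a : + p ∣ₛ a
    p∣a = divides b (≡.trans a≡pb (ℤ.*-comm (+ p) b))

    -- With r integral, rⁿ = (-w)ⁿ / a is a rational integer.
    θ∣w⇒p∣w : ∀ {w r} → R r → ιℤ w + θ * r ≈ 0# → + p ∣ₛ w
    θ∣w⇒p∣w {w} {r} r∈R w+θr≈0 =
      let e , a∣ = integral-fraction (span-integral θ-closed (R-^ r∈R (suc m))) arⁿ≈
      in subst (+ p ∣ₛ_) (ℤ.neg-involutive w) (ℤᵈ.∣m⇒∣-m
           (prime∣^ pr (ℤ.- w) (suc m) (prime∣^ pr _ e (ℤᵈ.∣-trans p∣a a∣))))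
      where
      θr≈-w : θ * r ≈ ιℤ (ℤ.- w)
      θr≈-w = begin
        θ * r                     ≈⟨ solve 2 (λ w x → x := w :+ x :- w) refl (ιℤ w) (θ * r) ⟩
        ιℤ w + θ * r - ιℤ w       ≈⟨ +-congʳ w+θr≈0 ⟩
        0# - ιℤ w                 ≈⟨ +-identityˡ _ ⟩
        - ιℤ w                    ≈⟨ ιℤ-neg w ⟨
        ιℤ (ℤ.- w)                ∎
      arⁿ≈ : ιℤ a * r ^ suc m ≈ ιℤ ((ℤ.- w) ℤ.^ suc m)
      arⁿ≈ = begin
        ιℤ a * r ^ suc m               ≈⟨ *-congʳ θⁿ≈a ⟨
        θ ^ suc m * r ^ suc m          ≈⟨ ^-distrib-* θ r (suc m) ⟨
        (θ * r) ^ suc m                ≈⟨ ^-congˡ (suc m) θr≈-w ⟩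
        ιℤ (ℤ.- w) ^ suc m             ≈⟨ ιℤ-^ (ℤ.- w) (suc m) ⟨
        ιℤ ((ℤ.- w) ℤ.^ suc m)         ∎

    -- The congruence x ≡ w modulo θR. It is a relation because w is not unique; but x ∈ θR forces p
    -- ∣ w, so p ∤ w expresses that x has θ-valuation 0 at p.
    Residue : Carrier → ℤ → Set (c ⊔ ℓ)
    Residue x w = Σ[ r ∈ Carrier ] R r × x ≈ ιℤ w + θ * r

    residue-θ* : ∀ {x r w} → R r → x ≈ θ * r → Residue x w → + p ∣ₛ w
    residue-θ* {x} {r} {w} r∈R x≈θr (r′ , r′∈R , x≈) = θ∣w⇒p∣w (span-+ r′∈R (span-neg r∈R)) (begin
      ιℤ w + θ * (r′ - r)         ≈⟨ solve 4 (λ w t r s → w :+ t :* (s :- r) := w :+ t :* s :- t :* r) refl _ _ _ _ ⟩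
      ιℤ w + θ * r′ - θ * r       ≈⟨ x≈y⇒x-y≈0 (trans (sym x≈) x≈θr) ⟩
      0#                          ∎)

    residue-0 : ∀ {x w} → x ≈ 0# → Residue x w → + p ∣ₛ w
    residue-0 x≈0 = residue-θ* span-0 (trans x≈0 (sym (zeroʳ θ)))

    residue-ιℤ : ∀ w → Residue (ιℤ w) w
    residue-ιℤ w = 0# , span-0 , sym (trans (+-congˡ (zeroʳ θ)) (+-identityʳ _))

    residue-* : ∀ {x w x′ w′} → Residue x w → Residue x′ w′ → Residue (x * x′) (w ℤ.* w′)
    residue-* {x} {w} {x′} {w′} (r , r∈R , x≈) (r′ , r′∈R , x′≈) =
      ιℤ w * r′ + ιℤ w′ * r + θ * (r * r′) ,
      span-+ (span-+ (span-ιℤ* w r′∈R) (span-ιℤ* w′ r∈R)) (R-* R-θ (R-* r∈R r′∈R)) , (begin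
      x * x′                                 ≈⟨ *-cong x≈ x′≈ ⟩
      (ιℤ w + θ * r) * (ιℤ w′ + θ * r′)
        ≈⟨ solve 5 (λ w t r v s → (w :+ t :* r) :* (v :+ t :* s) := w :* v :+ t :* (w :* s :+ v :* r :+ t :* (r :* s)))
               refl _ _ _ _ _ ⟩
      ιℤ w * ιℤ w′ + θ * (ιℤ w * r′ + ιℤ w′ * r + θ * (r * r′))   ≈⟨ +-congʳ (ιℤ-* w w′) ⟨
      ιℤ (w ℤ.* w′) + θ * (ιℤ w * r′ + ιℤ w′ * r + θ * (r * r′))  ∎)

    residue-^ : ∀ {x w} → Residue x w → ∀ k → Residue (x ^ k) (w ℤ.^ k)
    residue-^ x~w zero    = let r , r∈R , eq = residue-ιℤ 1ℤ in r , r∈R , trans (sym ι-1) eq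
    residue-^ x~w (suc k) = residue-* x~w (residue-^ x~w k)

    -- Such an equation puts w into θR, so w = w′ p. Multiplied by b it reads θ b = w′ θⁿ + θ² b r,
    -- because p b = θⁿ. As n ≥ 2, cancelling θ puts b into θR, and p would divide b.
    θ∉ℤ+θ²R : 1 ℕ.≤ m → ∀ {w r} → R r → ¬ (θ ≈ ιℤ w + θ * (θ * r))
    θ∉ℤ+θ²R 1≤m {w} {r} r∈R θ≈ = p∤b (residue-θ* (span-+ (span-ιℤ* w′ (R-^ R-θ e)) (span-ιℤ* b r∈R)) b≈ (residue-ιℤ b))
      where
      R-1 : R 1#
      R-1 = R-^ R-θ 0
      w+θ[θr-1]≈0 : ιℤ w + θ * (θ * r - 1#) ≈ 0#
      w+θ[θr-1]≈0 = begin
        ιℤ w + θ * (θ * r - 1#)            ≈⟨ solve 4 (λ w t r i → w :+ t :* (t :* r :- i) := w :+ t :* (t :* r) :- t :* i)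
               refl (ιℤ w) θ r 1# ⟩
        ιℤ w + θ * (θ * r) - θ * 1#        ≈⟨ x≈y⇒x-y≈0 (trans (sym θ≈) (sym (*-identityʳ θ))) ⟩
        0#                                 ∎
      p∣w : + p ∣ₛ w
      p∣w = θ∣w⇒p∣w (span-+ (R-* R-θ r∈R) (span-neg R-1)) w+θ[θr-1]≈0
      w′ = _∣ₛ_.quotient p∣w
      e = m ℕ.∸ 1
      pb≈ : ιℤ (+ p) * ιℤ b ≈ θ * (θ * θ ^ e)
      pb≈ = trans (sym a≈pb) (trans (sym θⁿ≈a) (reflexive (cong (λ k → θ * θ ^ k) (≡.sym (ℕ.m+[n∸m]≡n 1≤m)))))
      b≈ : ιℤ b ≈ θ * (ιℤ w′ * θ ^ e + ιℤ b * r)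
      b≈ = cancel-sub θ θ-cancel (begin
        θ * ιℤ b                                                      ≈⟨ *-congʳ θ≈ ⟩
        (ιℤ w + θ * (θ * r)) * ιℤ b
          ≈⟨ *-congʳ (+-congʳ (trans (ιℤ-cong (_∣ₛ_.equality p∣w)) (ιℤ-* w′ (+ p)))) ⟩
        (ιℤ w′ * ιℤ (+ p) + θ * (θ * r)) * ιℤ b
          ≈⟨ solve 5 (λ w p t r b → (w :* p :+ t :* (t :* r)) :* b := w :* (p :* b) :+ t :* (t :* (b :* r))) refl _ _ _ _ _ ⟩
        ιℤ w′ * (ιℤ (+ p) * ιℤ b) + θ * (θ * (ιℤ b * r))              ≈⟨ +-congʳ (*-congˡ pb≈) ⟩
        ιℤ w′ * (θ * (θ * θ ^ e)) + θ * (θ * (ιℤ b * r))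
          ≈⟨ solve 5 (λ w t e b r → w :* (t :* (t :* e)) :+ t :* (t :* (b :* r)) := t :* (t :* (w :* e :+ b :* r)))
                 refl _ _ _ _ _ ⟩
        θ * (θ * (ιℤ w′ * θ ^ e + ιℤ b * r))                          ∎)

    -- Every term c θⁱ with p ∣ c has θ-valuation at least n, so the θ-valuation is read off the first
    -- coefficient prime to p.
    valuation : ∀ {d} → d ℕ.≤ suc m → (v : Vec ℤ d) → ∀ i → ¬ (+ p ∣ₛ lookup v i) →
      ∃[ k ] ∃[ x ] ∃[ w ] k ℕ.< d × Residue x w × ¬ (+ p ∣ₛ w) × ιℤ (b ℤ.^ k) * ev v θ ≈ θ ^ k * x
    valuation {suc d} d<n (c ∷ v) i p∤ with + p ℤᵈ.∣? c
    ... | no p∤c = 0 , ev (c ∷ v) θ , c , s≤s z≤n , (ev v θ , span-≤ (ℕ.<⇒≤ d<n) (v , refl) , refl) , p∤c , *-congʳ ι-1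
    valuation {suc d} d<n (c ∷ v) zero    p∤ | yes p∣c = contradiction p∣c p∤
    valuation {suc d} d<n (c ∷ v) (suc i) p∤ | yes (divides c′ ≡.refl)
      with valuation (ℕ.<⇒≤ d<n) v i p∤
    ... | k , x , w , k<d , (r , r∈R , x≈) , p∤w , eq =
      -- One more factor b turns the head term c = c′ p into a c′ = θⁿ c′, up to the factor bᵏ.
      -- Since k + 2 ≤ n, extracting θ^(k+1) from it leaves at least one factor θ, so the new
      -- cofactor has the residue b w of b x.
      suc k , ιℤ b * x + θ * y , b ℤ.* w , s≤s k<d ,
      (ιℤ b * r + y , span-+ (span-ιℤ* b r∈R) y∈R , residue) , prime∤* pr p∤b p∤w , (begin
      ιℤ (b ℤ.^ suc k) * (ιℤ (c′ ℤ.* + p) + θ * ev v θ)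
        ≈⟨ *-cong (ιℤ-* b (b ℤ.^ k)) (+-congʳ (ιℤ-* c′ (+ p))) ⟩
      ιℤ b * bᵏ * (ιℤ c′ * ιℤ (+ p) + θ * ev v θ)
        ≈⟨ solve 6 (λ b bᵏ c p t v → b :* bᵏ :* (c :* p :+ t :* v) := p :* b :* (bᵏ :* c) :+ t :* b :* (bᵏ :* v))
               refl _ _ _ _ _ _ ⟩
      ιℤ (+ p) * ιℤ b * (bᵏ * ιℤ c′) + θ * ιℤ b * (bᵏ * ev v θ)
        ≈⟨ +-cong (*-congʳ pb≈) (*-congˡ eq) ⟩
      θ ^ suc k * (θ * θ ^ e) * (bᵏ * ιℤ c′) + θ * ιℤ b * (θ ^ k * x)
        ≈⟨ solve 7 (λ t tᵏ tᵉ bᵏ c b x → t :* tᵏ :* (t :* tᵉ) :* (bᵏ :* c) :+ t :* b :* (tᵏ :* x) := t :* tᵏ :* (b :* x :+ t :* (tᵉ :* (bᵏ :* c))))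
               refl _ _ _ _ _ _ _ ⟩
      θ ^ suc k * (ιℤ b * x + θ * y)   ∎)
      where
      bᵏ = ιℤ (b ℤ.^ k)
      e = suc m ℕ.∸ suc (suc k)
      y = θ ^ e * (bᵏ * ιℤ c′)
      y∈R : R y
      y∈R = R-* (R-^ R-θ e) (span-ιℤ* (b ℤ.^ k) (span-ιℤ c′))
      n≡ : suc k ℕ.+ suc e ≡ suc m
      n≡ = ≡.trans (ℕ.+-suc (suc k) e) (ℕ.m+[n∸m]≡n (ℕ.≤-trans (s≤s k<d) d<n))
      pb≈ : ιℤ (+ p) * ιℤ b ≈ θ ^ suc k * θ ^ suc e
      pb≈ = begin
        ιℤ (+ p) * ιℤ b           ≈⟨ a≈pb ⟨
        ιℤ a                      ≈⟨ θⁿ≈a ⟨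
        θ ^ suc m                 ≡⟨ cong (θ ^_) n≡ ⟨
        θ ^ (suc k ℕ.+ suc e)     ≈⟨ ^-homo-* θ (suc k) (suc e) ⟩
        θ ^ suc k * θ ^ suc e     ∎
      residue : ιℤ b * x + θ * y ≈ ιℤ (b ℤ.* w) + θ * (ιℤ b * r + y)
      residue = begin
        ιℤ b * x + θ * y                       ≈⟨ +-congʳ (*-congˡ x≈) ⟩
        ιℤ b * (ιℤ w + θ * r) + θ * y          ≈⟨ solve 5 (λ b w t r y → b :* (w :+ t :* r) :+ t :* y := b :* w :+ t :* (b :* r :+ y))
               refl _ _ _ _ _ ⟩
        ιℤ b * ιℤ w + θ * (ιℤ b * r + y)       ≈⟨ +-congʳ (ιℤ-* b w) ⟨
        ιℤ (b ℤ.* w) + θ * (ιℤ b * r + y)      ∎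

    -- All coefficients are divided by p until one of them resists. The given nonzero coefficient
    -- bounds the number of rounds.
    primitive-part : ∀ {d} (v : Vec ℤ d) i → lookup v i ≢ 0ℤ →
      ∃[ D ] ∃[ w ] D ≢ 0ℤ × v ≡ Vec.map (D ℤ.*_) w × ∃[ j ] ¬ (+ p ∣ₛ lookup w j)
    primitive-part {d} v i vᵢ≢0 = go ℤ.∣ lookup v i ∣ v (prime^∤ pr vᵢ≢0)
      where
      go : ∀ k (v : Vec ℤ d) → ¬ ((+ p) ℤ.^ k ∣ₛ lookup v i) →
        ∃[ D ] ∃[ w ] D ≢ 0ℤ × v ≡ Vec.map (D ℤ.*_) w × ∃[ j ] ¬ (+ p ∣ₛ lookup w j)
      go zero    v 1∤  = contradiction (divides (lookup v i) (≡.sym (ℤ.*-identityʳ _))) 1∤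
      go (suc k) v pᵏ∤ with Fin.all? (λ j → + p ℤᵈ.∣? lookup v j)
      ... | no ¬all = 1ℤ , v , (λ ()) , ≡.sym (≡.trans (Vec.map-cong ℤ.*-identityˡ v) (Vec.map-id v)) ,
        Fin.¬∀⟶∃¬ d _ (λ j → + p ℤᵈ.∣? lookup v j) ¬all
      ... | yes all with divide-coefficients (+ p) v all
      ...   | v′ , ≡.refl with go k v′ (λ pᵏ∣ → pᵏ∤ (subst (_ ∣ₛ_) (≡.sym (Vec.lookup-map i _ v′)) (ℤᵈ.*-monoʳ-∣ (+ p) pᵏ∣)))
      ...     | D , w , D≢0 , ≡.refl , p∤ = + p ℤ.* D , w , *-≢0 (prime≢0 pr) D≢0 ,
        ≡.trans (≡.sym (Vec.map-∘ _ _ w)) (Vec.map-cong (λ x → ≡.sym (ℤ.*-assoc (+ p) D x)) w) , p∤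

    -- The normal form E x = D θᵏ y with y of θ-valuation 0 at p. It is positive evidence that x is
    -- nonzero, in a shape that survives multiplication.
    Valued : Carrier → Set (c ⊔ ℓ)
    Valued x = ∃[ D ] ∃[ E ] ∃[ k ] ∃[ y ] ∃[ w ] D ≢ 0ℤ × Residue y w × ¬ (+ p ∣ₛ w) × ιℤ E * x ≈ ιℤ D * (θ ^ k * y)

    nonzero-valued : (v : Vec ℤ (suc m)) → ∀ i → lookup v i ≢ 0ℤ → Valued (ev v θ)
    nonzero-valued v i vᵢ≢0 with primitive-part v i vᵢ≢0
    ... | D , v′ , D≢0 , ≡.refl , j , p∤ with valuation ℕ.≤-refl v′ j p∤
    ...   | k , y , w , _ , y~w , p∤w , eq = D , b ℤ.^ k , k , y , w , D≢0 , y~w , p∤w , (begin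
      ιℤ (b ℤ.^ k) * ev (Vec.map (D ℤ.*_) v′) θ  ≈⟨ *-congˡ (ev-* D v′ θ) ⟩
      ιℤ (b ℤ.^ k) * (ιℤ D * ev v′ θ)            ≈⟨ solve 3 (λ b d v → b :* (d :* v) := d :* (b :* v)) refl _ _ _ ⟩
      ιℤ D * (ιℤ (b ℤ.^ k) * ev v′ θ)            ≈⟨ *-congˡ eq ⟩
      ιℤ D * (θ ^ k * y)                         ∎)

    -- If x x′ = 0, cancelling the integers D, D′ and the powers of θ gives y y′ = 0, whereas y y′
    -- has residue w w′, prime to p.
    valued-*≉0 : ∀ {x x′} → Valued x → Valued x′ → ¬ (x * x′ ≈ 0#)
    valued-*≉0 {x} {x′} (D , E , k , y , w , D≢0 , y~w , p∤w , eq) (D′ , E′ , k′ , y′ , w′ , D′≢0 , y′~w′ , p∤w′ , eq′) xx′≈0 =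
      prime∤* pr p∤w p∤w′ (residue-0 yy′≈0 (residue-* y~w y′~w′))
      where
      yy′≈0 : y * y′ ≈ 0#
      yy′≈0 = θ^-cancel k′ (θ^-cancel k (ιℤ-cancel D′≢0 (ιℤ-cancel D≢0 (begin
        ιℤ D * (ιℤ D′ * (θ ^ k * (θ ^ k′ * (y * y′))))
          ≈⟨ solve 6 (λ d e t u x y → d :* (e :* (t :* (u :* (x :* y)))) := (d :* (t :* x)) :* (e :* (u :* y)))
                 refl _ _ _ _ _ _ ⟩
        ιℤ D * (θ ^ k * y) * (ιℤ D′ * (θ ^ k′ * y′))   ≈⟨ *-cong eq eq′ ⟨
        ιℤ E * x * (ιℤ E′ * x′)   ≈⟨ solve 4 (λ e x f y → e :* x :* (f :* y) := e :* f :* (x :* y)) refl _ _ _ _ ⟩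
        ιℤ E * ιℤ E′ * (x * x′)   ≈⟨ trans (*-congˡ xx′≈0) (zeroʳ _) ⟩
        0#                        ∎))))

    independent : (v : Vec ℤ (suc m)) → ev v θ ≈ 0# → ∀ i → lookup v i ≡ 0ℤ
    independent v v≈0 i with lookup v i ℤ.≟ 0ℤ
    ... | yes vᵢ≡0 = vᵢ≡0
    -- The square of a valued element is nonzero, hence so is the element.
    ... | no  vᵢ≢0 = contradiction (trans (*-congʳ v≈0) (zeroˡ _)) (valued-*≉0 valued valued)
      where valued = nonzero-valued v i vᵢ≢0

    -- The zero test runs on the integer coordinates; it is what lets `fractional-domain` conclude
    -- with a disjunction.
    ev-zero? : (v : Vec ℤ (suc m)) → ev v θ ≈ 0# ⊎ Valued (ev v θ)
    ev-zero? v with Fin.all? (λ i → lookup v i ℤ.≟ 0ℤ)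
    ... | no ¬all = let i , vᵢ≢0 = Fin.¬∀⟶∃¬ _ _ (λ i → lookup v i ℤ.≟ 0ℤ) ¬all in inj₂ (nonzero-valued v i vᵢ≢0)
    ... | yes all = let w , v≡0w = divide-coefficients 0ℤ v (λ i → divides 0ℤ (all i)) in inj₁ (begin
      ev v θ                          ≡⟨ cong (λ v → ev v θ) v≡0w ⟩
      ev (Vec.map (0ℤ ℤ.*_) w) θ      ≈⟨ ev-* 0ℤ w θ ⟩
      ιℤ 0ℤ * ev w θ                  ≈⟨ trans (*-congʳ ι-0) (zeroˡ _) ⟩
      0#                              ∎)

    fractional-domain : ∀ {x x′} → Fractional x → Fractional x′ → x * x′ ≈ 0# → x ≈ 0# ⊎ x′ ≈ 0#
    fractional-domain {x} {x′} (D , D≢0 , v , Dx≈v) (D′ , D′≢0 , v′ , D′x′≈v′) xx′≈0 with ev-zero? v | ev-zero? v′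
    ... | inj₁ v≈0 | _ = inj₁ (ιℤ-cancel D≢0 (trans Dx≈v v≈0))
    ... | inj₂ _ | inj₁ v′≈0 = inj₂ (ιℤ-cancel D′≢0 (trans D′x′≈v′ v′≈0))
    ... | inj₂ val | inj₂ val′ = contradiction (begin
      ev v θ * ev v′ θ            ≈⟨ *-cong Dx≈v D′x′≈v′ ⟨
      ιℤ D * x * (ιℤ D′ * x′)     ≈⟨ solve 4 (λ e x f y → e :* x :* (f :* y) := e :* f :* (x :* y)) refl _ _ _ _ ⟩
      ιℤ D * ιℤ D′ * (x * x′)     ≈⟨ trans (*-congˡ xx′≈0) (zeroʳ _) ⟩
      0#                          ∎) (valued-*≉0 val val′)

    -- If y = z / p with z ∉ pR then z has θ-valuation s < n, so y has negative θ-valuation and N yᵏ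
    -- leaves R for large k.
    almostIntegral-p : ∀ {y} → AlmostIntegral y → R (ιℤ (+ p) * y) → R y
    almostIntegral-p {y} (N , N≢0 , Nyᵏ∈R) (v , py≈v) with Fin.all? (λ i → + p ℤᵈ.∣? lookup v i)
    ... | yes all = let v′ , v≡ = divide-coefficients (+ p) v all in
      v′ , ιℤ-cancel₂ (prime≢0 pr) (trans py≈v (trans (reflexive (cong (λ v → ev v θ) v≡)) (ev-* (+ p) v′ θ)))
    ... | no ¬all = contradiction p∣ p∤
      where
      val = let i , p∤vᵢ = Fin.¬∀⟶∃¬ _ _ (λ i → + p ℤᵈ.∣? lookup v i) ¬all in valuation ℕ.≤-refl v i p∤vᵢ
      s = proj₁ val
      x = proj₁ (proj₂ val)
      w = proj₁ (proj₂ (proj₂ val))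
      s<n = proj₁ (proj₂ (proj₂ (proj₂ val)))
      x~w = proj₁ (proj₂ (proj₂ (proj₂ (proj₂ val))))
      p∤w = proj₁ (proj₂ (proj₂ (proj₂ (proj₂ (proj₂ val)))))
      bˢv≈θˢx = proj₂ (proj₂ (proj₂ (proj₂ (proj₂ (proj₂ val)))))
      bˢ = ιℤ (b ℤ.^ s)
      e = suc m ℕ.∸ suc s
      -- The exponents satisfy s + 1 + e = n and bˢ (p y) = θˢ x, whence θ u y = b x: the element u
      -- y has valuation -1.
      u = bˢ * θ ^ e

      θⁿ≈ : θ ^ s * (θ * θ ^ e) ≈ ιℤ (+ p) * ιℤ b
      θⁿ≈ = begin
        θ ^ s * θ ^ suc e         ≈⟨ ^-homo-* θ s (suc e) ⟨
        θ ^ (s ℕ.+ suc e)         ≡⟨ cong (θ ^_) (≡.trans (ℕ.+-suc s e) (ℕ.m+[n∸m]≡n s<n)) ⟩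
        θ ^ suc m                 ≈⟨ θⁿ≈a ⟩
        ιℤ a                      ≈⟨ a≈pb ⟩
        ιℤ (+ p) * ιℤ b           ∎

      θuy≈bx : θ * (u * y) ≈ ιℤ b * x
      θuy≈bx = θ^-cancel₂ s (begin
        θ ^ s * (θ * (u * y))
          ≈⟨ solve 5 (λ tˢ t bˢ tᵉ y → tˢ :* (t :* (bˢ :* tᵉ :* y)) := bˢ :* ((tˢ :* (t :* tᵉ)) :* y))
                 refl (θ ^ s) θ bˢ (θ ^ e) y ⟩
        bˢ * (θ ^ s * (θ * θ ^ e) * y)        ≈⟨ *-congˡ (*-congʳ θⁿ≈) ⟩
        bˢ * (ιℤ (+ p) * ιℤ b * y)            ≈⟨ solve 4 (λ bˢ p b y → bˢ :* (p :* b :* y) := b :* (bˢ :* (p :* y)))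
               refl _ _ _ _ ⟩
        ιℤ b * (bˢ * (ιℤ (+ p) * y))          ≈⟨ *-congˡ (*-congˡ py≈v) ⟩
        ιℤ b * (bˢ * ev v θ)                  ≈⟨ *-congˡ bˢv≈θˢx ⟩
        ιℤ b * (θ ^ s * x)                    ≈⟨ solve 3 (λ b t x → b :* (t :* x) := t :* (b :* x)) refl _ _ _ ⟩
        θ ^ s * (ιℤ b * x)                    ∎)

      split = prime^-split pr N≢0
      f = proj₁ split
      N₁ = proj₁ (proj₂ split)
      N≡ = proj₁ (proj₂ (proj₂ split))
      -- N has θ-valuation g = n f, so N (u y)^(g+1) has valuation -1, although the choice of N puts
      -- it into R.
      g = suc m ℕ.* f
      bᶠ = ιℤ (b ℤ.^ f)
      r = bᶠ * (u ^ suc g * (ιℤ N * y ^ suc g))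

      bᶠN≈ : bᶠ * ιℤ N ≈ θ ^ g * ιℤ N₁
      bᶠN≈ = begin
        bᶠ * ιℤ N                                ≈⟨ *-congˡ (trans (ιℤ-cong N≡) (ιℤ-* _ N₁)) ⟩
        bᶠ * (ιℤ ((+ p) ℤ.^ f) * ιℤ N₁)          ≈⟨ solve 3 (λ b p n → b :* (p :* n) := p :* b :* n) refl _ _ _ ⟩
        ιℤ ((+ p) ℤ.^ f) * bᶠ * ιℤ N₁            ≈⟨ *-congʳ (*-cong (ιℤ-^ (+ p) f) (ιℤ-^ b f)) ⟩
        ιℤ (+ p) ^ f * ιℤ b ^ f * ιℤ N₁          ≈⟨ *-congʳ (^-distrib-* _ _ f) ⟨
        (ιℤ (+ p) * ιℤ b) ^ f * ιℤ N₁            ≈⟨ *-congʳ (^-congˡ f a≈pb) ⟨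
        ιℤ a ^ f * ιℤ N₁                         ≈⟨ *-congʳ (trans (θ^nk≈a^k f) (ιℤ-^ a f)) ⟨
        θ ^ g * ιℤ N₁                            ∎

      r∈R : R r
      r∈R = span-ιℤ* (b ℤ.^ f) (R-* (R-^ (span-ιℤ* (b ℤ.^ s) (R-^ R-θ e)) (suc g)) (Nyᵏ∈R (suc g)))

      θr≈ : ιℤ N₁ * (ιℤ b * x) ^ suc g ≈ θ * r
      θr≈ = θ^-cancel₂ g (begin
        θ ^ g * (ιℤ N₁ * (ιℤ b * x) ^ suc g)               ≈⟨ *-assoc _ _ _ ⟨
        θ ^ g * ιℤ N₁ * (ιℤ b * x) ^ suc g                 ≈⟨ *-cong bᶠN≈ (^-congˡ (suc g) θuy≈bx) ⟨
        bᶠ * ιℤ N * (θ * (u * y)) ^ suc g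
          ≈⟨ *-congˡ (trans (^-distrib-* θ _ (suc g)) (*-congˡ (^-distrib-* u y (suc g)))) ⟩
        bᶠ * ιℤ N * (θ ^ suc g * (u ^ suc g * y ^ suc g))
          ≈⟨ solve 6 (λ b n t tᵍ u y → b :* n :* (t :* tᵍ :* (u :* y)) := tᵍ :* (t :* (b :* (u :* (n :* y)))))
                 refl bᶠ (ιℤ N) θ (θ ^ g) (u ^ suc g) (y ^ suc g) ⟩
        θ ^ g * (θ * r)                                    ∎)

      p∤ : ¬ (+ p ∣ₛ N₁ ℤ.* (b ℤ.* w) ℤ.^ suc g)
      p∤ = prime∤* pr (proj₂ (proj₂ (proj₂ split))) (λ p∣ → prime∤* pr p∤b p∤w (prime∣^ pr _ (suc g) p∣))

      p∣ : + p ∣ₛ N₁ ℤ.* (b ℤ.* w) ℤ.^ suc g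
      p∣ = residue-θ* r∈R θr≈ (residue-* (residue-ιℤ N₁) (residue-^ (residue-* (residue-ιℤ b) x~w) (suc g)))

  -- The p-th power map modulo pR

  module Frobenius {p} (pr : Prime p) where
    open Binomial commutativeSemiring using () renaming (theorem to binomial-theorem)
    open Mult semiring using () renaming (_×_ to _×ₙ_)

    pR : Carrier → Set (c ⊔ ℓ)
    pR x = Σ[ r ∈ Carrier ] R r × x ≈ ιℤ (+ p) * r

    pR-+ : ∀ {x y} → pR x → pR y → pR (x + y)
    pR-+ (r , r∈R , x≈) (s , s∈R , y≈) = r + s , span-+ r∈R s∈R , trans (+-cong x≈ y≈) (sym (distribˡ _ _ _))

    pR-0 : pR 0#
    pR-0 = 0# , span-0 , sym (zeroʳ _)

    pR-sum : ∀ {d} (f : Fin d → Carrier) → (∀ i → pR (f i)) → pR (sum f)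
    pR-sum {zero}  f f∈ = pR-0
    pR-sum {suc d} f f∈ = pR-+ (f∈ zero) (pR-sum (λ i → f (suc i)) (λ i → f∈ (suc i)))

    ×ₙ≈ιℤ* : ∀ k x → k ×ₙ x ≈ ιℤ (+ k) * x
    ×ₙ≈ιℤ* zero    x = sym (trans (*-congʳ ι-0) (zeroˡ x))
    ×ₙ≈ιℤ* (suc k) x = begin
      x + k ×ₙ x                  ≈⟨ +-congˡ (×ₙ≈ιℤ* k x) ⟩
      x + ιℤ (+ k) * x            ≈⟨ solve 2 (λ x k → x :+ k :* x := (con 1ℤ :+ k) :* x) refl x (ιℤ (+ k)) ⟩
      (ιℤ 1ℤ + ιℤ (+ k)) * x      ≈⟨ *-congʳ (ιℤ-+ 1ℤ (+ k)) ⟨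
      ιℤ (+ suc k) * x            ∎

    p∣⇒×ₙ∈pR : ∀ {k x} → p ℕ.∣ k → R x → pR (k ×ₙ x)
    p∣⇒×ₙ∈pR {k} {x} (ℕ.divides q ≡.refl) x∈R = ιℤ (+ q) * x , span-ιℤ* (+ q) x∈R , (begin
      (q ℕ.* p) ×ₙ x                   ≈⟨ ×ₙ≈ιℤ* (q ℕ.* p) x ⟩
      ιℤ (+ (q ℕ.* p)) * x             ≈⟨ *-congʳ (trans (ιℤ-cong (ℤ.pos-* q p)) (ιℤ-* (+ q) (+ p))) ⟩
      ιℤ (+ q) * ιℤ (+ p) * x          ≈⟨ solve 3 (λ q p x → q :* p :* x := p :* (q :* x)) refl _ _ _ ⟩
      ιℤ (+ p) * (ιℤ (+ q) * x)        ∎)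

    freshman : ∀ {x y} → R x → R y → pR ((x + y) ^ p - (x ^ p + y ^ p))
    -- The exponent is generalised so that it can be matched with a successor; the binomial sum then
    -- splits into its two end terms and the middle ones, which p divides.
    freshman = go p ≡.refl
      where
      go : ∀ q → q ≡ p → ∀ {x y} → R x → R y → pR ((x + y) ^ q - (x ^ q + y ^ q))
      go zero    0≡p = contradiction (cong +_ (≡.sym 0≡p)) (prime≢0 pr)
      go (suc q) ≡.refl {x} {y} x∈R y∈R = proj₁ middle , proj₁ (proj₂ middle) , (begin
        (x + y) ^ p - (x ^ p + y ^ p)                     ≈⟨ +-congʳ (binomial-theorem p x y) ⟩
        t zero + sum t′ - (x ^ p + y ^ p)
          ≈⟨ +-congʳ (+-cong first (trans (sum-init-last t′) (+-congˡ last))) ⟩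
        y ^ p + (sum t″ + x ^ p) - (x ^ p + y ^ p)        ≈⟨ solve 3 (λ x y s → y :+ (s :+ x) :- (x :+ y) := s)
               refl (x ^ p) (y ^ p) (sum t″) ⟩
        sum t″                                            ≈⟨ proj₂ (proj₂ middle) ⟩
        ιℤ (+ p) * proj₁ middle                           ∎)
        where
        t : Fin (suc (suc q)) → Carrier
        t k = (p C toℕ k) ×ₙ (x ^ toℕ k * y ^ (p ℕ.∸ toℕ k))
        t′ : Fin (suc q) → Carrier
        t′ k = t (suc k)
        t″ : Fin q → Carrier
        t″ k = t′ (Fin.inject₁ k)
        first : t zero ≈ y ^ p
        first = trans (+-identityʳ _) (*-identityˡ _)
        last : t′ (Fin.fromℕ q) ≈ x ^ p
        last rewrite Fin.toℕ-fromℕ q | nCn≡1 (suc q) | ℕ.n∸n≡0 q = trans (+-identityʳ _) (*-identityʳ _)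
        middle : pR (sum t″)
        middle = pR-sum t″ λ k → p∣⇒×ₙ∈pR
          (prime∣pCk pr (suc (toℕ (Fin.inject₁ k))) (s≤s z≤n) (s≤s (ℕ.≤-trans (ℕ.≤-reflexive (cong suc (Fin.toℕ-inject₁ k))) (Fin.toℕ<n k))))
          (R-* (R-^ x∈R (suc (toℕ (Fin.inject₁ k)))) (R-^ y∈R (q ℕ.∸ toℕ (Fin.inject₁ k))))

    R-sum : ∀ {d} (f : Fin d → Carrier) → (∀ i → R (f i)) → R (sum f)
    R-sum {zero}  f f∈ = span-0
    R-sum {suc d} f f∈ = span-+ (f∈ zero) (R-sum (λ i → f (suc i)) (λ i → f∈ (suc i)))

    pR-resp : ∀ {x y} → x ≈ y → pR x → pR y
    pR-resp x≈y (r , r∈R , x≈) = r , r∈R , trans (sym x≈y) x≈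

    sum-^p : ∀ {d} (f : Fin d → Carrier) → (∀ i → R (f i)) → pR (sum f ^ p - sum (λ i → f i ^ p))
    sum-^p {zero}  f f∈ = 0# , span-0 , (begin
      0# ^ p - 0#       ≈⟨ +-congʳ (0^ p (prime≢0 pr)) ⟩
      0# - 0#           ≈⟨ trans (-‿inverseʳ 0#) (sym (zeroʳ _)) ⟩
      ιℤ (+ p) * 0#     ∎)
      where
      0^ : ∀ q → + q ≢ 0ℤ → 0# ^ q ≈ 0#
      0^ zero    0≢0 = contradiction ≡.refl 0≢0
      0^ (suc q) _   = zeroˡ _
    sum-^p {suc d} f f∈ = pR-resp
      (solve 4 (λ s x t u → s :- (x :+ t) :+ (t :- u) := s :- (x :+ u)) refl _ _ _ _)
      (pR-+ (freshman (f∈ zero) (R-sum f′ (λ i → f∈ (suc i)))) (sum-^p f′ (λ i → f∈ (suc i))))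
      where
      f′ : Fin d → Carrier
      f′ i = f (suc i)

  -- Coordinates with respect to the powers of θ

  module Coordinates (independent : (v : Vec ℤ (suc m)) → ev v θ ≈ 0# → ∀ i → lookup v i ≡ 0ℤ) where

    -- By independence the coordinates of both sides agree. The value q = 0 is allowed: divisibility
    -- by 0 is vanishing, which is the form used for irreducibility.
    divisible-coefficients : ∀ q {s} → R s → ∀ v → ev v θ ≈ ιℤ q * s → ∀ i → q ∣ₛ lookup v i
    divisible-coefficients q {s} (w , s≈w) v v≈qs i = divides (lookup w i) (≡.trans
      (ℤ.i-j≡0⇒i≡j _ _ (≡.trans (≡.sym lookup-u) (independent u u≈0 i))) (ℤ.*-comm q _))
      where
      u : Vec ℤ (suc m)
      u = Vec.zipWith ℤ._+_ v (Vec.map (ℤ._*_ (ℤ.- q)) w)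
      lookup-u : lookup u i ≡ lookup v i ℤ.- q ℤ.* lookup w i
      lookup-u = ≡.trans (Vec.lookup-zipWith ℤ._+_ i v _) (cong (ℤ._+_ (lookup v i))
        (≡.trans (Vec.lookup-map i _ w) (≡.sym (ℤ.neg-distribˡ-* q (lookup w i)))))
      u≈0 : ev u θ ≈ 0#
      u≈0 = begin
        ev u θ                                     ≈⟨ trans (ev-+ v _ θ) (+-congˡ (ev-* (ℤ.- q) w θ)) ⟩
        ev v θ + ιℤ (ℤ.- q) * ev w θ               ≈⟨ +-cong v≈qs (*-cong (ιℤ-neg q) (sym s≈w)) ⟩
        ιℤ q * s + (- ιℤ q) * s                    ≈⟨ solve 2 (λ q s → q :* s :+ (:- q) :* s := con 0ℤ) refl _ _ ⟩
        ιℤ 0ℤ                                      ≈⟨ ι-0 ⟩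
        0#                                         ∎

    -- Multiplication by k permutes the exponents modulo n, and θ^(ki) = a^⌊ki/n⌋ θ^(ki mod n).
    divisible-powers : ∀ q k r e → k ℕ.* r ≡ 1 ℕ.+ e ℕ.* suc m → ∀ (d : Fin (suc m) → ℤ) {s} → R s →
      sum (λ i → ιℤ (d i) * θ ^ (k ℕ.* toℕ i)) ≈ ιℤ q * s → ∀ i → q ∣ₛ d i ℤ.* a ℤ.^ ((k ℕ.* toℕ i) ℕ./ suc m)
    divisible-powers q k r e kr≡1 d {s} s∈R eq i = subst (q ∣ₛ_)
      (≡.trans (Vec.lookup∘tabulate g (mulMod k i)) (g-mulMod i))
      (divisible-coefficients q s∈R (tabulate g) g≈ (mulMod k i))
      where
      rk≡1 : r ℕ.* k ≡ 1 ℕ.+ e ℕ.* suc m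
      rk≡1 = ≡.trans (ℕ.*-comm r k) kr≡1
      h g : Fin (suc m) → ℤ
      h i = d i ℤ.* a ℤ.^ ((k ℕ.* toℕ i) ℕ./ suc m)
      g j = h (mulMod r j)
      g-mulMod : ∀ i → g (mulMod k i) ≡ h i
      g-mulMod i = cong h (mulMod-inverse {k = r} {r = k} {s = e} rk≡1 i)
      π = permutation (mulMod k) (mulMod r) (mulMod-inverse {k = k} {r = r} {s = e} kr≡1) (mulMod-inverse {k = r} {r = k} {s = e} rk≡1)
      term : ∀ i → ιℤ (g (mulMod k i)) * θ ^ toℕ (mulMod k i) ≈ ιℤ (d i) * θ ^ (k ℕ.* toℕ i)
      term i = begin
        ιℤ (g (mulMod k i)) * θ ^ toℕ (mulMod k i)
          ≡⟨ cong₂ (λ z j → ιℤ z * θ ^ j) (g-mulMod i) (toℕ-mulMod k i) ⟩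
        ιℤ (h i) * θ ^ (ki ℕ.% suc m)          ≈⟨ *-congʳ (ιℤ-* (d i) _) ⟩
        ιℤ (d i) * ιℤ (a ℤ.^ (ki ℕ./ suc m)) * θ ^ (ki ℕ.% suc m)   ≈⟨ *-congʳ (*-congˡ (θ^nk≈a^k (ki ℕ./ suc m))) ⟨
        ιℤ (d i) * θ ^ (suc m ℕ.* (ki ℕ./ suc m)) * θ ^ (ki ℕ.% suc m)
          ≈⟨ trans (*-assoc _ _ _) (*-congˡ (trans (*-comm _ _) (sym (^-homo-* θ (ki ℕ.% suc m) _)))) ⟩
        ιℤ (d i) * θ ^ (ki ℕ.% suc m ℕ.+ suc m ℕ.* (ki ℕ./ suc m))
          ≡⟨ cong (λ j → ιℤ (d i) * θ ^ j) (≡.sym (≡.trans (ℕ.m≡m%n+[m/n]*n ki (suc m)) (cong (ki ℕ.% suc m ℕ.+_) (ℕ.*-comm (ki ℕ./ suc m) (suc m))))) ⟩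
        ιℤ (d i) * θ ^ ki                      ∎
        where ki = k ℕ.* toℕ i
      g≈ : ev (tabulate g) θ ≈ ιℤ q * s
      g≈ = begin
        ev (tabulate g) θ                                                ≈⟨ ev-sum (tabulate g) θ ⟩
        sum (λ j → ιℤ (lookup (tabulate g) j) * θ ^ toℕ j)
          ≈⟨ sum-cong-≋ (λ j → *-congʳ {θ ^ toℕ j} (ιℤ-cong (Vec.lookup∘tabulate g j))) ⟩
        sum (λ j → ιℤ (g j) * θ ^ toℕ j)                                 ≈⟨ sum-permute (λ j → ιℤ (g j) * θ ^ toℕ j) π ⟩
        sum (λ i → ιℤ (g (mulMod k i)) * θ ^ toℕ (mulMod k i))           ≈⟨ sum-cong-≋ term ⟩
        sum (λ i → ιℤ (d i) * θ ^ (k ℕ.* toℕ i))                         ≈⟨ eq ⟩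
        ιℤ q * s                                                         ∎

    -- Primes dividing neither a nor n

    module Unramified {p} (pr : Prime p) (p∤a : ¬ (+ p ∣ₛ a)) {r e} (pr≡1 : p ℕ.* r ≡ 1 ℕ.+ e ℕ.* suc m) where
      open Frobenius pr

      p∣coefficients : ∀ (v : Vec ℤ (suc m)) → (∀ i → + p ∣ₛ lookup v i) → pR (ev v θ)
      p∣coefficients v p∣ = let w , v≡ = divide-coefficients (+ p) v p∣ in
        ev w θ , (w , refl) , trans (reflexive (cong (λ v → ev v θ) v≡)) (ev-* (+ p) w θ)

      -- Frobenius sends Σ cᵢθⁱ to Σ cᵢᵖθ^(pi) modulo p, hence is injective on R/pR.
      ^p∈pR⇒∈pR : ∀ {x} → R x → pR (x ^ p) → pR x
      ^p∈pR⇒∈pR {x} (v , x≈v) xᵖ∈pR = pR-resp (sym x≈v) (p∣coefficients v p∣vᵢ)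
        where
        f : Fin (suc m) → Carrier
        f i = ιℤ (lookup v i) * θ ^ toℕ i
        f^p≈ : ∀ i → f i ^ p ≈ ιℤ (lookup v i ℤ.^ p) * θ ^ (p ℕ.* toℕ i)
        f^p≈ i = trans (^-distrib-* _ _ p) (*-cong (sym (ιℤ-^ _ p))
          (trans (^-assocʳ θ (toℕ i) p) (reflexive (cong (θ ^_) (ℕ.*-comm (toℕ i) p)))))
        neg-pR : ∀ {x} → pR x → pR (- x)
        neg-pR (r , r∈R , x≈) = - r , span-neg r∈R , trans (-‿cong x≈) (-‿distribʳ-* _ _)
        sum∈pR : pR (sum (λ i → ιℤ (lookup v i ℤ.^ p) * θ ^ (p ℕ.* toℕ i)))
        sum∈pR = pR-resp
          (trans (+-congʳ (^-congˡ p (trans x≈v (ev-sum v θ))))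
            (trans (solve 2 (λ s t → s :+ (:- (s :- t)) := t) refl (sum f ^ p) (sum (λ i → f i ^ p))) (sum-cong-≋ f^p≈)))
          (pR-+ xᵖ∈pR (neg-pR (sum-^p f (λ i → span-ιℤ* (lookup v i) (R-^ R-θ (toℕ i))))))
        p∣vᵢ : ∀ i → + p ∣ₛ lookup v i
        p∣vᵢ i = [ prime∣^ pr (lookup v i) p , (λ p∣aᵏ → contradiction (prime∣^ pr a ((p ℕ.* toℕ i) ℕ./ suc m) p∣aᵏ) p∤a) ]′
          (prime∣* pr (lookup v i ℤ.^ p) (a ℤ.^ ((p ℕ.* toℕ i) ℕ./ suc m))
            (divisible-powers (+ p) p r e pr≡1 (λ i → lookup v i ℤ.^ p) (proj₁ (proj₂ sum∈pR)) (proj₂ (proj₂ sum∈pR)) i))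

      ^p^k∈pR⇒∈pR : ∀ k {x} → R x → pR (x ^ (p ℕ.^ k)) → pR x
      ^p^k∈pR⇒∈pR zero    x∈R x∈pR = pR-resp (*-identityʳ _) x∈pR
      ^p^k∈pR⇒∈pR (suc k) {x} x∈R x∈pR = ^p^k∈pR⇒∈pR k x∈R (^p∈pR⇒∈pR (R-^ x∈R (p ℕ.^ k)) (pR-resp
        (sym (trans (^-assocʳ x (p ℕ.^ k) p) (reflexive (cong (x ^_) (ℕ.*-comm (p ℕ.^ k) p))))) x∈pR))

      -- With z = p y in R, the element N zᵏ = pᵏ (N yᵏ) lies in pᵏR. Once pᵏ ∤ N, every coordinate
      -- of zᵏ must be divisible by p, and since R/pR is reduced this passes from zᵏ to z.
      almostIntegral-p : ∀ {y} → AlmostIntegral y → R (ιℤ (+ p) * y) → R y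
      almostIntegral-p {y} (N , N≢0 , Nyᵏ∈R) z∈R = span-resp (sym (ιℤ-cancel₂ (prime≢0 pr) (proj₂ (proj₂ z∈pR)))) (proj₁ (proj₂ z∈pR))
        where
        z = ιℤ (+ p) * y
        -- For this exponent pᵏ does not divide N, because |N| < p^|N|.
        k = ℤ.∣ N ∣
        zᵏ = R-^ z∈R k
        v = proj₁ zᵏ
        Nv≈ : ev (Vec.map (N ℤ.*_) v) θ ≈ ιℤ ((+ p) ℤ.^ k) * (ιℤ N * y ^ k)
        Nv≈ = begin
          ev (Vec.map (N ℤ.*_) v) θ              ≈⟨ trans (ev-* N v θ) (*-congˡ (sym (proj₂ zᵏ))) ⟩
          ιℤ N * z ^ k                           ≈⟨ *-congˡ (trans (^-distrib-* _ y k) (*-congʳ (sym (ιℤ-^ (+ p) k)))) ⟩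
          ιℤ N * (ιℤ ((+ p) ℤ.^ k) * y ^ k)      ≈⟨ solve 3 (λ n p y → n :* (p :* y) := p :* (n :* y)) refl _ _ _ ⟩
          ιℤ ((+ p) ℤ.^ k) * (ιℤ N * y ^ k)      ∎
        p∣vᵢ : ∀ i → + p ∣ₛ lookup v i
        p∣vᵢ i = decidable-stable (+ p ℤᵈ.∣? lookup v i) λ p∤ → prime^∤ pr N≢0
          (prime^∣* pr k N (lookup v i) p∤ (subst (_ ∣ₛ_) (Vec.lookup-map i (N ℤ.*_) v)
            (divisible-coefficients ((+ p) ℤ.^ k) (Nyᵏ∈R k) (Vec.map (N ℤ.*_) v) Nv≈ i)))
        zᵏ∈pR : pR (z ^ k)
        zᵏ∈pR = pR-resp (sym (proj₂ zᵏ)) (p∣coefficients v p∣vᵢ)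
        -- The Frobenius argument undoes only powers whose exponent is a power of p, so the exponent
        -- k is raised to pᵏ > k.
        e′ = p ℕ.^ k ℕ.∸ k
        z^p^k∈pR : pR (z ^ (p ℕ.^ k))
        z^p^k∈pR = let s , s∈R , zᵏ≈ps = zᵏ∈pR in s * z ^ e′ , R-* s∈R (R-^ z∈R e′) , (begin
          z ^ (p ℕ.^ k)                  ≡⟨ cong (z ^_) (ℕ.m+[n∸m]≡n (ℕ.<⇒≤ (n<prime^n pr k))) ⟨
          z ^ (k ℕ.+ e′)                 ≈⟨ ^-homo-* z k e′ ⟩
          z ^ k * z ^ e′                 ≈⟨ *-congʳ zᵏ≈ps ⟩
          ιℤ (+ p) * s * z ^ e′          ≈⟨ *-assoc _ _ _ ⟩
          ιℤ (+ p) * (s * z ^ e′)        ∎)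
        z∈pR : pR z
        z∈pR = ^p^k∈pR⇒∈pR k z∈R z^p^k∈pR

-- Evaluation of polynomials

-- The coefficients form a raw ring so that ℤ and ℚ are both covered; symmetry of their equality,
-- which a raw ring does not provide, is a parameter.
module Evaluation {c ℓ} (A : ℚAlgebra c ℓ) {S : RawRing 0ℓ 0ℓ} (S-sym : Symmetric (RawRing._≈_ S))
                  {φ : RawRing.Carrier S → ℚAlgebra.Carrier A}
                  (φ-homo : IsRingHomomorphism S (ℚAlgebra.rawRing A) φ) where
  open ℚAlgebraProperties A
  open Polynomial S
  private module S = RawRing S
  open IsRingHomomorphism φ-homo
    renaming (⟦⟧-cong to φ-cong; +-homo to φ-+; *-homo to φ-*; -‿homo to φ-neg; 0#-homo to φ-0; 1#-homo to φ-1)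

  eval : Poly → Carrier → Carrier
  eval []      x = 0#
  eval (k ∷ p) x = φ k + x * eval p x

  eval-+ : ∀ p q x → eval (p +ₚ q) x ≈ eval p x + eval q x
  eval-+ []      q       x = sym (+-identityˡ _)
  eval-+ (j ∷ p) []      x = sym (+-identityʳ _)
  eval-+ (j ∷ p) (k ∷ q) x = begin
    φ (j S.+ k) + x * eval (p +ₚ q) x      ≈⟨ +-cong (φ-+ j k) (*-congˡ (eval-+ p q x)) ⟩
    φ j + φ k + x * (eval p x + eval q x)
      ≈⟨ solve 5 (λ j k x p q → j :+ k :+ x :* (p :+ q) := j :+ x :* p :+ (k :+ x :* q)) refl _ _ _ _ _ ⟩
    φ j + x * eval p x + (φ k + x * eval q x)   ∎

  eval-scale : ∀ k p x → eval (List.map (k S.*_) p) x ≈ φ k * eval p x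
  eval-scale k []      x = sym (zeroʳ _)
  eval-scale k (j ∷ p) x = begin
    φ (k S.* j) + x * eval (List.map (k S.*_) p) x   ≈⟨ +-cong (φ-* k j) (*-congˡ (eval-scale k p x)) ⟩
    φ k * φ j + x * (φ k * eval p x)
      ≈⟨ solve 4 (λ k j x p → k :* j :+ x :* (k :* p) := k :* (j :+ x :* p)) refl _ _ _ _ ⟩
    φ k * (φ j + x * eval p x)                       ∎

  eval-∷0 : ∀ p x → eval (S.0# ∷ p) x ≈ x * eval p x
  eval-∷0 p x = trans (+-congʳ φ-0) (+-identityˡ _)

  eval-* : ∀ p q x → eval (p *ₚ q) x ≈ eval p x * eval q x
  eval-* []      q x = sym (zeroˡ _)
  eval-* (k ∷ p) q x = begin
    eval (List.map (k S.*_) q +ₚ (S.0# ∷ p *ₚ q)) x   ≈⟨ eval-+ (List.map (k S.*_) q) _ x ⟩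
    eval (List.map (k S.*_) q) x + eval (S.0# ∷ p *ₚ q) x
      ≈⟨ +-cong (eval-scale k q x) (trans (eval-∷0 (p *ₚ q) x) (*-congˡ (eval-* p q x))) ⟩
    φ k * eval q x + x * (eval p x * eval q x)
      ≈⟨ solve 4 (λ k x p q → k :* q :+ x :* (p :* q) := (k :+ x :* p) :* q) refl _ _ _ _ ⟩
    (φ k + x * eval p x) * eval q x                   ∎

  eval-neg : ∀ p x → eval (-ₚ p) x ≈ - eval p x
  eval-neg []      x = sym -0#≈0#
  eval-neg (k ∷ p) x = begin
    φ (S.- k) + x * eval (-ₚ p) x     ≈⟨ +-cong (φ-neg k) (*-congˡ (eval-neg p x)) ⟩
    - φ k + x * (- eval p x)          ≈⟨ solve 3 (λ k x p → (:- k) :+ x :* (:- p) := :- (k :+ x :* p)) refl _ _ _ ⟩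
    - (φ k + x * eval p x)            ∎

  eval-const : ∀ k x → eval (const k) x ≈ φ k
  eval-const k x = trans (+-congˡ (zeroʳ x)) (+-identityʳ _)

  eval-X : ∀ x → eval X x ≈ x
  eval-X x = trans (eval-∷0 (const S.1#) x) (trans (*-congˡ (trans (eval-const S.1# x) φ-1)) (*-identityʳ x))

  open RawSemiringDefs (RawRing.rawSemiring polyRawRing) using () renaming (_^_ to _^ₚ_)

  eval-^ : ∀ p k x → eval (p ^ₚ k) x ≈ eval p x ^ k
  eval-^ p zero    x = trans (eval-const S.1# x) φ-1
  eval-^ p (suc k) x = trans (eval-* p (p ^ₚ k) x) (*-congˡ (eval-^ p k x))

  eval-zero : ∀ p x → (∀ i → coeff p i S.≈ S.0#) → eval p x ≈ 0#
  eval-zero []      x p≈0 = refl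
  eval-zero (k ∷ p) x p≈0 = trans (+-cong (trans (φ-cong (p≈0 0)) φ-0) (*-congˡ (eval-zero p x (λ i → p≈0 (suc i)))))
    (trans (+-identityˡ _) (zeroʳ x))

  -- Equal polynomials may be lists of different lengths; the surplus of the longer one consists of
  -- zeros and evaluates to 0.
  eval-cong : ∀ p q x → p ≈ₚ q → eval p x ≈ eval q x
  eval-cong []      q       x p≈q = sym (eval-zero q x (λ i → S-sym (p≈q i)))
  eval-cong (j ∷ p) []      x p≈q = eval-zero (j ∷ p) x p≈q
  eval-cong (j ∷ p) (k ∷ q) x p≈q = +-cong (φ-cong (p≈q 0)) (*-congˡ (eval-cong p q x (λ i → p≈q (suc i))))

  eval-sum : ∀ n p x → (∀ i → n ℕ.≤ i → coeff p i S.≈ S.0#) → eval p x ≈ sum {n} (λ i → φ (coeff p (toℕ i)) * x ^ toℕ i)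
  eval-sum zero    p       x high = eval-zero p x (λ i → high i z≤n)
  eval-sum (suc n) []      x high = sym (trans (sum-cong-≋ {suc n} (λ i → *-congʳ {x ^ toℕ i} φ-0))
    (trans (sym (*-distribˡ-sum 0# (λ (i : Fin (suc n)) → x ^ toℕ i))) (zeroˡ _)))
  eval-sum (suc n) (k ∷ p) x high = +-cong (sym (*-identityʳ _)) (begin
    x * eval p x
      ≈⟨ *-congˡ (eval-sum n p x (λ i n≤i → high (suc i) (s≤s n≤i))) ⟩
    x * sum {n} (λ i → φ (coeff p (toℕ i)) * x ^ toℕ i)
      ≈⟨ *-distribˡ-sum {n} x (λ i → φ (coeff p (toℕ i)) * x ^ toℕ i) ⟩
    sum {n} (λ i → x * (φ (coeff p (toℕ i)) * x ^ toℕ i))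
      ≈⟨ sum-cong-≋ {n} (λ i → solve 3 (λ y k z → y :* (k :* z) := k :* (y :* z)) refl x (φ (coeff p (toℕ i))) (x ^ toℕ i)) ⟩
    sum {n} (λ i → φ (coeff p (toℕ i)) * x ^ suc (toℕ i))        ∎)

module IntegerPolynomials {c ℓ} (A : ℚAlgebra c ℓ) where
  open ℚAlgebraProperties A
  open Polynomial ℤ.+-*-rawRing

  ιℤ-homo : IsRingHomomorphism ℤ.+-*-rawRing rawRing ιℤ
  ιℤ-homo = record
    { isSemiringHomomorphism = record
      { isNearSemiringHomomorphism = record
        { +-isMonoidHomomorphism = record
          { isMagmaHomomorphism = record { isRelHomomorphism = record { cong = ιℤ-cong } ; homo = ιℤ-+ }
          ; ε-homo = ι-0 }
        ; *-homo = ιℤ-* }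
      ; 1#-homo = ι-1 }
    ; -‿homo = ιℤ-neg }

  open Evaluation A ≡.sym ιℤ-homo public

  eval≈ev : ∀ p x → eval p x ≈ ev (Vec.fromList p) x
  eval≈ev []      x = refl
  eval≈ev (k ∷ p) x = +-congˡ (*-congˡ (eval≈ev p x))

  ev≈eval : ∀ {d} (v : Vec ℤ d) x → ev v x ≈ eval (Vec.toList v) x
  ev≈eval []      x = refl
  ev≈eval (k ∷ v) x = +-congˡ (*-congˡ (ev≈eval v x))

  eval-xⁿ-aᵘ : ∀ n u a x → eval (xⁿ-aᵘ n u a) x ≈ x ^ n - ιℤ (a ℤ.^ u)
  eval-xⁿ-aᵘ n u a x = begin
    eval (xⁿ-aᵘ n u a) x                              ≈⟨ eval-+ (X ^ₚ n) (-ₚ const (a ℤ.^ u)) x ⟩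
    eval (X ^ₚ n) x + eval (-ₚ const (a ℤ.^ u)) x
      ≈⟨ +-cong (trans (eval-^ X n x) (^-congˡ n (eval-X x))) (trans (eval-neg (const (a ℤ.^ u)) x) (-‿cong (eval-const (a ℤ.^ u) x))) ⟩
    x ^ n - ιℤ (a ℤ.^ u)                              ∎
    where open RawSemiringDefs (RawRing.rawSemiring ℤ[x]) using () renaming (_^_ to _^ₚ_)

  monic-root : ∀ p {d} → coeff p d ≡ 1ℤ → (∀ i → d ℕ.< i → coeff p i ≡ 0ℤ) → ∀ y → Span d y (eval p y - y ^ d)
  monic-root []      {d}     ()   _    y
  monic-root (k ∷ p) {zero}  ≡.refl high y = span-resp (sym (begin
    ιℤ 1ℤ + y * eval p y - 1#      ≈⟨ +-congʳ (+-cong ι-1 (*-congˡ (eval-zero p y (λ i → high (suc i) (s≤s z≤n))))) ⟩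
    1# + y * 0# - 1#               ≈⟨ +-congʳ (trans (+-congˡ (zeroʳ y)) (+-identityʳ 1#)) ⟩
    1# - 1#                        ≈⟨ -‿inverseʳ 1# ⟩
    0#                             ∎)) span-0
  monic-root (k ∷ p) {suc d} pd≡1 high y = span-resp
    (solve 4 (λ k y p q → k :+ y :* (p :- q) := k :+ y :* p :- y :* q) refl _ _ _ _)
    (span-∷ k (monic-root p pd≡1 (λ i d<i → high (suc i) (s≤s d<i)) y))

  -- `Monic` includes degree 0 while `Closed d` has degree d + 1; one multiplication by y bridges
  -- the difference.
  monic-root⇒integral : ∀ {y} p → Monic p → eval p y ≈ 0# → Integral y
  monic-root⇒integral {y} p (d , pd≡1 , high) p≈0 = d , span-y* (span-resp
    (trans (-‿cong (trans (+-congʳ p≈0) (+-identityˡ _))) (-‿involutive _))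
    (span-neg (monic-root p pd≡1 high y)))

  x^_-_ : ∀ d → Vec ℤ d → Poly
  x^ zero  - []      = 1ℤ ∷ []
  x^ suc d - (k ∷ v) = ℤ.- k ∷ (x^ d - v)

  eval-x^- : ∀ {d} (v : Vec ℤ d) y → eval (x^ d - v) y ≈ y ^ d - ev v y
  eval-x^- []      y = trans (eval-const 1ℤ y) (trans ι-1 (sym (trans (+-congˡ -0#≈0#) (+-identityʳ 1#))))
  eval-x^- {suc d} (k ∷ v) y = begin
    ιℤ (ℤ.- k) + y * eval (x^ d - v) y     ≈⟨ +-cong (ιℤ-neg k) (*-congˡ (eval-x^- v y)) ⟩
    - ιℤ k + y * (y ^ d - ev v y)          ≈⟨ solve 4 (λ k y z v → (:- k) :+ y :* (z :- v) := y :* z :- (k :+ y :* v))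
           refl _ _ _ _ ⟩
    y ^ suc d - (ιℤ k + y * ev v y)        ∎

  monic-x^- : ∀ {d} (v : Vec ℤ d) → (coeff (x^ d - v) d ≡ 1ℤ) × (∀ i → d ℕ.< i → coeff (x^ d - v) i ≡ 0ℤ)
  monic-x^- []      = ≡.refl , λ { (suc i) _ → ≡.refl }
  monic-x^- (k ∷ v) = proj₁ (monic-x^- v) , λ { (suc i) (s≤s d<i) → proj₂ (monic-x^- v) i d<i }

  integral⇒monic-root : ∀ {y} → Integral y → ∃[ p ] Monic p × eval p y ≈ 0#
  integral⇒monic-root {y} (m , v , yⁿ≈v) = (x^ suc m - v) , (suc m , monic-x^- v) ,
    trans (eval-x^- v y) (x≈y⇒x-y≈0 yⁿ≈v)

-- Fractions of R with integer denominators

module Fractions {c ℓ} (A : ℚAlgebra c ℓ) {m : ℕ} {θ : ℚAlgebra.Carrier A} {a : ℤ}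
                 (a≢0 : a ≢ 0ℤ) (θⁿ≈a : RootOf A (suc m) a θ) where
  open ℚAlgebraProperties A
  open PureExtension A {m} a≢0 θⁿ≈a

  R⇒fractional : ∀ {x} → R x → Fractional x
  R⇒fractional x∈R = 1ℤ , (λ ()) , span-ιℤ* 1ℤ x∈R

  fractional-ι : ∀ q → Fractional (ι q)
  fractional-ι q = ℚ.↧ q , (λ ()) , span-resp (trans (ι-cong (≡.sym (denominator-clears q))) (ι-* _ q)) (span-ιℤ (ℚ.↥ q))

  fractional-resp : ∀ {x y} → x ≈ y → Fractional x → Fractional y
  fractional-resp x≈y (D , D≢0 , Dx∈R) = D , D≢0 , span-resp (*-congˡ x≈y) Dx∈R

  fractional-+ : ∀ {x y} → Fractional x → Fractional y → Fractional (x + y)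
  fractional-+ {x} {y} (D , D≢0 , Dx∈R) (E , E≢0 , Ey∈R) = D ℤ.* E , *-≢0 D≢0 E≢0 , span-resp (begin
    ιℤ E * (ιℤ D * x) + ιℤ D * (ιℤ E * y)
      ≈⟨ solve 4 (λ d e x y → e :* (d :* x) :+ d :* (e :* y) := d :* e :* (x :+ y)) refl (ιℤ D) (ιℤ E) x y ⟩
    ιℤ D * ιℤ E * (x + y)       ≈⟨ *-congʳ (ιℤ-* D E) ⟨
    ιℤ (D ℤ.* E) * (x + y)      ∎)
    (span-+ (span-ιℤ* E Dx∈R) (span-ιℤ* D Ey∈R))

  fractional-* : ∀ {x y} → Fractional x → Fractional y → Fractional (x * y)
  fractional-* {x} {y} (D , D≢0 , Dx∈R) (E , E≢0 , Ey∈R) = D ℤ.* E , *-≢0 D≢0 E≢0 , span-resp (begin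
    ιℤ D * x * (ιℤ E * y)       ≈⟨ solve 4 (λ d e x y → d :* x :* (e :* y) := d :* e :* (x :* y)) refl (ιℤ D) (ιℤ E) x y ⟩
    ιℤ D * ιℤ E * (x * y)       ≈⟨ *-congʳ (ιℤ-* D E) ⟨
    ιℤ (D ℤ.* E) * (x * y)      ∎)
    (R-* Dx∈R Ey∈R)

  fractional-neg : ∀ {x} → Fractional x → Fractional (- x)
  fractional-neg (D , D≢0 , Dx∈R) = D , D≢0 , span-resp (-‿distribʳ-* _ _) (span-neg Dx∈R)

  R-ev : ∀ {z d} → R z → (v : Vec ℤ d) → R (ev v z)
  R-ev z∈R []      = span-0
  R-ev z∈R (k ∷ v) = span-+ (span-ιℤ k) (R-* z∈R (R-ev z∈R v))

  -- An integral equation of z = D x, stripped of its zero constant terms, exhibits a multiple of 1 / z in R.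
  fractional-inverse : ∀ {x y} → x * y ≈ 1# → Fractional x → Fractional y
  fractional-inverse {x} {y} xy≈1 (D , D≢0 , z∈R) = let m′ , v , zᵐ≈v = span-integral θ-closed z∈R in go v zᵐ≈v
    where
    z = ιℤ D * x
    zy≈D : z * y ≈ ιℤ D
    zy≈D = trans (*-assoc _ _ _) (trans (*-congˡ xy≈1) (*-identityʳ _))
    z-cancel : ∀ {w} → z * w ≈ 0# → w ≈ 0#
    z-cancel zw≈0 = x*y≈1⇒cancel xy≈1 (ιℤ-cancel D≢0 (trans (sym (*-assoc _ _ _)) zw≈0))
    go : ∀ {d} (v : Vec ℤ d) → z ^ d ≈ ev v z → Fractional y
    go []      1≈0 = contradiction 1≈0 nontrivial
    go {suc d} (k ∷ v) zᵈ≈ with k ℤ.≟ 0ℤ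
    ... | yes ≡.refl = go v (cancel-sub z z-cancel (trans zᵈ≈ (trans (+-congʳ ι-0) (+-identityˡ _))))
    ... | no  k≢0 = k , k≢0 , span-resp (begin
      ιℤ D * (z ^ d - ev v z)          ≈⟨ *-congʳ zy≈D ⟨
      z * y * (z ^ d - ev v z)
        ≈⟨ solve 5 (λ z y zᵈ v k → z :* y :* (zᵈ :- v) := (z :* zᵈ :- (k :+ z :* v)) :* y :+ k :* y)
               refl z y (z ^ d) (ev v z) (ιℤ k) ⟩
      (z ^ suc d - (ιℤ k + z * ev v z)) * y + ιℤ k * y   ≈⟨ +-congʳ (trans (*-congʳ (x≈y⇒x-y≈0 zᵈ≈)) (zeroˡ y)) ⟩
      0# + ιℤ k * y                    ≈⟨ +-identityˡ _ ⟩
      ιℤ k * y                         ∎)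
      (span-ιℤ* D (span-+ (R-^ z∈R d) (span-neg (R-ev z∈R v))))

  -- Every power of y is an integer combination of 1, y, ..., y^m′, and one power of D clears the
  -- denominators of all of these at once.
  integral⇒almostIntegral : ∀ {y} → Fractional y → Integral y → AlmostIntegral y
  integral⇒almostIntegral {y} (D , D≢0 , Dy∈R) (m′ , closed) =
    D ℤ.^ suc m′ , ^-≢0 D≢0 (suc m′) , λ k → let v , yᵏ≈v = Closure.closed-^ closed (Closure.closed-y closed) k in
      span-resp (*-congˡ (sym yᵏ≈v)) (clear v)
    where
    clear : ∀ {d} (v : Vec ℤ d) → R (ιℤ (D ℤ.^ d) * ev v y)
    clear []      = span-resp (sym (zeroʳ _)) span-0
    clear {suc d} (k ∷ v) = span-resp (begin
      ιℤ (D ℤ.^ suc d) * ιℤ k + ιℤ D * y * (ιℤ (D ℤ.^ d) * ev v y)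
        ≈⟨ +-congʳ (*-congʳ (ιℤ-* D _)) ⟩
      ιℤ D * ιℤ (D ℤ.^ d) * ιℤ k + ιℤ D * y * (ιℤ (D ℤ.^ d) * ev v y)
        ≈⟨ solve 5 (λ d e k y v → d :* e :* k :+ d :* y :* (e :* v) := d :* e :* (k :+ y :* v)) refl _ _ _ _ _ ⟩
      ιℤ D * ιℤ (D ℤ.^ d) * (ιℤ k + y * ev v y)    ≈⟨ *-congʳ (ιℤ-* D _) ⟨
      ιℤ (D ℤ.^ suc d) * (ιℤ k + y * ev v y)       ∎)
      (span-+ (span-ιℤ* (D ℤ.^ suc d) (span-ιℤ k)) (R-* Dy∈R (clear v)))

  almostIntegral-ιℤ* : ∀ k {y} → AlmostIntegral y → AlmostIntegral (ιℤ k * y)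
  almostIntegral-ιℤ* k {y} (N , N≢0 , Nyⁱ∈R) = N , N≢0 , λ i → span-resp (begin
    ιℤ (k ℤ.^ i) * (ιℤ N * y ^ i)       ≈⟨ *-congʳ (ιℤ-^ k i) ⟩
    ιℤ k ^ i * (ιℤ N * y ^ i)           ≈⟨ solve 3 (λ k n y → k :* (n :* y) := n :* (k :* y)) refl _ _ _ ⟩
    ιℤ N * (ιℤ k ^ i * y ^ i)           ≈⟨ *-congˡ (^-distrib-* (ιℤ k) y i) ⟨
    ιℤ N * (ιℤ k * y) ^ i               ∎)
    (span-ιℤ* (k ℤ.^ i) (Nyⁱ∈R i))

-- R is integrally closed

module RadicalExtension {c ℓ} (A : ℚAlgebra c ℓ) {m : ℕ} {θ : ℚAlgebra.Carrier A} {a : ℤ}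
                        (squarefree : SquareFree a) (2≤n : 2 ℕ.≤ suc m)
                        (radical : ∀ p → Prime p → p ℕ.∣ suc m → + p ∣ₛ a)
                        (θⁿ≈a : RootOf A (suc m) a θ) where
  open ℚAlgebraProperties A

  open PureExtension A {m} (squarefree⇒≢0 squarefree) θⁿ≈a
  open Fractions A {m} (squarefree⇒≢0 squarefree) θⁿ≈a

  private
    module EisensteinAt {p} (pr : Prime p) (p∣a : + p ∣ₛ a) =
      Eisenstein pr {_∣ₛ_.quotient p∣a} (≡.trans (_∣ₛ_.equality p∣a) (ℤ.*-comm _ (+ p))) (squarefree⇒p∤quotient squarefree pr p∣a)

    -- As n ≥ 2 there is a prime p₀ dividing n, and `radical` makes it divide a; independence and
    -- the domain property are taken from this single prime.
    p₀-prime = proj₁ (proj₂ (prime-divisor 2≤n))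
    p₀∣a = radical _ p₀-prime (proj₂ (proj₂ (prime-divisor 2≤n)))

  open EisensteinAt p₀-prime p₀∣a public using (independent; fractional-domain; θ∉ℤ+θ²R)
  open Coordinates independent public

  almostIntegral-p : ∀ {p y} → Prime p → AlmostIntegral y → R (ιℤ (+ p) * y) → R y
  almostIntegral-p {p} pr with + p ℤᵈ.∣? a
  ... | yes p∣a = EisensteinAt.almostIntegral-p pr p∣a
  -- By `radical` p does not divide n either, so p is invertible modulo n.
  ... | no  p∤a = let r , e , pr≡1 = gcd≡1⇒inverse p (suc m) 2≤n (prime-coprime pr λ p∣n → p∤a (radical p pr p∣n))
                  in Unramified.almostIntegral-p pr p∤a {r} {e} pr≡1

  -- The denominator |D| is removed one prime factor at a time. The multiple of y left at each stage
  -- is again almost integral, so the case of a single prime applies to it.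
  almostIntegral⇒R : ∀ {y} → Fractional y → AlmostIntegral y → R y
  almostIntegral⇒R {y} (D , D≢0 , Dy∈R) ai =
    go (PrimeFactorisation.factorsPrime fac) ai
      (subst (λ d → R (ιℤ (+ d) * y)) (PrimeFactorisation.isFactorisation fac) ∣D∣y∈R)
    where
    fac = factorise ℤ.∣ D ∣ {{ℤ.≢-nonZero D≢0}}
    ∣D∣y∈R : R (ιℤ (+ ℤ.∣ D ∣) * y)
    ∣D∣y∈R with ℤ.+∣i∣≡i⊎+∣i∣≡-i D
    ... | inj₁ eq = span-resp (*-congʳ (ιℤ-cong (≡.sym eq))) Dy∈R
    ... | inj₂ eq = span-resp (trans (-‿distribˡ-* _ _) (*-congʳ (trans (sym (ιℤ-neg D)) (ιℤ-cong (≡.sym eq))))) (span-neg Dy∈R)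
    go : ∀ {ps y} → All Prime ps → AlmostIntegral y → R (ιℤ (+ product ps) * y) → R y
    go []            ai y∈R = span-resp (trans (*-congʳ ι-1) (*-identityˡ _)) y∈R
    go {p ∷ ps} {y} (pr ∷ prs) ai y∈R = go prs ai (almostIntegral-p pr (almostIntegral-ιℤ* (+ product ps) ai)
      (span-resp (trans (*-congʳ (trans (ιℤ-cong (ℤ.pos-* p (product ps))) (ιℤ-* (+ p) _))) (*-assoc _ _ _)) y∈R))

  integral⇒R : ∀ {y} → Fractional y → Integral y → R y
  integral⇒R frac int = almostIntegral⇒R frac (integral⇒almostIntegral frac int)

-- Irreducibility

common-denominator : ∀ {k} (f : Fin k → ℚ) →
  ∃[ D ] D ≢ 0ℤ × Σ[ z ∈ (Fin k → ℤ) ] (∀ i → fromℤ (z i) ≡ fromℤ D ℚ.* f i)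
common-denominator {zero}  f = 1ℤ , (λ ()) , (λ ()) , λ ()
common-denominator {suc k} f with common-denominator (λ i → f (suc i))
... | D , D≢0 , z , zᵢ≡ = D ℤ.* ℚ.↧ q , *-≢0 D≢0 (λ ()) , z′ , z′ᵢ≡
  where
  q = f zero
  z′ : Fin (suc k) → ℤ
  z′ zero    = D ℤ.* ℚ.↥ q
  z′ (suc i) = ℚ.↧ q ℤ.* z i
  open ≡.≡-Reasoning
  z′ᵢ≡ : ∀ i → fromℤ (z′ i) ≡ fromℤ (D ℤ.* ℚ.↧ q) ℚ.* f i
  z′ᵢ≡ zero = begin
    fromℤ (D ℤ.* ℚ.↥ q)                   ≡⟨ fromℤ-* D (ℚ.↥ q) ⟩
    fromℤ D ℚ.* fromℤ (ℚ.↥ q)             ≡⟨ cong (fromℤ D ℚ.*_) (denominator-clears q) ⟨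
    fromℤ D ℚ.* (fromℤ (ℚ.↧ q) ℚ.* q)     ≡⟨ ℚ.*-assoc (fromℤ D) (fromℤ (ℚ.↧ q)) q ⟨
    fromℤ D ℚ.* fromℤ (ℚ.↧ q) ℚ.* q       ≡⟨ cong (ℚ._* q) (fromℤ-* D (ℚ.↧ q)) ⟨
    fromℤ (D ℤ.* ℚ.↧ q) ℚ.* q             ∎
  z′ᵢ≡ (suc i) = begin
    fromℤ (ℚ.↧ q ℤ.* z i)                             ≡⟨ fromℤ-* (ℚ.↧ q) (z i) ⟩
    fromℤ (ℚ.↧ q) ℚ.* fromℤ (z i)                     ≡⟨ cong (fromℤ (ℚ.↧ q) ℚ.*_) (zᵢ≡ i) ⟩
    fromℤ (ℚ.↧ q) ℚ.* (fromℤ D ℚ.* f (suc i))         ≡⟨ ℚ.*-assoc (fromℤ (ℚ.↧ q)) (fromℤ D) (f (suc i)) ⟨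
    fromℤ (ℚ.↧ q) ℚ.* fromℤ D ℚ.* f (suc i)           ≡⟨ cong (ℚ._* f (suc i)) (≡.trans (ℚ.*-comm (fromℤ (ℚ.↧ q)) (fromℤ D)) (≡.sym (fromℤ-* D (ℚ.↧ q)))) ⟩
    fromℤ (D ℤ.* ℚ.↧ q) ℚ.* f (suc i)                 ∎

module PolynomialDegree (S : CommutativeRing 0ℓ 0ℓ) where
  open CommutativeRing S hiding (zero)
  open Polynomial rawRing
  open ≈-Reasoning setoid

  -- Degree at most d. Since trailing zeros are allowed, the length of the list says nothing about
  -- the degree.
  HighZero : ℕ → Poly → Set
  HighZero d p = ∀ i → d ℕ.< i → coeff p i ≈ 0#

  coeff-+ : ∀ p q i → coeff (p +ₚ q) i ≈ coeff p i + coeff q i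
  coeff-+ []      q       i       = sym (+-identityˡ _)
  coeff-+ (j ∷ p) []      i       = sym (+-identityʳ _)
  coeff-+ (j ∷ p) (k ∷ q) zero    = refl
  coeff-+ (j ∷ p) (k ∷ q) (suc i) = coeff-+ p q i

  coeff-scale : ∀ k p i → coeff (List.map (k *_) p) i ≈ k * coeff p i
  coeff-scale k []      i       = sym (zeroʳ k)
  coeff-scale k (j ∷ p) zero    = refl
  coeff-scale k (j ∷ p) (suc i) = coeff-scale k p i

  coeff-∷-*-suc : ∀ k p q i → coeff ((k ∷ p) *ₚ q) (suc i) ≈ k * coeff q (suc i) + coeff (p *ₚ q) i
  coeff-∷-*-suc k p q i = trans (coeff-+ (List.map (k *_) q) _ (suc i)) (+-congʳ (coeff-scale k q (suc i)))

  coeff-0-* : ∀ p q → (∀ i → coeff p i ≈ 0#) → ∀ i → coeff (p *ₚ q) i ≈ 0#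
  coeff-0-* []      q p≈0 i       = refl
  coeff-0-* (k ∷ p) q p≈0 zero    = begin
    coeff ((k ∷ p) *ₚ q) 0             ≈⟨ trans (coeff-+ (List.map (k *_) q) _ 0) (+-identityʳ _) ⟩
    coeff (List.map (k *_) q) 0        ≈⟨ coeff-scale k q 0 ⟩
    k * coeff q 0                      ≈⟨ trans (*-congʳ (p≈0 0)) (zeroˡ _) ⟩
    0#                                 ∎
  coeff-0-* (k ∷ p) q p≈0 (suc i) = begin
    coeff ((k ∷ p) *ₚ q) (suc i)              ≈⟨ coeff-∷-*-suc k p q i ⟩
    k * coeff q (suc i) + coeff (p *ₚ q) i
      ≈⟨ +-cong (trans (*-congʳ (p≈0 0)) (zeroˡ _)) (coeff-0-* p q (λ j → p≈0 (suc j)) i) ⟩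
    0# + 0#                                   ≈⟨ +-identityˡ 0# ⟩
    0#                                        ∎

  highZero-* : ∀ d e p q → HighZero d p → HighZero e q → HighZero (d ℕ.+ e) (p *ₚ q)
  highZero-* d e []      q p-high q-high i _ = refl
  highZero-* zero e (k ∷ p) q p-high q-high (suc i) e<i = begin
    coeff ((k ∷ p) *ₚ q) (suc i)              ≈⟨ coeff-∷-*-suc k p q i ⟩
    k * coeff q (suc i) + coeff (p *ₚ q) i
      ≈⟨ +-cong (trans (*-congˡ (q-high (suc i) e<i)) (zeroʳ k)) (coeff-0-* p q (λ j → p-high (suc j) (s≤s z≤n)) i) ⟩
    0# + 0#                                   ≈⟨ +-identityˡ 0# ⟩
    0#                                        ∎
  highZero-* (suc d) e (k ∷ p) q p-high q-high (suc i) (s≤s d+e<i) = begin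
    coeff ((k ∷ p) *ₚ q) (suc i)              ≈⟨ coeff-∷-*-suc k p q i ⟩
    k * coeff q (suc i) + coeff (p *ₚ q) i
      ≈⟨ +-cong (trans (*-congˡ (q-high (suc i) (ℕ.m<n⇒m<1+n (ℕ.≤-<-trans (ℕ.m≤n+m e d) d+e<i)))) (zeroʳ k))
                (highZero-* d e p q (λ j d<j → p-high (suc j) (s≤s d<j)) q-high i d+e<i) ⟩
    0# + 0#                                   ≈⟨ +-identityˡ 0# ⟩
    0#                                        ∎

  leading-* : ∀ d e p q → HighZero d p → HighZero e q → coeff (p *ₚ q) (d ℕ.+ e) ≈ coeff p d * coeff q e
  leading-* d e []      q p-high q-high = sym (zeroˡ _)
  leading-* zero zero (k ∷ p) q p-high q-high =
    trans (coeff-+ (List.map (k *_) q) _ 0) (trans (+-identityʳ _) (coeff-scale k q 0))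
  leading-* zero (suc e) (k ∷ p) q p-high q-high = begin
    coeff ((k ∷ p) *ₚ q) (suc e)              ≈⟨ coeff-∷-*-suc k p q e ⟩
    k * coeff q (suc e) + coeff (p *ₚ q) e    ≈⟨ +-congˡ (coeff-0-* p q (λ j → p-high (suc j) (s≤s z≤n)) e) ⟩
    k * coeff q (suc e) + 0#                  ≈⟨ +-identityʳ _ ⟩
    k * coeff q (suc e)                       ∎
  leading-* (suc d) e (k ∷ p) q p-high q-high = begin
    coeff ((k ∷ p) *ₚ q) (suc (d ℕ.+ e))      ≈⟨ coeff-∷-*-suc k p q (d ℕ.+ e) ⟩
    k * coeff q (suc (d ℕ.+ e)) + coeff (p *ₚ q) (d ℕ.+ e)
      ≈⟨ +-cong (trans (*-congˡ (q-high (suc (d ℕ.+ e)) (s≤s (ℕ.m≤n+m e d)))) (zeroʳ k))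
                (leading-* d e p q (λ j d<j → p-high (suc j) (s≤s d<j)) q-high) ⟩
    0# + coeff p d * coeff q e                ≈⟨ +-identityˡ _ ⟩
    coeff p d * coeff q e                     ∎

module ℤDegree = PolynomialDegree ℤ.+-*-commutativeRing
module ℚDegree = PolynomialDegree ℚ.+-*-commutativeRing

highZero-xⁿ-aᵘ : ∀ n u a → 1 ℕ.≤ n → ℤDegree.HighZero n (xⁿ-aᵘ n u a)
highZero-xⁿ-aᵘ n u a 1≤n i n<i = ≡.trans (ℤDegree.coeff-+ (X ^ₚ n) (-ₚ const (a ℤ.^ u)) i)
  (cong₂ ℤ._+_ (highZero-X^ n i n<i) (highZero-const i (ℕ.≤-<-trans 1≤n n<i)))
  where
  open Polynomial ℤ.+-*-rawRing
  open RawSemiringDefs (RawRing.rawSemiring ℤ[x]) using () renaming (_^_ to _^ₚ_)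
  highZero-X^ : ∀ k → ℤDegree.HighZero k (X ^ₚ k)
  highZero-X^ zero    (suc i) _ = ≡.refl
  highZero-X^ (suc k) = ℤDegree.highZero-* 1 k X (X ^ₚ k) (λ { (suc (suc i)) _ → ≡.refl ; (suc zero) (s≤s ()) }) (highZero-X^ k)
  highZero-const : ∀ i → 1 ℕ.< i → coeff (-ₚ const (a ℤ.^ u)) i ≡ 0ℤ
  highZero-const (suc i) _ = ≡.refl

coeff-ℤ[x]→ℚ[x] : ∀ p i → Polynomial.coeff ℚ.+-*-rawRing (ℤ[x]→ℚ[x] p) i ≡ fromℤ (Polynomial.coeff ℤ.+-*-rawRing p i)
coeff-ℤ[x]→ℚ[x] []      i       = ≡.refl
coeff-ℤ[x]→ℚ[x] (k ∷ p) zero    = ≡.refl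
coeff-ℤ[x]→ℚ[x] (k ∷ p) (suc i) = coeff-ℤ[x]→ℚ[x] p i

degree? : ∀ f → let open Polynomial ℚ.+-*-rawRing in
  (∀ i → coeff f i ≡ 0ℚ) ⊎ (∃[ d ] coeff f d ≢ 0ℚ × ℚDegree.HighZero d f)
degree? []      = inj₁ λ i → ≡.refl
degree? (k ∷ f) with degree? f
... | inj₂ (d , fd≢0 , high) = inj₂ (suc d , fd≢0 , λ { (suc i) (s≤s d<i) → high i d<i })
... | inj₁ f≡0 with k ℚ.≟ 0ℚ
...   | yes k≡0 = inj₁ λ { zero → k≡0 ; (suc i) → f≡0 i }
...   | no  k≢0 = inj₂ (0 , k≢0 , λ { (suc i) _ → f≡0 i })

-- A model of ℚ[x]/(xⁿ - a): polynomials in the shift operator acting on the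
-- sequences with s (n + i) = a s i.  All ring laws hold because the operators commute.
module ShiftModel (m : ℕ) (a : ℤ) where
  open Polynomial ℚ.+-*-rawRing
  open Data.Rational.Solver.+-*-Solver using () renaming (solve to solveℚ; _:=_ to _⊜_; _:+_ to _⊕_; _:*_ to _⊗_; :-_ to ⊝_; con to conℚ)

  act : Poly → (ℕ → ℚ) → ℕ → ℚ
  act []      s i = 0ℚ
  act (k ∷ p) s i = k ℚ.* s i ℚ.+ act p s (suc i)

  Recurrent : (ℕ → ℚ) → Set
  Recurrent s = ∀ i → s (suc m ℕ.+ i) ≡ fromℤ a ℚ.* s i

  infix 4 _∼_
  -- Congruence modulo xⁿ - a, seen through the action, so that no division with remainder enters.
  -- Being a record, it lets unification recover p and q.
  record _∼_ (p q : Poly) : Set where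
    constructor agree
    field on : ∀ s → Recurrent s → ∀ i → act p s i ≡ act q s i
  open _∼_

  act-cong : ∀ p {s t} → (∀ i → s i ≡ t i) → ∀ i → act p s i ≡ act p t i
  act-cong []      s≡t i = ≡.refl
  act-cong (k ∷ p) s≡t i = cong₂ (λ x y → k ℚ.* x ℚ.+ y) (s≡t i) (act-cong p s≡t (suc i))

  act-shift : ∀ p s i → act p (λ j → s (suc j)) i ≡ act p s (suc i)
  act-shift []      s i = ≡.refl
  act-shift (k ∷ p) s i = cong (ℚ._+_ (k ℚ.* s (suc i))) (act-shift p s (suc i))

  act-linear : ∀ p k s t i → act p (λ j → k ℚ.* s j ℚ.+ t j) i ≡ k ℚ.* act p s i ℚ.+ act p t i
  act-linear []      k s t i = solveℚ 1 (λ k → conℚ 0ℚ ⊜ k ⊗ conℚ 0ℚ ⊕ conℚ 0ℚ) ≡.refl k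
  act-linear (j ∷ p) k s t i = ≡.trans (cong (ℚ._+_ (j ℚ.* (k ℚ.* s i ℚ.+ t i))) (act-linear p k s t (suc i)))
    (solveℚ 6 (λ j k s t x y → j ⊗ (k ⊗ s ⊕ t) ⊕ (k ⊗ x ⊕ y) ⊜ k ⊗ (j ⊗ s ⊕ x) ⊕ (j ⊗ t ⊕ y)) ≡.refl
      j k (s i) (t i) (act p s (suc i)) (act p t (suc i)))

  act-+ : ∀ p q s i → act (p +ₚ q) s i ≡ act p s i ℚ.+ act q s i
  act-+ []      q       s i = ≡.sym (ℚ.+-identityˡ _)
  act-+ (j ∷ p) []      s i = ≡.sym (ℚ.+-identityʳ _)
  act-+ (j ∷ p) (k ∷ q) s i = ≡.trans (cong (ℚ._+_ ((j ℚ.+ k) ℚ.* s i)) (act-+ p q s (suc i)))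
    (solveℚ 5 (λ j k s x y → (j ⊕ k) ⊗ s ⊕ (x ⊕ y) ⊜ (j ⊗ s ⊕ x) ⊕ (k ⊗ s ⊕ y)) ≡.refl j k (s i) (act p s (suc i)) (act q s (suc i)))

  act-scale : ∀ k p s i → act (List.map (k ℚ.*_) p) s i ≡ k ℚ.* act p s i
  act-scale k []      s i = ≡.sym (ℚ.*-zeroʳ k)
  act-scale k (j ∷ p) s i = ≡.trans (cong (ℚ._+_ (k ℚ.* j ℚ.* s i)) (act-scale k p s (suc i)))
    (solveℚ 4 (λ k j s x → k ⊗ j ⊗ s ⊕ k ⊗ x ⊜ k ⊗ (j ⊗ s ⊕ x)) ≡.refl k j (s i) (act p s (suc i)))

  act-neg : ∀ p s i → act (-ₚ p) s i ≡ ℚ.- act p s i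
  act-neg []      s i = ≡.refl
  act-neg (k ∷ p) s i = ≡.trans (cong (ℚ._+_ ((ℚ.- k) ℚ.* s i)) (act-neg p s (suc i)))
    (solveℚ 3 (λ k s x → (⊝ k) ⊗ s ⊕ (⊝ x) ⊜ ⊝ (k ⊗ s ⊕ x)) ≡.refl k (s i) (act p s (suc i)))

  act-const : ∀ k s i → act (const k) s i ≡ k ℚ.* s i
  act-const k s i = ℚ.+-identityʳ _

  act-0∷ : ∀ p s i → act (0ℚ ∷ p) s i ≡ act p s (suc i)
  act-0∷ p s i = solveℚ 2 (λ s x → conℚ 0ℚ ⊗ s ⊕ x ⊜ x) ≡.refl (s i) (act p s (suc i))

  act-* : ∀ p q s i → act (p *ₚ q) s i ≡ act p (act q s) i
  act-* []      q s i = ≡.refl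
  act-* (k ∷ p) q s i = ≡.trans (act-+ (List.map (k ℚ.*_) q) _ s i)
    (cong₂ ℚ._+_ (act-scale k q s i) (≡.trans (act-0∷ (p *ₚ q) s i) (act-* p q s (suc i))))

  act-comm : ∀ p q s i → act p (act q s) i ≡ act q (act p s) i
  act-comm []      q s i = ≡.sym (act-zero q i)
    where
    act-zero : ∀ q i → act q (λ _ → 0ℚ) i ≡ 0ℚ
    act-zero []      i = ≡.refl
    act-zero (k ∷ q) i = ≡.trans (cong₂ ℚ._+_ (ℚ.*-zeroʳ k) (act-zero q (suc i))) (ℚ.+-identityˡ 0ℚ)
  act-comm (k ∷ p) q s i = ≡.trans
    (cong (ℚ._+_ (k ℚ.* act q s i)) (≡.trans (act-comm p q s (suc i)) (≡.sym (act-shift q (act p s) i))))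
    (≡.sym (act-linear q k s (λ j → act p s (suc j)) i))

  -- This makes multiplication respect `_∼_`: in the action of p q on s, the polynomial p acts on
  -- the sequence q s, which has to be recurrent again.
  recurrent-act : ∀ p {s} → Recurrent s → Recurrent (act p s)
  recurrent-act []      rec i = ≡.sym (ℚ.*-zeroʳ (fromℤ a))
  recurrent-act (k ∷ p) {s} rec i = ≡.trans
    (cong₂ (λ x y → k ℚ.* x ℚ.+ y) (rec i)
      (≡.trans (cong (act p s) (≡.sym (ℕ.+-suc (suc m) i))) (recurrent-act p rec (suc i))))
    (solveℚ 4 (λ k a s x → k ⊗ (a ⊗ s) ⊕ a ⊗ x ⊜ a ⊗ (k ⊗ s ⊕ x)) ≡.refl k (fromℤ a) (s i) (act p s (suc i)))

  ∼-pointwise : ∀ {p q} → (∀ s i → act p s i ≡ act q s i) → p ∼ q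
  ∼-pointwise eq = agree λ s _ i → eq s i

  commutativeRing : CommutativeRing 0ℓ 0ℓ
  commutativeRing = record
    { Carrier = Poly ; _≈_ = _∼_ ; _+_ = _+ₚ_ ; _*_ = _*ₚ_ ; -_ = -ₚ_ ; 0# = [] ; 1# = const 1ℚ
    ; isCommutativeRing = record
      { isRing = record
        { +-isAbelianGroup = record
          { isGroup = record
            { isMonoid = record
              { isSemigroup = record
                { isMagma = record
                  { isEquivalence = record
                    { refl  = agree λ _ _ _ → ≡.refl
                    ; sym   = λ p∼q → agree λ s rec i → ≡.sym (on p∼q s rec i)
                    ; trans = λ p∼q q∼r → agree λ s rec i → ≡.trans (on p∼q s rec i) (on q∼r s rec i)
                    }
                  ; ∙-cong = λ {p} {p′} {q} {q′} p∼p′ q∼q′ → agree λ s rec i → ≡.trans (act-+ p q s i)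
                      (≡.trans (cong₂ ℚ._+_ (on p∼p′ s rec i) (on q∼q′ s rec i)) (≡.sym (act-+ p′ q′ s i)))
                  }
                ; assoc = λ p q r → ∼-pointwise λ s i → ≡.trans (≡.trans (act-+ (p +ₚ q) r s i) (cong (ℚ._+ act r s i) (act-+ p q s i)))
                    (≡.trans (ℚ.+-assoc (act p s i) (act q s i) (act r s i))
                      (≡.sym (≡.trans (act-+ p (q +ₚ r) s i) (cong (ℚ._+_ (act p s i)) (act-+ q r s i)))))
                }
              ; identity = (λ p → ∼-pointwise λ s i → ≡.refl) , (λ p → ∼-pointwise λ s i → ≡.trans (act-+ p [] s i) (ℚ.+-identityʳ _))
              }
            ; inverse = (λ p → ∼-pointwise λ s i → ≡.trans (act-+ (-ₚ p) p s i) (≡.trans (cong (ℚ._+ act p s i) (act-neg p s i))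
                          (ℚ.+-inverseˡ (act p s i))))
                      , (λ p → ∼-pointwise λ s i → ≡.trans (act-+ p (-ₚ p) s i) (≡.trans (cong (ℚ._+_ (act p s i)) (act-neg p s i))
                          (ℚ.+-inverseʳ (act p s i))))
            ; ⁻¹-cong = λ {p} {q} p∼q → agree λ s rec i → ≡.trans (act-neg p s i) (≡.trans (cong ℚ.-_ (on p∼q s rec i)) (≡.sym (act-neg q s i)))
            }
          ; comm = λ p q → ∼-pointwise λ s i → ≡.trans (act-+ p q s i) (≡.trans (ℚ.+-comm (act p s i) (act q s i)) (≡.sym (act-+ q p s i)))
          }
        ; *-cong = λ {p} {p′} {q} {q′} p∼p′ q∼q′ → agree λ s rec i → ≡.trans (act-* p q s i)
            (≡.trans (on p∼p′ (act q s) (recurrent-act q rec) i) (≡.trans (act-cong p′ (on q∼q′ s rec) i) (≡.sym (act-* p′ q′ s i))))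
        ; *-assoc = λ p q r → ∼-pointwise λ s i → ≡.trans (≡.trans (act-* (p *ₚ q) r s i) (act-* p q (act r s) i))
            (≡.sym (≡.trans (act-* p (q *ₚ r) s i) (act-cong p (act-* q r s) i)))
        ; *-identity = (λ p → ∼-pointwise λ s i → ≡.trans (act-* (const 1ℚ) p s i) (act-1 (act p s) i))
                     , (λ p → ∼-pointwise λ s i → ≡.trans (act-* p (const 1ℚ) s i) (act-cong p (act-1 s) i))
        ; distrib = (λ p q r → ∼-pointwise λ s i → ≡.trans (act-* p (q +ₚ r) s i) (≡.trans
              (≡.trans (act-cong p (λ j → ≡.trans (act-+ q r s j) (cong (ℚ._+ act r s j) (≡.sym (ℚ.*-identityˡ (act q s j))))) i)
                (≡.trans (act-linear p 1ℚ (act q s) (act r s) i) (cong (ℚ._+ act p (act r s) i) (ℚ.*-identityˡ (act p (act q s) i)))))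
              (≡.sym (≡.trans (act-+ (p *ₚ q) (p *ₚ r) s i) (cong₂ ℚ._+_ (act-* p q s i) (act-* p r s i))))))
            , (λ p q r → ∼-pointwise λ s i → ≡.trans (≡.trans (act-* (q +ₚ r) p s i) (act-+ q r (act p s) i))
              (≡.sym (≡.trans (act-+ (q *ₚ p) (r *ₚ p) s i) (cong₂ ℚ._+_ (act-* q p s i) (act-* r p s i)))))
        }
      ; *-comm = λ p q → ∼-pointwise λ s i → ≡.trans (act-* p q s i) (≡.trans (act-comm p q s i) (≡.sym (act-* q p s i)))
      }
    }
    where
    act-1 : ∀ s i → act (const 1ℚ) s i ≡ s i
    act-1 s i = ≡.trans (act-const 1ℚ s i) (ℚ.*-identityˡ (s i))

  -- A recurrent sequence that starts with a⁰ = 1. The constants 1 and 0 act differently on it, so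
  -- the model is nontrivial.
  powers : ℕ → ℚ
  powers i = fromℤ (a ℤ.^ (i ℕ./ suc m))

  powers-recurrent : Recurrent powers
  powers-recurrent i = ≡.trans
    (cong (λ k → fromℤ (a ℤ.^ k)) (≡.trans (ℕ.+-distrib-/-∣ˡ i ℕ.∣-refl) (cong (ℕ._+ i ℕ./ suc m) (ℕ.n/n≡1 (suc m)))))
    (fromℤ-* a _)

  algebra : ℚAlgebra 0ℓ 0ℓ
  algebra = record
    { commutativeRing = commutativeRing
    ; ι = const
    ; ι-homo = record
      { isSemiringHomomorphism = record
        { isNearSemiringHomomorphism = record
          { +-isMonoidHomomorphism = record
            { isMagmaHomomorphism = record
              { isRelHomomorphism = record { cong = λ { ≡.refl → ∼-pointwise λ _ _ → ≡.refl } }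
              ; homo = λ _ _ → ∼-pointwise λ _ _ → ≡.refl }
            ; ε-homo = ∼-pointwise λ s i → ≡.trans (act-const 0ℚ s i) (ℚ.*-zeroˡ (s i)) }
          ; *-homo = λ j k → ∼-pointwise λ s i → cong (λ x → act (const x) s i) (≡.sym (ℚ.+-identityʳ (j ℚ.* k))) }
        ; 1#-homo = ∼-pointwise λ _ _ → ≡.refl }
      ; -‿homo = λ _ → ∼-pointwise λ _ _ → ≡.refl }
    ; nontrivial = λ 1∼0 → contradiction (on 1∼0 powers powers-recurrent 0) λ ()
    }

  open ℚAlgebraProperties algebra using (_^_; _≈_; ιℤ)

  act-X^ : ∀ k s i → act (X ^ k) s i ≡ s (k ℕ.+ i)
  act-X^ zero    s i = ≡.trans (act-const 1ℚ s i) (ℚ.*-identityˡ (s i))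
  act-X^ (suc k) s i = ≡.trans (act-* X (X ^ k) s i) (≡.trans (act-0∷ (const 1ℚ) (act (X ^ k) s) i)
    (≡.trans (act-const 1ℚ (act (X ^ k) s) (suc i)) (≡.trans (ℚ.*-identityˡ _) (≡.trans (act-X^ k s (suc i)) (cong s (ℕ.+-suc k i))))))

  Xⁿ≈a : X ^ suc m ≈ ιℤ a
  Xⁿ≈a = agree λ s rec i → ≡.trans (act-X^ (suc m) s i) (≡.trans (rec i) (≡.sym (act-const (fromℤ a) s i)))

-- Irreducibility of xⁿ - aᵘ

module Irreducibility {c ℓ} (A : ℚAlgebra c ℓ) {m u : ℕ} {θ : ℚAlgebra.Carrier A} {a : ℤ}
                      (squarefree : SquareFree a) (2≤n : 2 ℕ.≤ suc m)
                      (radical : ∀ p → Prime p → p ℕ.∣ suc m → + p ∣ₛ a)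
                      (θⁿ≈a : RootOf A (suc m) a θ) (gcd≡1 : ℕ.gcd u (suc m) ≡ 1) where
  open ℚAlgebraProperties A
  open Polynomial ℚ.+-*-rawRing
  open PureExtension A {m} (squarefree⇒≢0 squarefree) θⁿ≈a
  open Fractions A {m} (squarefree⇒≢0 squarefree) θⁿ≈a
  open RadicalExtension A {m} squarefree 2≤n radical θⁿ≈a
  open Evaluation A ≡.sym ι-homo
  module ℤEval = IntegerPolynomials A

  F : Poly
  F = ℤ[x]→ℚ[x] (xⁿ-aᵘ (suc m) u a)

  F-high : ℚDegree.HighZero (suc m) F
  F-high i n<i = ≡.trans (coeff-ℤ[x]→ℚ[x] (xⁿ-aᵘ (suc m) u a) i) (cong fromℤ (highZero-xⁿ-aᵘ (suc m) u a (s≤s z≤n) i n<i))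

  eval-ℤ[x]→ℚ[x] : ∀ p x → eval (ℤ[x]→ℚ[x] p) x ≈ ℤEval.eval p x
  eval-ℤ[x]→ℚ[x] []      x = refl
  eval-ℤ[x]→ℚ[x] (k ∷ p) x = +-congˡ (*-congˡ (eval-ℤ[x]→ℚ[x] p x))

  eval-F : ∀ x → eval F x ≈ x ^ suc m - ιℤ (a ℤ.^ u)
  eval-F x = trans (eval-ℤ[x]→ℚ[x] (xⁿ-aᵘ (suc m) u a) x) (ℤEval.eval-xⁿ-aᵘ (suc m) u a x)

  α : Carrier
  α = θ ^ u

  F[α]≈0 : eval F α ≈ 0#
  F[α]≈0 = trans (eval-F α) (x≈y⇒x-y≈0 (trans (^-assocʳ θ u (suc m)) (trans (reflexive (cong (θ ^_) (ℕ.*-comm u (suc m)))) (θ^nk≈a^k u))))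

  -- The value is -aᵘ. Evaluation at 0 is what excludes a zero factor in a factorisation of F.
  F[0]≉0 : ¬ (eval F 0# ≈ 0#)
  F[0]≉0 F[0]≈0 = ^-≢0 (squarefree⇒≢0 squarefree) u (ιℤ-injective (begin
    ιℤ (a ℤ.^ u)                        ≈⟨ -‿involutive _ ⟨
    - (- ιℤ (a ℤ.^ u))                  ≈⟨ -‿cong (trans (+-congʳ (zeroˡ (0# ^ m))) (+-identityˡ (- ιℤ (a ℤ.^ u)))) ⟨
    - (0# ^ suc m - ιℤ (a ℤ.^ u))       ≈⟨ -‿cong (trans (sym (eval-F 0#)) F[0]≈0) ⟩
    - 0#                                ≈⟨ -0#≈0# ⟩
    0#                                  ∎))

  fractional-eval : ∀ f → Fractional (eval f α)
  fractional-eval []      = R⇒fractional span-0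
  fractional-eval (k ∷ f) = fractional-+ (fractional-ι k) (fractional-* (R⇒fractional (R-^ R-θ u)) (fractional-eval f))

  root⇒degree≥n : ∀ f d → coeff f d ≢ 0ℚ → ℚDegree.HighZero d f → eval f α ≈ 0# → suc m ℕ.≤ d
  root⇒degree≥n f d fd≢0 high f[α]≈0 = ℕ.≮⇒≥ λ d<n → fd≢0 (leading≡0 d<n)
    where
    den = common-denominator {suc m} (λ i → coeff f (toℕ i))
    D = proj₁ den
    D≢0 = proj₁ (proj₂ den)
    z = proj₁ (proj₂ (proj₂ den))
    z≡ = proj₂ (proj₂ (proj₂ den))
    inv = gcd≡1⇒inverse u (suc m) 2≤n gcd≡1
    -- The product 0 · 0 presents the value zero as q s with q = 0, so that `divisible-powers`
    -- yields 0 ∣ zᵢ aᵏ, and hence zᵢ = 0.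
    sum≈0 : d ℕ.< suc m → sum {suc m} (λ i → ιℤ (z i) * θ ^ (u ℕ.* toℕ i)) ≈ ιℤ 0ℤ * 0#
    sum≈0 d<n = begin
      sum {suc m} (λ i → ιℤ (z i) * θ ^ (u ℕ.* toℕ i))
        ≈⟨ sum-cong-≋ (λ i → trans (*-cong (trans (ι-cong (z≡ i)) (ι-* (fromℤ D) (coeff f (toℕ i))))
             (sym (^-assocʳ θ u (toℕ i)))) (*-assoc (ιℤ D) (ι (coeff f (toℕ i))) (α ^ toℕ i))) ⟩
      sum {suc m} (λ i → ιℤ D * (ι (coeff f (toℕ i)) * α ^ toℕ i))
        ≈⟨ *-distribˡ-sum {suc m} (ιℤ D) (λ i → ι (coeff f (toℕ i)) * α ^ toℕ i) ⟨
      ιℤ D * sum {suc m} (λ i → ι (coeff f (toℕ i)) * α ^ toℕ i)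
        ≈⟨ *-congˡ (trans (sym (eval-sum (suc m) f α (λ i n≤i → high i (ℕ.≤-trans d<n n≤i)))) f[α]≈0) ⟩
      ιℤ D * 0#      ≈⟨ zeroʳ (ιℤ D) ⟩
      0#             ≈⟨ zeroʳ (ιℤ 0ℤ) ⟨
      ιℤ 0ℤ * 0#     ∎
    zᵢ≡0 : d ℕ.< suc m → ∀ i → z i ≡ 0ℤ
    zᵢ≡0 d<n i = [ (λ zᵢ≡0 → zᵢ≡0) , (λ aᵏ≡0 → contradiction aᵏ≡0 (^-≢0 (squarefree⇒≢0 squarefree) ((u ℕ.* toℕ i) ℕ./ suc m))) ]′
      (ℤ.i*j≡0⇒i≡0∨j≡0 (z i) (ℤᵈ.0∣⇒≡0 (divisible-powers 0ℤ u (proj₁ inv) (proj₁ (proj₂ inv)) (proj₂ (proj₂ inv)) z span-0 (sum≈0 d<n) i)))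
    leading≡0 : d ℕ.< suc m → coeff f d ≡ 0ℚ
    leading≡0 d<n = decidable-stable (coeff f d ℚ.≟ 0ℚ) λ fd≢0 → nonzero D≢0 fd≢0
      (≡.trans (≡.sym (≡.trans (z≡ (Fin.fromℕ< d<n)) (cong (λ i → fromℤ D ℚ.* coeff f i) (Fin.toℕ-fromℕ< d<n))))
        (cong fromℤ (zᵢ≡0 d<n (Fin.fromℕ< d<n))))
      where
      nonzero : ∀ {D q} → D ≢ 0ℤ → q ≢ 0ℚ → ¬ (fromℤ D ℚ.* q ≡ 0ℚ)
      nonzero D≢0 q≢0 Dq≡0 = q≢0 (ι-injective (ιℤ-cancel D≢0 (trans (sym (ι-* _ _)) (trans (ι-cong Dq≡0) ι-0))))

  constant-unit : ∀ g → coeff g 0 ≢ 0ℚ → ℚDegree.HighZero 0 g → ∃[ q ] (q *ₚ g) ≈ₚ const 1ℚ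
  constant-unit g g₀≢0 high = let k , kg₀≡1 = ι-inverse g₀≢0 in const k , λ where
      zero    → ≡.trans (coeff-k g k 0) (≡.trans (ℚ.+-identityʳ _) kg₀≡1)
      (suc i) → ≡.trans (coeff-k g k (suc i)) (≡.trans (ℚ.+-identityʳ _) (≡.trans (cong (k ℚ.*_) (high (suc i) (s≤s z≤n))) (ℚ.*-zeroʳ k)))
    where
    coeff-0 : ∀ i → coeff (0ℚ ∷ []) i ≡ 0ℚ
    coeff-0 zero    = ≡.refl
    coeff-0 (suc i) = ≡.refl
    coeff-k : ∀ g k i → coeff (const k *ₚ g) i ≡ k ℚ.* coeff g i ℚ.+ 0ℚ
    coeff-k g k i = ≡.trans (ℚDegree.coeff-+ (List.map (k ℚ.*_) g) (0ℚ ∷ []) i) (cong₂ ℚ._+_ (ℚDegree.coeff-scale k g i) (coeff-0 i))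

  -- The product of the leading coefficients is nonzero in ℚ and stands at position d + e of F,
  -- where F vanishes if d + e > n.
  factor-degree : ∀ f g → F ≈ₚ f *ₚ g → ∃[ d ] coeff f d ≢ 0ℚ × ℚDegree.HighZero d f ×
    (∃[ e ] coeff g e ≢ 0ℚ × ℚDegree.HighZero e g × d ℕ.+ e ℕ.≤ suc m)
  factor-degree f g F≈fg with degree? f | degree? g
  ... | inj₁ f≡0 | _ = contradiction (trans (eval-cong F (f *ₚ g) 0# F≈fg) (trans (eval-* f g 0#)
          (trans (*-congʳ (eval-zero f 0# f≡0)) (zeroˡ (eval g 0#))))) F[0]≉0
  ... | inj₂ _ | inj₁ g≡0 = contradiction (trans (eval-cong F (f *ₚ g) 0# F≈fg) (trans (eval-* f g 0#)
          (trans (*-congˡ (eval-zero g 0# g≡0)) (zeroʳ (eval f 0#))))) F[0]≉0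
  ... | inj₂ (d , fd≢0 , f-high) | inj₂ (e , ge≢0 , g-high) = d , fd≢0 , f-high , e , ge≢0 , g-high ,
    ℕ.≮⇒≥ λ n<d+e → fdge≢0 (≡.trans (≡.sym (ℚDegree.leading-* d e f g f-high g-high))
      (≡.trans (≡.sym (F≈fg (d ℕ.+ e))) (F-high (d ℕ.+ e) n<d+e)))
    where
    fdge≢0 : coeff f d ℚ.* coeff g e ≢ 0ℚ
    fdge≢0 eq = let k , kf≡1 = ι-inverse fd≢0 in ge≢0 (≡.trans (≡.sym (ℚ.*-identityˡ (coeff g e)))
      (≡.trans (cong (ℚ._* coeff g e) (≡.sym kf≡1)) (≡.trans (ℚ.*-assoc k (coeff f d) (coeff g e)) (≡.trans (cong (k ℚ.*_) eq) (ℚ.*-zeroʳ k)))))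

  irreducible : Irreducibleℚ F
  irreducible = record { p∤1 = F∤1 ; split-∣1 = λ {f} {g} → split f g }
    where
    open RawSemiringDefs (RawRing.rawSemiring ℚ[x]) using () renaming (_∣_ to _∣ₚ_; _∤_ to _∤ₚ_)
    F∤1 : F ∤ₚ const 1ℚ
    F∤1 record { quotient = q ; equality = qF≈1 } = nontrivial (begin
      1#                     ≈⟨ trans (eval-const 1ℚ α) ι-1 ⟨
      eval (const 1ℚ) α      ≈⟨ eval-cong (q *ₚ F) (const 1ℚ) α qF≈1 ⟨
      eval (q *ₚ F) α        ≈⟨ eval-* q F α ⟩
      eval q α * eval F α    ≈⟨ trans (*-congˡ F[α]≈0) (zeroʳ (eval q α)) ⟩
      0#                     ∎)
    unit : ∀ g e → coeff g e ≢ 0ℚ → ℚDegree.HighZero e g → e ≡ 0 → g ∣ₚ const 1ℚ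
    unit g zero ge≢0 g-high ≡.refl = let q , qg≈1 = constant-unit g ge≢0 g-high in record { quotient = q ; equality = qg≈1 }
    split : ∀ f g → F ≈ₚ f *ₚ g → f ∣ₚ const 1ℚ ⊎ g ∣ₚ const 1ℚ
    split f g F≈fg = let d , fd≢0 , f-high , e , ge≢0 , g-high , d+e≤n = factor-degree f g F≈fg in
      -- The factor that vanishes at α uses up the whole degree n, so the other one is a nonzero
      -- constant.
      [ (λ f[α]≈0 → inj₂ (unit g e ge≢0 g-high (ℕ.n≤0⇒n≡0 (ℕ.+-cancelˡ-≤ (suc m) e 0
          (ℕ.≤-trans (ℕ.+-monoˡ-≤ e (root⇒degree≥n f d fd≢0 f-high f[α]≈0)) (ℕ.≤-trans d+e≤n (ℕ.≤-reflexive (≡.sym (ℕ.+-identityʳ (suc m))))))))))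
      , (λ g[α]≈0 → inj₁ (unit f d fd≢0 f-high (ℕ.n≤0⇒n≡0 (ℕ.+-cancelʳ-≤ (suc m) d 0
          (ℕ.≤-trans (ℕ.+-monoʳ-≤ d (root⇒degree≥n g e ge≢0 g-high g[α]≈0)) d+e≤n))))) ]′
      (fractional-domain (fractional-eval f) (fractional-eval g)
        (trans (sym (eval-* f g α)) (trans (sym (eval-cong F (f *ₚ g) α F≈fg)) F[α]≈0)))

-- The ring of integers

module NumberField {c ℓ₁ ℓ₂} (K : FieldExtension c ℓ₁ ℓ₂) where
  private module K = FieldExtension K

  algebra : ℚAlgebra c ℓ₁
  algebra = record
    { commutativeRing = K.commutativeRing
    ; ι = K.ι
    ; ι-homo = K.ι-homo
    -- 1 - 0 is invertible, so 1 and 0 are apart, and apartness is irreflexive.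
    ; nontrivial = λ 1≈0 → K.#-irrefl 1≈0 (K.invertible⇒# (K.1# , 1-0-invertible , K.trans (K.*-comm _ _) 1-0-invertible))
    }
    where
    1-0-invertible : K.1# K.* (K.1# K.- K.0#) K.≈ K.1#
    1-0-invertible = K.trans (K.*-identityˡ _) (K.trans (K.+-congˡ (RingProperties.-0#≈0# (CommutativeRing.ring K.commutativeRing))) (K.+-identityʳ K.1#))

  open ℚAlgebraProperties algebra
  open IntegerPolynomials algebra

  ⟨⟩≈eval : ∀ p x → p K.⟨ x ⟩ ≈ eval p x
  ⟨⟩≈eval []      x = refl
  ⟨⟩≈eval (k ∷ p) x = +-congˡ (*-congˡ (⟨⟩≈eval p x))

  𝒪⇒integral : ∀ {x} → K.𝒪 x → Integral x
  𝒪⇒integral (p , monic , p≈0) = monic-root⇒integral p monic (trans (sym (⟨⟩≈eval p _)) p≈0)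

  integral⇒𝒪 : ∀ {x} → Integral x → K.𝒪 x
  integral⇒𝒪 int = let p , monic , p≈0 = integral⇒monic-root int in p , monic , trans (⟨⟩≈eval p _) p≈0

  ev-tabulate : ∀ {d} (k : Fin d → ℤ) x → ev (tabulate k) x ≈ sum (λ i → ιℤ (k i) * x ^ toℕ i)
  ev-tabulate {d} k x = trans (ev-sum (tabulate k) x) (sum-cong-≋ {d} (λ i → *-congʳ {x ^ toℕ i} (ιℤ-cong (Vec.lookup∘tabulate k i))))

  module RadicalGenerator {m u : ℕ} {a : ℤ} (squarefree : SquareFree a) (3≤n : 3 ℕ.≤ suc m)
                          (radical : ∀ p → Prime p → p ℕ.∣ suc m → + p ∣ₛ a) (gcd≡1 : ℕ.gcd u (suc m) ≡ 1)
                          (α : Carrier) (αⁿ≈aᵘ : α ^ suc m ≈ ιℤ (a ℤ.^ u)) where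

    private
      n = suc m
      2≤n = ℕ.<⇒≤ 3≤n
      a≢0 : a ≢ 0ℤ
      a≢0 = squarefree⇒≢0 squarefree
      bézout = gcd≡1⇒inverse u n 2≤n gcd≡1
      r = proj₁ bézout
      s = proj₁ (proj₂ bézout)
      ur≡1+sn = proj₂ (proj₂ bézout)
      a⁻ˢ = ι-inverse {fromℤ (a ℤ.^ s)} (λ aˢ≡0 → ^-≢0 a≢0 s (fromℤ-injective aˢ≡0))
      q = proj₁ a⁻ˢ

    -- θ = αʳ / aˢ, where u r = 1 + s n.
    θ : Carrier
    θ = ι q * α ^ r

    private
      unit : ∀ k → ι q ^ k * ιℤ (a ℤ.^ s) ^ k ≈ 1#
      unit k = trans (sym (^-distrib-* _ _ k)) (trans (^-congˡ k (trans (sym (ι-* q _)) (trans (ι-cong (proj₂ a⁻ˢ)) ι-1))) (1^ k))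

      α^n* : ∀ k → α ^ (n ℕ.* k) ≈ ιℤ (a ℤ.^ k) ^ u
      α^n* k = begin
        α ^ (n ℕ.* k)                ≈⟨ ^-assocʳ α n k ⟨
        (α ^ n) ^ k                  ≈⟨ ^-congˡ k αⁿ≈aᵘ ⟩
        ιℤ (a ℤ.^ u) ^ k             ≈⟨ ιℤ-^ (a ℤ.^ u) k ⟨
        ιℤ ((a ℤ.^ u) ℤ.^ k)         ≡⟨ cong ιℤ (≡.trans (ℤ.^-*-assoc a u k) (≡.trans (cong (a ℤ.^_) (ℕ.*-comm u k)) (≡.sym (ℤ.^-*-assoc a k u)))) ⟩
        ιℤ ((a ℤ.^ k) ℤ.^ u)         ≈⟨ ιℤ-^ (a ℤ.^ k) u ⟩
        ιℤ (a ℤ.^ k) ^ u             ∎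

    -- αʳⁿ = aᵘʳ = a · aˢⁿ, and the denominator (aˢ)ⁿ cancels the second factor.
    θⁿ≈a : θ ^ n ≈ ιℤ a
    θⁿ≈a = begin
      θ ^ n                                      ≈⟨ ^-distrib-* (ι q) (α ^ r) n ⟩
      ι q ^ n * (α ^ r) ^ n
        ≈⟨ *-congˡ (trans (^-assocʳ α r n) (reflexive (cong (α ^_) (ℕ.*-comm r n)))) ⟩
      ι q ^ n * α ^ (n ℕ.* r)
        ≈⟨ *-congˡ (trans (sym (^-assocʳ α n r)) (trans (^-congˡ r αⁿ≈aᵘ) (sym (ιℤ-^ _ r)))) ⟩
      ι q ^ n * ιℤ ((a ℤ.^ u) ℤ.^ r)             ≡⟨ cong (λ z → ι q ^ n * ιℤ z) aᵘʳ≡ ⟩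
      ι q ^ n * ιℤ (a ℤ.* (a ℤ.^ s) ℤ.^ n)       ≈⟨ *-congˡ (trans (ιℤ-* a _) (*-congˡ (ιℤ-^ (a ℤ.^ s) n))) ⟩
      ι q ^ n * (ιℤ a * ιℤ (a ℤ.^ s) ^ n)        ≈⟨ solve 3 (λ q a b → q :* (a :* b) := q :* b :* a)
             refl (ι q ^ n) (ιℤ a) (ιℤ (a ℤ.^ s) ^ n) ⟩
      ι q ^ n * ιℤ (a ℤ.^ s) ^ n * ιℤ a          ≈⟨ trans (*-congʳ (unit n)) (*-identityˡ _) ⟩
      ιℤ a                                       ∎
      where
      aᵘʳ≡ : (a ℤ.^ u) ℤ.^ r ≡ a ℤ.* (a ℤ.^ s) ℤ.^ n
      aᵘʳ≡ = ≡.trans (ℤ.^-*-assoc a u r) (≡.trans (cong (a ℤ.^_) ur≡1+sn) (cong (a ℤ.*_) (≡.sym (ℤ.^-*-assoc a s n))))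

    -- αʳᵘ = α · (αⁿ)ˢ = α · aᵘˢ, and the denominator (aˢ)ᵘ cancels the second factor.
    θᵘ≈α : θ ^ u ≈ α
    θᵘ≈α = begin
      θ ^ u                                      ≈⟨ ^-distrib-* (ι q) (α ^ r) u ⟩
      ι q ^ u * (α ^ r) ^ u                      ≈⟨ *-congˡ (^-assocʳ α r u) ⟩
      ι q ^ u * α ^ (r ℕ.* u)                    ≡⟨ cong (λ k → ι q ^ u * α ^ k) (≡.trans (ℕ.*-comm r u) (≡.trans ur≡1+sn (cong suc (ℕ.*-comm s n)))) ⟩
      ι q ^ u * (α * α ^ (n ℕ.* s))              ≈⟨ *-congˡ (*-congˡ (α^n* s)) ⟩
      ι q ^ u * (α * ιℤ (a ℤ.^ s) ^ u)           ≈⟨ solve 3 (λ q a b → q :* (a :* b) := q :* b :* a)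
             refl (ι q ^ u) α (ιℤ (a ℤ.^ s) ^ u) ⟩
      ι q ^ u * ιℤ (a ℤ.^ s) ^ u * α             ≈⟨ trans (*-congʳ (unit u)) (*-identityˡ α) ⟩
      α                                          ∎

    open PureExtension algebra {m} {θ} {a} a≢0 θⁿ≈a
    open Fractions algebra {m} {θ} {a} a≢0 θⁿ≈a
    open RadicalExtension algebra {m} {θ} {a} squarefree 2≤n radical θⁿ≈a

    R⇒𝒪 : ∀ {x} → R x → K.𝒪 x
    R⇒𝒪 x∈R = integral⇒𝒪 (span-integral θ-closed x∈R)

    θ∈𝒪 : K.𝒪 θ
    θ∈𝒪 = R⇒𝒪 R-θ

    ℤ[]⇒R : ∀ {x y} → R y → K.ℤ[ y ] x → R x
    ℤ[]⇒R {x} {y} y∈R (p , x≈p) = span-resp (sym (trans x≈p (trans (⟨⟩≈eval p y) (eval≈ev p y)))) (R-ev y∈R (Vec.fromList p))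

    ℤ[α]≠𝒪 : 2 ℕ.≤ u → ¬ (K.ℤ[ α ] ≐ K.𝒪)
    ℤ[α]≠𝒪 2≤u (_ , 𝒪⊆ℤ[α]) = not-in-ℤ[α] (𝒪⊆ℤ[α] θ∈𝒪)
      where
      -- u ≥ 2 makes α = θᵘ a multiple of θ² in R, so a polynomial in α differs from its constant
      -- term by an element of θ²R.
      e = u ℕ.∸ 2
      α≈θ²θᵉ : α ≈ θ * (θ * θ ^ e)
      α≈θ²θᵉ = trans (sym θᵘ≈α) (reflexive (cong (θ ^_) (≡.sym (ℕ.m+[n∸m]≡n 2≤u))))
      R-α : R α
      R-α = span-resp θᵘ≈α (R-^ R-θ u)
      1≤m : 1 ℕ.≤ m
      1≤m = ℕ.s≤s⁻¹ 2≤n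
      not-in-ℤ[α] : ¬ K.ℤ[ α ] θ
      not-in-ℤ[α] ([]    , θ≈0) = θ∉ℤ+θ²R 1≤m {0ℤ} span-0 (trans θ≈0
        (sym (trans (+-cong ι-0 (trans (*-congˡ (zeroʳ θ)) (zeroʳ θ))) (+-identityˡ 0#))))
      not-in-ℤ[α] (k ∷ p , θ≈p) = θ∉ℤ+θ²R 1≤m {k} (R-* (R-^ R-θ e) (ℤ[]⇒R R-α (p , refl))) (begin
        θ                                               ≈⟨ θ≈p ⟩
        ιℤ k + α * (p K.⟨ α ⟩)                          ≈⟨ +-congˡ (*-congʳ α≈θ²θᵉ) ⟩
        ιℤ k + θ * (θ * θ ^ e) * (p K.⟨ α ⟩)
          ≈⟨ solve 4 (λ k t e p → k :+ t :* (t :* e) :* p := k :+ t :* (t :* (e :* p))) refl (ιℤ k) θ (θ ^ e) (p K.⟨ α ⟩) ⟩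
        ιℤ k + θ * (θ * (θ ^ e * (p K.⟨ α ⟩)))          ∎)

    module Generated (ℚ⟨α⟩≐U : K.ℚ⟨_⟩ α ≐ U) where

      -- Since α generates K, every element acquires an integer denominator over R; the removal of
      -- denominators that proves `𝒪⇒R` starts from it.
      fractional : ∀ y → Fractional y
      fractional y = go (proj₂ ℚ⟨α⟩≐U {y} tt)
        where
        go : ∀ {y} → K.ℚ⟨_⟩ α y → Fractional y
        go (K.rational q)      = fractional-ι q
        go K.generator         = fractional-resp θᵘ≈α (R⇒fractional (R-^ R-θ u))
        go (K.add x y)         = fractional-+ (go x) (go y)
        go (K.neg x)           = fractional-neg (go x)
        go (K.mul x y)         = fractional-* (go x) (go y)
        go (K.inv x xy≈1)      = fractional-inverse xy≈1 (go x)
        go (K.resp x≈y x)      = fractional-resp x≈y (go x)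

      ℚ⟨θ⟩≐U : K.ℚ⟨_⟩ θ ≐ U
      ℚ⟨θ⟩≐U = (λ _ → tt) , λ {y} _ → go (proj₂ ℚ⟨α⟩≐U {y} tt)
        where
        power : ∀ k → K.ℚ⟨_⟩ θ (θ ^ k)
        power zero    = K.resp ι-1 (K.rational 1ℚ)
        power (suc k) = K.mul K.generator (power k)
        go : ∀ {y} → K.ℚ⟨_⟩ α y → K.ℚ⟨_⟩ θ y
        go (K.rational q)      = K.rational q
        go K.generator         = K.resp θᵘ≈α (power u)
        go (K.add x y)         = K.add (go x) (go y)
        go (K.neg x)           = K.neg (go x)
        go (K.mul x y)         = K.mul (go x) (go y)
        go (K.inv x xy≈1)      = K.inv (go x) xy≈1
        go (K.resp x≈y x)      = K.resp x≈y (go x)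

      𝒪⇒R : ∀ {x} → K.𝒪 x → R x
      𝒪⇒R {x} x∈𝒪 = integral⇒R (fractional x) (𝒪⇒integral x∈𝒪)

      ℤ[θ]≐𝒪 : K.ℤ[ θ ] ≐ K.𝒪
      ℤ[θ]≐𝒪 = (λ x∈ℤ[θ] → R⇒𝒪 (ℤ[]⇒R R-θ x∈ℤ[θ])) , λ x∈𝒪 → let v , x≈v = 𝒪⇒R x∈𝒪 in
        Vec.toList v , trans x≈v (trans (ev≈eval v θ) (sym (⟨⟩≈eval (Vec.toList v) θ)))

      powers-independent : ∀ (k : Fin n → ℤ) → sum {n} (λ i → ιℤ (k i) * θ ^ toℕ i) ≈ 0# → ∀ i → k i ≡ 0ℤ
      powers-independent k sum≈0 i = ≡.trans (≡.sym (Vec.lookup∘tabulate k i))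
        (independent (tabulate k) (trans (ev-tabulate k θ) sum≈0) i)

      integralBasis : K.IsBasis ℤ.+-*-rawRing ιℤ K.𝒪 {n} (λ i → θ ^ toℕ i)
      integralBasis = record
        { member      = λ i → R⇒𝒪 (R-^ R-θ (toℕ i))
        ; spanning    = λ x∈𝒪 → let v , x≈v = 𝒪⇒R x∈𝒪 in lookup v , trans x≈v (ev-sum v θ)
        ; independent = powers-independent
        }

      -- `Monogenic` also records the degree of K, so the same powers of θ have to form a ℚ-basis.
      rationalBasis : K.IsBasis ℚ.+-*-rawRing ι U {n} (λ i → θ ^ toℕ i)
      rationalBasis = record
        { member      = λ _ → tt
        ; spanning    = λ {x} _ → rational-coordinates (fractional x)
        ; independent = rational-independent
        }
        where
        rational-coordinates : ∀ {x} → Fractional x → Σ[ k ∈ (Fin n → ℚ) ] x ≈ sum {n} (λ i → ι (k i) * θ ^ toℕ i)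
        rational-coordinates {x} (D , D≢0 , v , Dx≈v) = (λ i → D⁻¹ ℚ.* fromℤ (lookup v i)) , (begin
          x                                                          ≈⟨ trans (*-congʳ (trans (ι-cong D⁻¹D≡1) ι-1)) (*-identityˡ x) ⟨
          ι (D⁻¹ ℚ.* fromℤ D) * x                                    ≈⟨ trans (*-congʳ (ι-* D⁻¹ (fromℤ D))) (*-assoc _ _ _) ⟩
          ι D⁻¹ * (ιℤ D * x)                                         ≈⟨ *-congˡ (trans Dx≈v (ev-sum v θ)) ⟩
          ι D⁻¹ * sum {n} (λ i → ιℤ (lookup v i) * θ ^ toℕ i)
            ≈⟨ *-distribˡ-sum {n} (ι D⁻¹) (λ i → ιℤ (lookup v i) * θ ^ toℕ i) ⟩
          sum {n} (λ i → ι D⁻¹ * (ιℤ (lookup v i) * θ ^ toℕ i))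
            ≈⟨ sum-cong-≋ {n} (λ i → trans (sym (*-assoc (ι D⁻¹) (ιℤ (lookup v i)) (θ ^ toℕ i)))
                 (*-congʳ {θ ^ toℕ i} (sym (ι-* D⁻¹ (fromℤ (lookup v i)))))) ⟩
          sum {n} (λ i → ι (D⁻¹ ℚ.* fromℤ (lookup v i)) * θ ^ toℕ i) ∎)
          where
          D⁻¹ = proj₁ (ι-inverse {fromℤ D} (λ D≡0 → D≢0 (fromℤ-injective D≡0)))
          D⁻¹D≡1 = proj₂ (ι-inverse {fromℤ D} (λ D≡0 → D≢0 (fromℤ-injective D≡0)))
        rational-independent : ∀ (k : Fin n → ℚ) → sum {n} (λ i → ι (k i) * θ ^ toℕ i) ≈ 0# → ∀ i → k i ≡ 0ℚ
        rational-independent k sum≈0 i = let D , D≢0 , z , z≡ = common-denominator k in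
          ι-injective (ιℤ-cancel D≢0 (begin
            ιℤ D * ι (k i)       ≈⟨ trans (ι-cong (z≡ i)) (ι-* (fromℤ D) (k i)) ⟨
            ιℤ (z i)             ≈⟨ ιℤ-cong (powers-independent z (scaled D z z≡) i) ⟩
            ιℤ 0ℤ                ≈⟨ ι-0 ⟩
            0#                   ∎))
          where
          scaled : ∀ D (z : Fin n → ℤ) → (∀ i → fromℤ (z i) ≡ fromℤ D ℚ.* k i) → sum {n} (λ i → ιℤ (z i) * θ ^ toℕ i) ≈ 0#
          scaled D z z≡ = begin
            sum {n} (λ i → ιℤ (z i) * θ ^ toℕ i)
              ≈⟨ sum-cong-≋ {n} (λ i → trans (*-congʳ {θ ^ toℕ i} (trans (ι-cong (z≡ i)) (ι-* (fromℤ D) (k i)))) (*-assoc (ιℤ D) (ι (k i)) (θ ^ toℕ i))) ⟩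
            sum {n} (λ i → ιℤ D * (ι (k i) * θ ^ toℕ i))    ≈⟨ *-distribˡ-sum {n} (ιℤ D) (λ i → ι (k i) * θ ^ toℕ i) ⟨
            ιℤ D * sum {n} (λ i → ι (k i) * θ ^ toℕ i)      ≈⟨ trans (*-congˡ sum≈0) (zeroʳ _) ⟩
            0#                                              ∎

      monogenic : K.Monogenic
      monogenic = n , (_ , rationalBasis) , θ , θ∈𝒪 , integralBasis

theorem2p7 : ∀ {c ℓ₁ ℓ₂} (n u : ℕ) (a : ℤ) →
    3 ≤ n → 2 ≤ u → gcd u n ≡ 1 →
    SquareFree a →
    (∀ p → Prime p → p ∣ n → (+ p) ℤ.∣ a) →
    Irreducibleℚ (ℤ[x]→ℚ[x] (xⁿ-aᵘ n u a)) ×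
    (∀ (K : FieldExtension c ℓ₁ ℓ₂) → let open FieldExtension K in
    ∀ (α : Carrier) →
    (xⁿ-aᵘ n u a) ⟨ α ⟩ ≈ 0# →
    ℚ⟨ α ⟩ ≐ U →
    ¬ (ℤ[ α ] ≐ 𝒪) ×
    (∃[ θ ] (θ ∈ 𝒪) × (ℚ⟨ θ ⟩ ≐ U) × (ℤ[ θ ] ≐ 𝒪)) ×
    Monogenic)
theorem2p7 zero    u a ()
theorem2p7 (suc m) u a 3≤n 2≤u gcd≡1 squarefree radical =
  -- No field is given for this part: the root θ of xⁿ - a is the class of x in the model, and α =
  -- θᵘ is the root of xⁿ - aᵘ.
  Irreducibility.irreducible (ShiftModel.algebra m a) {m} {u} squarefree (ℕ.<⇒≤ 3≤n) radical′ (ShiftModel.Xⁿ≈a m a) gcd≡1 ,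
  λ K α F[α]≈0 ℚ⟨α⟩≐U →
    let open NumberField K
        open ℚAlgebraProperties algebra using (x-y≈0⇒x≈y; trans; sym)
        open IntegerPolynomials algebra using (eval-xⁿ-aᵘ)
        αⁿ≈aᵘ = x-y≈0⇒x≈y (trans (sym (eval-xⁿ-aᵘ (suc m) u a α)) (trans (sym (⟨⟩≈eval (xⁿ-aᵘ (suc m) u a) α)) F[α]≈0))
        open RadicalGenerator {m} {u} {a} squarefree 3≤n radical′ gcd≡1 α αⁿ≈aᵘ
        open Generated ℚ⟨α⟩≐U
    in ℤ[α]≠𝒪 2≤u , (θ , θ∈𝒪 , ℚ⟨θ⟩≐U , ℤ[θ]≐𝒪) , monogenic
  where
  radical′ : ∀ p → Prime p → p ℕ.∣ suc m → + p ∣ₛ a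
  radical′ p pr p∣n = ∣ᵤ⇒∣ (radical p pr p∣n)
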